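{- Let $\mathcal{B}$, $\mathbb{P}$ be as in the context and $q\ge1$. The denominator $D(\mathcal{B}^q,\mathcal{A}_{\mathbb{P}}^q)$ of the inside-out polytope equals the least common multiple of the denominators of: (1) points on rigid cycles of length at most $q$; (2) points on corner trajectories of length at most $q$ that start at corners; (3) self-crossing points of augmentations of corner trajectories or rigid cycles of length at most $q-1$; and (4) crossing points of augmentations of two distinct corner trajectories or rigid cycles whose lengths sum to at most $q-1$.
   Context: Board: $\mathcal{B}\subset\mathbb{R}^2$ is a convex polygon with rational corner coordinates, interior $\mathcal{B}^\circ$, boundary $\partial\mathcal{B}$; each side lies on a line $\alpha_1x+\alpha_2y=\beta$. Piece: $\mathbb{P}$ is a two-move rider with nonparallel basic moves $\mathbf{m}_1=(c_1,d_1)$, $\mathbf{m}_2=(c_2,d_2)$, each with relatively prime integer coordinates. For $\mathbf{z}=(\mathbf{z}_1,\dots,\mathbf{z}_q)\in\mathbb{R}^{2q}$, the attack equation of type $r$ between $i\neq j$ is the hyperplane $(\mathbf{z}_i-\mathbf{z}_j)\cdot(d_r,-c_r)=0$; $\mathcal{A}_{\mathbb{P}}^q$ is the arrangement of all of them. A fixation is a hyperplane $(\alpha_1,\alpha_2)\cdot\mathbf{z}_i=\beta$ with $\alpha_1x+\alpha_2y=\beta$ the line of a side of $\mathcal{B}$. A vertex of $(\mathcal{B}^q,\mathcal{A}_{\mathbb{P}}^q)$ is a point of $\mathcal{B}^q$ that is the unique common point of some collection of attack equations and fixations. The denominator of a rational point is the lcm of the denominators of its coordinates; $D(\mathcal{B}^q,\mathcal{A}_{\mathbb{P}}^q)$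 is the lcm of the denominators of all vertices. For a point $\mathbf{z}$, $\mathcal{H}(\mathbf{z})$ is the set of attack equations and fixations containing it; the rank of $\mathbf{z}\in\mathbb{R}^{2q}$ is the rank of the linear system $\mathcal{H}(\mathbf{z})$; full rank means rank $2q$. The rank of a finite set $\{\mathbf{p}_1,\dots,\mathbf{p}_k\}$ of distinct points is the rank of $(\mathbf{p}_1,\dots,\mathbf{p}_k)$. Dynamics: for $r\in\{1,2\}$, $s_r:\partial\mathcal{B}\to\partial\mathcal{B}$ sends $\mathbf{b}$ to itself if the line $\{\mathbf{b}+\lambda\mathbf{m}_r\}$ misses $\mathcal{B}^\circ$, and otherwise to the other point where that line meets $\partial\mathcal{B}$. An extended trajectory is a maximal sequence $(\mathbf{b}_i)_{i\in I}$ ($I\subseteq\mathbb{Z}$ an interval, possibly infinite) in $\partial\mathcal{B}$ with $\mathbf{b}_{i+1}=s_{r_i}(\mathbf{b}_i)\ne\mathbf{b}_i$, $r_i\in\{1,2\}$ alternating. A trajectory is a finite consecutive subsequence $[\mathbf{b}_1,\dots,\mathbf{b}_l]$ of distinct points of an extended trajectory; $l$ is its length; it starts at $\mathbf{b}_1$. A cyclical trajectory consists of $p$ consecutive points of an extended trajectory that is periodic with minimal period $p\ge2$; a rigid cycle is a cyclical trajectory whose point set has full rank. A corner trajectory is a trajectory containing a corner of $\mathcal{B}$. The augmentation of $[\mathbf{b}_1,\dots,\mathbf{b}_l]$ adds the preceding point $\mathbf{b}_0$ and following point $\mathbf{b}_{l+1}$ of its extended trajectory, when they exist. A crossing point of two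 such sequences is a point of $\mathcal{B}^\circ$ lying on a segment between consecutive points of each; if the two sequences are the same it is a self-crossing point.
   Formalization: Crossing and self-crossing points are required to lie on two non-parallel segments; under the literal definition every interior point of a shared segment would count, giving unbounded denominators. -}

module Defs where

open import Data.Nat as ℕ using (ℕ; zero; suc; _≤_)
open import Data.Nat.DivMod using (_mod_)
open import Data.Nat.GCD using (gcd)
open import Data.Nat.LCM using (lcm)
open import Data.Nat.Divisibility using (_∣_)
open import Data.Integer as ℤ using (ℤ; ∣_∣)
open import Data.Rational as ℚ using (ℚ; 0ℚ; 1ℚ; _+_; _*_; _-_; _/_)
open import Data.Fin using (Fin; toℕ)
open import Data.List using (List; []; _∷_; _++_; length; lookup)
open import Data.List.Membership.Propositional using (_∈_)
open import Data.List.Relation.Unary.All using (All)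
open import Data.List.Relation.Unary.Any using (Any)
open import Data.List.Relation.Unary.Unique.Propositional using (Unique)
open import Data.Product using (Σ; ∃; ∃-syntax; _×_; _,_; proj₁; proj₂)
open import Data.Sum using (_⊎_)
open import Data.Unit using (⊤)
open import Relation.Nullary using (¬_)
open import Relation.Binary.PropositionalEquality using (_≡_; _≢_)

Pt : Set
Pt = ℚ × ℚ

_+ᵖ_ : Pt → Pt → Pt
(a , b) +ᵖ (c , d) = (a + c , b + d)

_-ᵖ_ : Pt → Pt → Pt
(a , b) -ᵖ (c , d) = (a - c , b - d)

_·ᵖ_ : ℚ → Pt → Pt
t ·ᵖ (a , b) = (t * a , t * b)

cross : Pt → Pt → ℚ
cross (a , b) (c , d) = a * d - b * c

dot : Pt → Pt → ℚ
dot (a , b) (c , d) = a * c + b * d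

ℤ→ℚ : ℤ → ℚ
ℤ→ℚ z = z / 1

next : ∀ {n} → Fin n → Fin n
next {suc m} k = suc (toℕ k) mod (suc m)

-- Convex polygon with rational corners, listed counterclockwise
-- (strict convexity: every corner other than k, k+1 lies strictly to
-- the left of the directed side from corner k to corner k+1).

record Board : Set where
  field
    n       : ℕ
    corner  : Fin n → Pt
    three≤n : 3 ≤ n
    convex  : ∀ (k j : Fin n) → j ≢ k → j ≢ next k →
              ℚ._<_ 0ℚ (cross (corner (next k) -ᵖ corner k) (corner j -ᵖ corner k))

module _ (B : Board) where
  open Board B

  -- side value: ≥ 0 on the inner side of side k, = 0 on its line
  sideVal : Fin n → Pt → ℚ
  sideVal k p = cross (corner (next k) -ᵖ corner k) (p -ᵖ corner k)

  -- the line of side k written as α₁x + α₂y = β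
  sideα : Fin n → Pt
  sideα k = let (dx , dy) = corner (next k) -ᵖ corner k in (ℚ.- dy , dx)

  sideβ : Fin n → ℚ
  sideβ k = dot (sideα k) (corner k)

  InB : Pt → Set
  InB p = ∀ k → ℚ._≤_ 0ℚ (sideVal k p)

  Interior : Pt → Set
  Interior p = ∀ k → ℚ._<_ 0ℚ (sideVal k p)

  OnBoundary : Pt → Set
  OnBoundary p = InB p × ¬ Interior p

  IsCorner : Pt → Set
  IsCorner p = ∃[ k ] corner k ≡ p

record Piece : Set where
  field
    c₁ d₁ c₂ d₂ : ℤ
    coprime₁    : gcd ∣ c₁ ∣ ∣ d₁ ∣ ≡ 1
    coprime₂    : gcd ∣ c₂ ∣ ∣ d₂ ∣ ≡ 1
    nonparallel : ℤ._-_ (ℤ._*_ c₁ d₂) (ℤ._*_ c₂ d₁) ≢ ℤ.+ 0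

data Move : Set where
  mv₁ mv₂ : Move

other : Move → Move
other mv₁ = mv₂
other mv₂ = mv₁

module _ (P : Piece) where
  open Piece P

  move : Move → Pt
  move mv₁ = (ℤ→ℚ c₁ , ℤ→ℚ d₁)
  move mv₂ = (ℤ→ℚ c₂ , ℤ→ℚ d₂)

  normal : Move → Pt
  normal mv₁ = (ℤ→ℚ d₁ , ℚ.- ℤ→ℚ c₁)
  normal mv₂ = (ℤ→ℚ d₂ , ℚ.- ℤ→ℚ c₂)

module _ (B : Board) (P : Piece) where
  open Board B

  data Hyp (q : ℕ) : Set where
    attack : (r : Move) (i j : Fin q) → i ≢ j → Hyp q
    fixation : (k : Fin n) (i : Fin q) → Hyp q

  Sat : ∀ {q} → Hyp q → (Fin q → Pt) → Set
  Sat (attack r i j _) z = dot (z i -ᵖ z j) (normal P r) ≡ 0ℚ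
  Sat (fixation k i)   z = dot (sideα B k) (z i) ≡ sideβ B k

  Vertex : ∀ {q} → (Fin q → Pt) → Set
  Vertex {q} z = (∀ i → InB B (z i)) ×
    Σ (List (Hyp q)) λ C → All (λ h → Sat h z) C ×
      (∀ (w : Fin q → Pt) → All (λ h → Sat h w) C → ∀ i → w i ≡ z i)

  -- full rank of z : the linear system H(z) (all hyperplanes containing z)
  -- has rank 2q, i.e. z is its unique solution
  FullRank : ∀ {q} → (Fin q → Pt) → Set
  FullRank {q} z = ∀ (w : Fin q → Pt) → (∀ h → Sat h z → Sat h w) → ∀ i → w i ≡ z i

  -- Dynamics: Step r b b' means b' = s_r(b) ≠ b
  -- (the line through b in direction m_r meets B°, and b' is the other
  -- point where it meets ∂B)

  Step : Move → Pt → Pt → Set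
  Step r b b' = OnBoundary B b' × b' ≢ b ×
    (∃[ λ' ] b' ≡ b +ᵖ (λ' ·ᵖ move P r)) ×
    (∃[ μ ] Interior B (b +ᵖ (μ ·ᵖ move P r)))

  AltChain : Move → List Pt → Set
  AltChain r (b ∷ b' ∷ rest) = Step r b b' × AltChain (other r) (b' ∷ rest)
  AltChain r _ = ⊤

  outMove : Move → List Pt → Move
  outMove r (b ∷ b' ∷ rest) = outMove (other r) (b' ∷ rest)
  outMove r _ = r

  lastPt : Pt → List Pt → Pt
  lastPt b [] = b
  lastPt b (b' ∷ rest) = lastPt b' rest

  TrajectoryFrom : Move → Pt → List Pt → Set
  TrajectoryFrom r b rest = Unique (b ∷ rest) × All (OnBoundary B) (b ∷ rest) ×
    AltChain r (b ∷ rest)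

  Trajectory : List Pt → Set
  Trajectory [] = ⊥'
    where open import Data.Empty renaming (⊥ to ⊥')
  Trajectory (b ∷ rest) = ∃[ r ] TrajectoryFrom r b rest

  CornerTrajectory : List Pt → Set
  CornerTrajectory L = Trajectory L × Any (IsCorner B) L

  CornerTrajectoryFromCorner : List Pt → Set
  CornerTrajectoryFromCorner [] = ⊥'
    where open import Data.Empty renaming (⊥ to ⊥')
  CornerTrajectoryFromCorner (b ∷ rest) = Trajectory (b ∷ rest) × IsCorner B b

  -- cyclical trajectory: p ≥ 2 distinct consecutive points of a periodic
  -- extended trajectory of minimal period p
  CyclicalTrajectory : List Pt → Set
  CyclicalTrajectory [] = ⊥'
    where open import Data.Empty renaming (⊥ to ⊥')
  CyclicalTrajectory (b ∷ rest) = 2 ≤ length (b ∷ rest) ×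
    ∃[ r ] TrajectoryFrom r b rest × outMove r (b ∷ rest) ≡ other r ×
      Step (other r) (lastPt b rest) b

  tuple : (L : List Pt) → Fin (length L) → Pt
  tuple L = lookup L

  RigidCycle : List Pt → Set
  RigidCycle L = CyclicalTrajectory L × FullRank (tuple L)

  Neighbour : Move → Pt → List Pt → Set
  Neighbour r b xs = (∃[ b' ] Step r b b' × xs ≡ b' ∷ []) ⊎
                     ((∀ b' → ¬ Step r b b') × xs ≡ [])

  Augmentation : List Pt → List Pt → Set
  Augmentation [] A = ⊥'
    where open import Data.Empty renaming (⊥ to ⊥')
  Augmentation (b ∷ rest) A = ∃[ r ] TrajectoryFrom r b rest ×
    Σ (List Pt) λ pre → Σ (List Pt) λ post →
      Neighbour (other r) b pre × Neighbour (outMove r (b ∷ rest)) (lastPt b rest) post ×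
      A ≡ pre ++ (b ∷ rest) ++ post

  segments : List Pt → List (Pt × Pt)
  segments (a ∷ b ∷ rest) = (a , b) ∷ segments (b ∷ rest)
  segments _ = []

  OnSegment : Pt → Pt × Pt → Set
  OnSegment p (a , b) = ∃[ t ] ℚ._≤_ 0ℚ t × ℚ._≤_ t 1ℚ × p ≡ a +ᵖ (t ·ᵖ (b -ᵖ a))

  NonParallel : Pt × Pt → Pt × Pt → Set
  NonParallel (a₁ , b₁) (a₂ , b₂) = cross (b₁ -ᵖ a₁) (b₂ -ᵖ a₂) ≢ 0ℚ

  CrossingPoint : List Pt → List Pt → Pt → Set
  CrossingPoint A₁ A₂ p = Interior B p ×
    ∃[ s₁ ] ∃[ s₂ ] s₁ ∈ segments A₁ × s₂ ∈ segments A₂ ×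
      OnSegment p s₁ × OnSegment p s₂ × NonParallel s₁ s₂

  SelfCrossingPoint : List Pt → Pt → Set
  SelfCrossingPoint A p = CrossingPoint A A p

  CornerOrRigid : List Pt → Set
  CornerOrRigid L = CornerTrajectory L ⊎ RigidCycle L

denPt : Pt → ℕ
denPt (x , y) = lcm (ℚ.denominatorℕ x) (ℚ.denominatorℕ y)

denConf : ∀ {q} → (Fin q → Pt) → ℕ
denConf {zero} z = 1
denConf {suc q} z = lcm (denPt (z Data.Fin.zero)) (denConf (λ i → z (Data.Fin.suc i)))
  where import Data.Fin

IsLcmOf : (ℕ → Set) → ℕ → Set
IsLcmOf S D = (∀ m → S m → m ∣ D) × (∀ M → (∀ m → S m → m ∣ M) → D ∣ M)

module _ (B : Board) (P : Piece) (q : ℕ) where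

  VertexDen : ℕ → Set
  VertexDen m = ∃[ z ] Vertex B P {q} z × m ≡ denConf z

  SpecialPoint : Pt → Set
  SpecialPoint p =
      (∃[ L ] RigidCycle B P L × length L ≤ q × p ∈ L)
    ⊎ (∃[ L ] CornerTrajectoryFromCorner B P L × length L ≤ q × p ∈ L)
    ⊎ (∃[ L ] ∃[ A ] CornerOrRigid B P L × suc (length L) ≤ q ×
         Augmentation B P L A × SelfCrossingPoint B P A p)
    ⊎ (∃[ L₁ ] ∃[ L₂ ] ∃[ A₁ ] ∃[ A₂ ] L₁ ≢ L₂ ×
         CornerOrRigid B P L₁ × CornerOrRigid B P L₂ ×
         suc (length L₁ ℕ.+ length L₂) ≤ q ×
         Augmentation B P L₁ A₁ × Augmentation B P L₂ A₂ ×
         CrossingPoint B P A₁ A₂ p)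

  SpecialDen : ℕ → Set
  SpecialDen m = ∃[ p ] SpecialPoint p × m ≡ denPt p

{-# OPTIONS --safe #-}

-- The values of the normals of the two moves are coordinates on the plane; attacks identify coordinates of
-- different pieces and fixations relate the two coordinates of a piece on a side. A line in the direction of a
-- move that enters the interior of the board carries exactly two boundary points, so the boundary points of a
-- configuration split into maximal chains of steps of s₁ and s₂ within the configuration. In a full-rank
-- configuration every such chain has full rank by itself. If it closes up, it is a rigid cycle; otherwise it
-- must contain a corner, because a chain of l non-corner points carries only l equations in l + 1 coordinates.
-- An interior point of the configuration needs a boundary point on each of its two lines, hence it is a crossing
-- point of the augmentations of the chains through them (one chain, or two disjoint ones).
-- Conversely corners and rigid cycles are determined by their hyperplanes, steps and crossings propagate this,
-- and repeated pieces fill up a configuration to q. The least common multiple exists because the vertices are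
-- enumerated by elimination applied to the finitely many sets of hyperplanes.

module Submission where

open import Defs
open import Data.Nat using (ℕ; _≤_)
open import Data.Product using (Σ; _×_)
open import Data.Empty using (⊥; ⊥-elim)
open import Data.Fin as Fin using (Fin; zero; suc; toℕ; fromℕ; fromℕ<; inject₁)
import Data.Fin.Properties as Finₚ
open import Data.Integer as ℤ using (ℤ)
import Data.Integer.Properties as ℤₚ
open import Data.List using (List; []; _∷_; _++_; length; lookup; map; concatMap; filter; allFin; foldr)
import Data.List.Membership.DecPropositional as DecMembership
open import Data.List.Membership.Propositional using (_∈_; _∉_; find; lose)
open import Data.List.Membership.Propositional.Properties
  using (∈-lookup; ∈-map⁺; ∈-filter⁺; ∈-concatMap⁺; ∈-concatMap⁻; ∈-allFin; ∈-++⁺ˡ; ∈-++⁺ʳ; ∈-++⁻)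
import Data.List.Properties as Listₚ
open import Data.List.Relation.Binary.Permutation.Propositional using (_↭_; ↭-refl; ↭-sym; ↭-trans; ↭⇒↭ₛ)
import Data.List.Relation.Binary.Permutation.Propositional.Properties as ↭ₚ
import Data.List.Relation.Binary.Permutation.Setoid.Properties as Permutationₛ
open import Data.List.Relation.Unary.All as All using (All; []; _∷_)
import Data.List.Relation.Unary.All.Properties as Allₚ
open import Data.List.Relation.Unary.AllPairs using ([]; _∷_)
open import Data.List.Relation.Unary.Any as Any using (Any; here; there)
import Data.List.Relation.Unary.Any.Properties as Anyₚ
open import Data.List.Relation.Unary.Unique.Propositional using (Unique)
import Data.List.Relation.Unary.Unique.Propositional.Properties as Uniqueₚ
open import Data.Nat as ℕ using (zero; suc; z≤n; s≤s)
open import Data.Nat.Divisibility using (_∣_; ∣-trans; 1∣_)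
open import Data.Nat.DivMod using (_%_; m<n⇒m%n≡m; n%n≡0; m%n<n)
open import Data.Nat.LCM using (lcm; lcm-least; m∣lcm[m,n]; n∣lcm[m,n])
import Data.Nat.Properties as ℕₚ
open import Data.Product using (∃-syntax; _,_; proj₁; proj₂)
open import Data.Product.Properties using (≡-dec)
open import Data.Rational as ℚ using (ℚ; 0ℚ; 1ℚ; ½; _+_; _*_; _-_; -_) renaming (_≤_ to _≤ℚ_; _<_ to _<ℚ_)
import Data.Rational.Properties as ℚₚ
open import Data.Rational.Solver using (module +-*-Solver)
open import Data.Rational.Unnormalised as ℚᵘ using (mkℚᵘ; *≡*)
import Data.Rational.Unnormalised.Properties as ℚᵘₚ
open import Data.Sum using (_⊎_; inj₁; inj₂)
open import Data.Unit using (tt)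
open import Data.Vec as Vec using (Vec; []; _∷_)
open import Function using (_∘_)
open import Relation.Binary.Definitions using (Tri; tri<; tri≈; tri>; DecidableEquality)
open import Relation.Binary.PropositionalEquality
open import Relation.Nullary using (¬_; Dec; yes; no; contradiction; ¬?)
open import Relation.Nullary.Decidable using (_×-dec_)
open +-*-Solver using (solve; _:+_; _:*_; _:-_; :-_; _:=_; con)

-- Denominators enter only at the end: what is proved is that a point is special exactly when some
-- vertex has a piece there, so the two families of denominators have the same common multiples. The
-- obstacle is an attack between boundary points of different chains, which could couple their
-- equations. Two distinct boundary points on a line along a move are either joined by a step or lie
-- on one side parallel to that move. In the second case the fixations to that side alone already
-- force the line coordinate, and the attack adds nothing. This is why a chain can be cut out of its
-- configuration, and why an open chain without corners keeps its one degree of freedom. The bound q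
-- - 1 in (3) and (4) leaves one piece for the interior crossing point itself. Coordinates are
-- rational, so lying on the boundary, being linked and belonging to a chain are decidable. Chains
-- are found by finite search among the places of the configuration instead of following an extended
-- trajectory, which may be infinite.

inverse : ∀ {a} → a ≢ 0ℚ → ∃[ b ] b * a ≡ 1ℚ
inverse {a} a≢0 = (ℚ.1/ a) , ℚₚ.*-inverseˡ a
  where instance _ = ℚ.≢-nonZero a≢0

a*b≡0⇒b≡0 : ∀ {a b} → a ≢ 0ℚ → a * b ≡ 0ℚ → b ≡ 0ℚ
a*b≡0⇒b≡0 {a} {b} a≢0 ab≡0 with inverse a≢0
... | c , ca≡1 = begin
  b            ≡⟨ solve 1 (λ b → b := con 1ℚ :* b) refl b ⟩
  1ℚ * b       ≡⟨ cong (_* b) (sym ca≡1) ⟩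
  c * a * b    ≡⟨ ℚₚ.*-assoc c a b ⟩
  c * (a * b)  ≡⟨ cong (c *_) ab≡0 ⟩
  c * 0ℚ       ≡⟨ ℚₚ.*-zeroʳ c ⟩
  0ℚ           ∎
  where open ≡-Reasoning

a-b≡0⇒a≡b : ∀ {a b} → a - b ≡ 0ℚ → a ≡ b
a-b≡0⇒a≡b {a} {b} eq = begin
  a          ≡⟨ solve 2 (λ a b → a := (a :- b) :+ b) refl a b ⟩
  a - b + b  ≡⟨ cong (_+ b) eq ⟩
  0ℚ + b     ≡⟨ ℚₚ.+-identityˡ b ⟩
  b          ∎
  where open ≡-Reasoning

a≡b⇒a-b≡0 : ∀ {a b} → a ≡ b → a - b ≡ 0ℚ
a≡b⇒a-b≡0 {a} refl = ℚₚ.+-inverseʳ a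

x+1≢x : ∀ {x} → x + 1ℚ ≢ x
x+1≢x {x} eq = ℚₚ.1≢0 (trans (solve 1 (λ x → con 1ℚ := (x :+ con 1ℚ) :- x) refl x) (a≡b⇒a-b≡0 eq))

-- Signs and order in ℚ

pos* : ∀ {a b} → 0ℚ <ℚ a → 0ℚ <ℚ b → 0ℚ <ℚ a * b
pos* {a} {b} p q = ℚₚ.positive⁻¹ (a * b) {{ℚₚ.pos*pos⇒pos a {{ℚ.positive p}} b {{ℚ.positive q}}}}

nonNeg* : ∀ {a b} → 0ℚ ≤ℚ a → 0ℚ ≤ℚ b → 0ℚ ≤ℚ a * b
nonNeg* {a} {b} p q =
  ℚₚ.nonNegative⁻¹ (a * b) {{ℚₚ.nonNeg*nonNeg⇒nonNeg a {{ℚ.nonNegative p}} b {{ℚ.nonNegative q}}}}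

pos-cancel : ∀ {a b} → 0ℚ <ℚ a → 0ℚ <ℚ a * b → 0ℚ <ℚ b
pos-cancel {a} p q = ℚₚ.*-cancelˡ-<-nonNeg a {{ℚₚ.pos⇒nonNeg a {{ℚ.positive p}}}}
  (subst₂ _<ℚ_ (sym (ℚₚ.*-zeroʳ a)) refl q)

nonNeg-cancel : ∀ {a b} → 0ℚ <ℚ a → 0ℚ ≤ℚ a * b → 0ℚ ≤ℚ b
nonNeg-cancel {a} p q = ℚₚ.*-cancelˡ-≤-pos a {{ℚ.positive p}} (subst₂ _≤ℚ_ (sym (ℚₚ.*-zeroʳ a)) refl q)

pos+nonNeg : ∀ {a b} → 0ℚ <ℚ a → 0ℚ ≤ℚ b → 0ℚ <ℚ a + b
pos+nonNeg p q = subst₂ _<ℚ_ (ℚₚ.+-identityˡ 0ℚ) refl (ℚₚ.+-mono-<-≤ p q)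

nonNeg+ : ∀ {a b} → 0ℚ ≤ℚ a → 0ℚ ≤ℚ b → 0ℚ ≤ℚ a + b
nonNeg+ p q = subst₂ _≤ℚ_ (ℚₚ.+-identityˡ 0ℚ) refl (ℚₚ.+-mono-≤ p q)

a<b⇒0<b-a : ∀ {a b} → a <ℚ b → 0ℚ <ℚ b - a
a<b⇒0<b-a {a} p = subst₂ _<ℚ_ (ℚₚ.+-inverseʳ a) refl (ℚₚ.+-monoˡ-< (- a) p)

a≤b⇒0≤b-a : ∀ {a b} → a ≤ℚ b → 0ℚ ≤ℚ b - a
a≤b⇒0≤b-a {a} p = subst₂ _≤ℚ_ (ℚₚ.+-inverseʳ a) refl (ℚₚ.+-monoˡ-≤ (- a) p)

0≤b-a⇒a≤b : ∀ {a b} → 0ℚ ≤ℚ b - a → a ≤ℚ b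
0≤b-a⇒a≤b {a} {b} p = subst₂ _≤ℚ_ (ℚₚ.+-identityˡ a)
  (solve 2 (λ a b → (b :- a) :+ a := b) refl a b) (ℚₚ.+-monoˡ-≤ a p)

neg⇒0<- : ∀ {a} → a <ℚ 0ℚ → 0ℚ <ℚ - a
neg⇒0<- {a} p = subst (0ℚ <ℚ_) (ℚₚ.+-identityˡ (- a)) (a<b⇒0<b-a p)

nonNeg-sum-zero : ∀ {a b} → 0ℚ ≤ℚ a → 0ℚ ≤ℚ b → a + b ≡ 0ℚ → a ≡ 0ℚ
nonNeg-sum-zero {a} {b} p q eq = ℚₚ.≤-antisym
  (0≤b-a⇒a≤b (subst (0ℚ ≤ℚ_) (trans (solve 2 (λ a b → b := (a :+ b) :- a) refl a b) (cong (_- a) eq)) q)) p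

≤0⇒≡0 : ∀ {a} → 0ℚ ≤ℚ a → ¬ (0ℚ <ℚ a) → a ≡ 0ℚ
≤0⇒≡0 p ¬q = ℚₚ.≤-antisym (ℚₚ.≮⇒≥ ¬q) p

-- Linear systems

infixl 6 _⊕_
_⊕_ : ∀ {N} → Vec ℚ N → Vec ℚ N → Vec ℚ N
_⊕_ = Vec.zipWith _+_

scale : ∀ {N} → ℚ → Vec ℚ N → Vec ℚ N
scale c = Vec.map (c *_)

_∙_ : ∀ {N} → Vec ℚ N → Vec ℚ N → ℚ
[]       ∙ []       = 0ℚ
(a ∷ as) ∙ (x ∷ xs) = a * x + as ∙ xs

∙-⊕ : ∀ {N} (a b x : Vec ℚ N) → (a ⊕ b) ∙ x ≡ a ∙ x + b ∙ x
∙-⊕ []       []       []       = sym (ℚₚ.+-identityˡ 0ℚ)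
∙-⊕ (a ∷ as) (b ∷ bs) (x ∷ xs) = trans (cong ((a + b) * x +_) (∙-⊕ as bs xs))
  (solve 5 (λ a b x s t → (a :+ b) :* x :+ (s :+ t) := (a :* x :+ s) :+ (b :* x :+ t)) refl a b x (as ∙ xs) (bs ∙ xs))

∙-scale : ∀ {N} c (a x : Vec ℚ N) → scale c a ∙ x ≡ c * (a ∙ x)
∙-scale c []       []       = sym (ℚₚ.*-zeroʳ c)
∙-scale c (a ∷ as) (x ∷ xs) = trans (cong (c * a * x +_) (∙-scale c as xs))
  (solve 4 (λ c a x s → c :* a :* x :+ c :* s := c :* (a :* x :+ s)) refl c a x (as ∙ xs))

Equation : ℕ → Set
Equation N = Vec ℚ N × ℚ

Solves : ∀ {N} → Vec ℚ N → Equation N → Set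
Solves x (a , β) = a ∙ x ≡ β

UniqueSolution : ∀ {N} → List (Equation N) → Vec ℚ N → Set
UniqueSolution E x = All (Solves x) E × (∀ y → All (Solves y) E → y ≡ x)

head≢0 : ∀ {N} → Equation (suc N) → Set
head≢0 (a ∷ _ , _) = a ≢ 0ℚ

-- Gaussian elimination of the leading variable x by the pivot equation a₀x + a ∙ xs = β, with `b`
-- the inverse of the pivot coefficient.
module Elimination {N} (a₀ : ℚ) (a : Vec ℚ N) (β : ℚ) (b : ℚ) (ba₀≡1 : b * a₀ ≡ 1ℚ) where

  pivot : Vec ℚ N → ℚ
  pivot xs = b * (β - a ∙ xs)

  pivot-unique : ∀ x xs → Solves (x ∷ xs) (a₀ ∷ a , β) → x ≡ pivot xs
  pivot-unique x xs eq = begin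
    x                        ≡⟨ solve 1 (λ x → x := con 1ℚ :* x) refl x ⟩
    1ℚ * x                   ≡⟨ cong (_* x) (sym ba₀≡1) ⟩
    b * a₀ * x               ≡⟨ solve 4 (λ b a x s → b :* a :* x := b :* (a :* x :+ s :- s)) refl b a₀ x s ⟩
    b * (a₀ * x + s - s)     ≡⟨ cong (λ u → b * (u - s)) eq ⟩
    b * (β - s)              ∎
    where open ≡-Reasoning ; s = a ∙ xs

  -- Substitutes `pivot` for the leading variable. The pivot equation itself becomes 0 = 0, so it
  -- may stay in the list.
  reduce : Equation (suc N) → Equation N
  reduce (c₀ ∷ c , γ) = c ⊕ scale (- (c₀ * b)) a , γ - c₀ * b * β

  reduce-∙ : ∀ c₀ c xs → (c ⊕ scale (- (c₀ * b)) a) ∙ xs + c₀ * b * β ≡ (c₀ ∷ c) ∙ (pivot xs ∷ xs)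
  reduce-∙ c₀ c xs = trans
    (cong (_+ c₀ * b * β) (trans (∙-⊕ c (scale (- (c₀ * b)) a) xs) (cong (c ∙ xs +_) (∙-scale (- (c₀ * b)) a xs))))
    (solve 5 (λ c b β s t → s :+ :- (c :* b) :* t :+ c :* b :* β := c :* (b :* (β :- t)) :+ s) refl c₀ b β (c ∙ xs) (a ∙ xs))

  reduce⁺ : ∀ xs e → Solves (pivot xs ∷ xs) e → Solves xs (reduce e)
  reduce⁺ xs (c₀ ∷ c , γ) eq = begin
    L                       ≡⟨ solve 2 (λ l d → l := l :+ d :- d) refl L D ⟩
    L + D - D               ≡⟨ cong (_- D) (trans (reduce-∙ c₀ c xs) eq) ⟩
    γ - D                   ∎
    where open ≡-Reasoning ; L = (c ⊕ scale (- (c₀ * b)) a) ∙ xs ; D = c₀ * b * β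

  reduce⁻ : ∀ xs e → Solves xs (reduce e) → Solves (pivot xs ∷ xs) e
  reduce⁻ xs (c₀ ∷ c , γ) eq = begin
    (c₀ ∷ c) ∙ (pivot xs ∷ xs)  ≡⟨ sym (reduce-∙ c₀ c xs) ⟩
    L + D                       ≡⟨ cong (_+ D) eq ⟩
    γ - D + D                   ≡⟨ solve 2 (λ g d → g :- d :+ d := g) refl γ D ⟩
    γ                           ∎
    where open ≡-Reasoning ; L = (c ⊕ scale (- (c₀ * b)) a) ∙ xs ; D = c₀ * b * β

  extend : ∀ {E} xs → All (Solves xs) (map reduce E) → All (Solves (pivot xs ∷ xs)) E
  extend xs sat = All.tabulate (λ {e} e∈ → reduce⁻ xs e (All.lookup sat (∈-map⁺ reduce e∈)))

  restrict : ∀ {E} → (a₀ ∷ a , β) ∈ E → ∀ x xs → All (Solves (x ∷ xs)) E → All (Solves xs) (map reduce E)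
  restrict e∈E x xs sat = Allₚ.map⁺ (All.map (λ {e} eq → reduce⁺ xs e
    (subst (λ u → Solves (u ∷ xs) e) (pivot-unique x xs (All.lookup sat e∈E)) eq)) sat)

  -- Solutions of E and of the reduced system correspond one to one, `pivot` supplying the lost
  -- coordinate; hence uniqueness passes in both directions.
  eliminate : ∀ {E} → (a₀ ∷ a , β) ∈ E → Dec (∃[ xs ] UniqueSolution (map reduce E) xs) →
              Dec (∃[ x ] UniqueSolution E x)
  eliminate {E} e∈E (yes (xs , sat , uniq)) = yes (pivot xs ∷ xs , extend xs sat , unique)
    where
    unique : ∀ y → All (Solves y) E → y ≡ pivot xs ∷ xs
    unique (y ∷ ys) ysat = cong₂ _∷_ (trans (pivot-unique y ys (All.lookup ysat e∈E)) (cong pivot ys≡)) ys≡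
      where
      ys≡ : ys ≡ xs
      ys≡ = uniq ys (restrict e∈E y ys ysat)
  eliminate {E} e∈E (no ¬unique) = no λ { (x ∷ xs , sat , uniq) →
    ¬unique (xs , restrict e∈E x xs sat , λ ys ysat → cong Vec.tail (uniq (pivot ys ∷ ys) (extend ys ysat))) }

uniqueSolution? : ∀ {N} (E : List (Equation N)) → Dec (∃[ x ] UniqueSolution E x)
uniqueSolution? {zero} E with All.all? (λ e → ([] ∙ []) ℚₚ.≟ proj₂ e) E
... | yes sat = yes ([] , All.map (λ {e} → lift e) sat , λ { [] _ → refl })
  where
  lift : (e : Equation 0) → [] ∙ [] ≡ proj₂ e → Solves [] e
  lift ([] , β) eq = eq
... | no ¬sat = no λ { ([] , sat , _) → ¬sat (All.map (λ {e} → lower e) sat) }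
  where
  lower : (e : Equation 0) → Solves [] e → [] ∙ [] ≡ proj₂ e
  lower ([] , β) eq = eq
uniqueSolution? {suc N} E with Any.any? head≢0? E
  where
  head≢0? : ∀ e → Dec (head≢0 e)
  head≢0? (a ∷ _ , _) = ¬? (a ℚₚ.≟ 0ℚ)
-- The leading variable occurs in no equation, so every solution can be shifted by 1 in it.
... | no none = no λ { (x ∷ xs , sat , uniq) →
        x+1≢x (cong Vec.head (uniq (x + 1ℚ ∷ xs) (shift x xs sat (Allₚ.¬Any⇒All¬ E none)))) }
  where
  shift₁ : ∀ x xs e → Solves (x ∷ xs) e → ¬ head≢0 e → Solves (x + 1ℚ ∷ xs) e
  shift₁ x xs (a ∷ as , β) eq ¬h with a ℚₚ.≟ 0ℚ
  ... | no a≢0 = contradiction a≢0 ¬h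
  ... | yes refl = trans (solve 2 (λ x s → con 0ℚ :* (x :+ con 1ℚ) :+ s := con 0ℚ :* x :+ s) refl x (as ∙ xs)) eq
  shift : ∀ x xs {E} → All (Solves (x ∷ xs)) E → All (¬_ ∘ head≢0) E → All (Solves (x + 1ℚ ∷ xs)) E
  shift x xs {E} sat ¬hs = All.zipWith (λ {e} p → shift₁ x xs e (proj₁ p) (proj₂ p)) (sat , ¬hs)
... | yes some = pivoting (find some)
  where
  pivoting : (∃[ e ] e ∈ E × head≢0 e) → Dec (∃[ x ] UniqueSolution E x)
  pivoting ((a₀ ∷ a , β) , e∈E , a₀≢0) = eliminate e∈E (uniqueSolution? (map reduce E))
    where
    open Elimination a₀ a β (proj₁ (inverse a₀≢0)) (proj₂ (inverse a₀≢0))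

-- Cyclic indices

-- Replaces the remainder in the definition of `next` by its two cases, an increment and the return
-- from the last index to 0.
next-cases : ∀ {n} (k : Fin n) →
             suc (toℕ k) ℕ.< n × toℕ (next k) ≡ suc (toℕ k) ⊎ suc (toℕ k) ≡ n × toℕ (next k) ≡ 0
next-cases {suc m} k with ℕₚ.m≤n⇒m<n∨m≡n (Finₚ.toℕ<n k)
... | inj₁ lt = inj₁ (lt , trans (Finₚ.toℕ-fromℕ< (m%n<n (suc (toℕ k)) (suc m))) (m<n⇒m%n≡m lt))
... | inj₂ eq = inj₂ (eq , trans (Finₚ.toℕ-fromℕ< (m%n<n (suc (toℕ k)) (suc m)))
                                 (trans (cong (_% suc m) eq) (n%n≡0 (suc m))))

next≢ : ∀ {n} (k : Fin n) → 3 ℕ.≤ n → next k ≢ k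
next≢ k 3≤n eq with next-cases k
... | inj₁ (_ , e) = ℕₚ.1+n≢n (trans (sym e) (cong toℕ eq))
... | inj₂ (e , z) = ℕₚ.<⇒≢ (ℕₚ.<-≤-trans (s≤s (s≤s z≤n)) 3≤n)
                       (trans (cong suc (trans (sym z) (cong toℕ eq))) e)

next²≢ : ∀ {n} (k : Fin n) → 3 ℕ.≤ n → next (next k) ≢ k
next²≢ k 3≤n eq with next-cases k | next-cases (next k)
... | inj₁ (_ , e) | inj₁ (_ , e′) = ℕₚ.m+1+n≢m (toℕ k) {1} (trans (ℕₚ.+-comm (toℕ k) 2)
                                       (trans (sym (trans e′ (cong suc e))) (cong toℕ eq)))
... | inj₁ (_ , e) | inj₂ (e′ , z) = ℕₚ.<⇒≢ 3≤n
        (trans (cong (λ i → suc (suc i)) (trans (sym z) (cong toℕ eq))) (trans (cong suc (sym e)) e′))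
... | inj₂ (e , z) | inj₁ (_ , e′) = ℕₚ.<⇒≢ 3≤n
        (trans (cong suc (trans (sym (trans e′ (cong suc z))) (cong toℕ eq))) e)
... | inj₂ (_ , z) | inj₂ (e′ , _) = ℕₚ.<⇒≢ (ℕₚ.<-≤-trans (s≤s (s≤s z≤n)) 3≤n) (trans (cong suc (sym z)) e′)

next-injective : ∀ {n} {j k : Fin n} → next j ≡ next k → j ≡ k
next-injective {j = j} {k} eq with next-cases j | next-cases k | cong toℕ eq
... | inj₁ (_ , e) | inj₁ (_ , e′) | q = Finₚ.toℕ-injective (ℕₚ.suc-injective (trans (sym e) (trans q e′)))
... | inj₁ (_ , e) | inj₂ (_ , e′) | q = contradiction (trans (sym e) (trans q e′)) ℕₚ.1+n≢0
... | inj₂ (_ , e) | inj₁ (_ , e′) | q = contradiction (trans (sym e′) (trans (sym q) e)) ℕₚ.1+n≢0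
... | inj₂ (e , _) | inj₂ (e′ , _) | q = Finₚ.toℕ-injective (ℕₚ.suc-injective (trans e (sym e′)))

previous : ∀ {n} (k : Fin n) → ∃[ j ] next j ≡ k
previous {suc m} zero with next-cases (fromℕ m)
... | inj₁ (lt , _) = contradiction (subst (ℕ._< suc m) (cong suc (Finₚ.toℕ-fromℕ m)) lt) (ℕₚ.<-irrefl refl)
... | inj₂ (_ , z)  = fromℕ m , Finₚ.toℕ-injective z
previous {suc m} (suc i) with next-cases (inject₁ i)
... | inj₁ (_ , e) = inject₁ i , Finₚ.toℕ-injective (trans e (cong suc (Finₚ.toℕ-inject₁ i)))
... | inj₂ (e , _) = contradiction (trans (cong suc (sym (Finₚ.toℕ-inject₁ i))) e) (ℕₚ.<⇒≢ (s≤s (Finₚ.toℕ<n i)))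

module _ {n} (F : Fin n → ℚ) (F↑ : ∀ k → F k ≤ℚ F (next k)) (z : Fin n) (z≡0 : toℕ z ≡ 0) where

  cyclic-lower : ∀ m k → toℕ k ≡ m → F z ≤ℚ F k
  cyclic-lower zero k eq = ℚₚ.≤-reflexive (cong F (Finₚ.toℕ-injective (trans z≡0 (sym eq))))
  cyclic-lower (suc m) k eq with previous k
  ... | j , refl with next-cases j
  ...   | inj₁ (_ , e) = ℚₚ.≤-trans (cyclic-lower m j (ℕₚ.suc-injective (trans (sym e) eq))) (F↑ j)
  ...   | inj₂ (_ , e) = contradiction (trans (sym eq) e) ℕₚ.1+n≢0

  -- Here `d` counts the steps from `k` to the last index, from which one more step returns to 0.
  cyclic-upper : ∀ d k → suc (toℕ k) ℕ.+ d ≡ n → F k ≤ℚ F z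
  cyclic-upper d k eq with next-cases k
  ... | inj₂ (_ , e) = ℚₚ.≤-trans (F↑ k) (ℚₚ.≤-reflexive (cong F (Finₚ.toℕ-injective (trans e (sym z≡0)))))
  cyclic-upper zero k eq | inj₁ (lt , e) =
    contradiction (trans (sym (ℕₚ.+-identityʳ _)) eq) (ℕₚ.<⇒≢ lt)
  cyclic-upper (suc d) k eq | inj₁ (lt , e) = ℚₚ.≤-trans (F↑ k) (cyclic-upper d (next k)
    (trans (cong (λ i → suc i ℕ.+ d) e) (trans (cong suc (sym (ℕₚ.+-suc (toℕ k) d))) eq)))

-- One full turn returns to the starting value, so none of the inequalities on the way can be
-- strict.
cyclic-constant : ∀ {n} (F : Fin n → ℚ) → (∀ k → F k ≤ℚ F (next k)) → ∀ j k → F j ≡ F k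
cyclic-constant {suc m} F F↑ j k = trans (const j) (sym (const k))
  where
  const : ∀ k → F k ≡ F zero
  const k = ℚₚ.≤-antisym (cyclic-upper F F↑ zero refl (suc m ℕ.∸ suc (toℕ k)) k (ℕₚ.m+[n∸m]≡n (Finₚ.toℕ<n k)))
                         (cyclic-lower F F↑ zero refl (toℕ k) k refl)

-- Plane geometry

-- Carries nonparallelism of the moves from ℤ to ℚ. The detour through unnormalised rationals avoids
-- the gcd in `z / 1`: there both products visibly have denominator 1.
ℤ→ℚ-cross : ∀ a b c d → ℤ→ℚ a * ℤ→ℚ b ≡ ℤ→ℚ c * ℤ→ℚ d → a ℤ.* b ≡ c ℤ.* d
ℤ→ℚ-cross a b c d eq = numerators (ℚᵘₚ.≃-trans (ℚᵘₚ.≃-sym (product a b))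
    (ℚᵘₚ.≃-trans (ℚₚ.toℚᵘ-cong eq) (product c d)))
  where
  product : ∀ a b → ℚ.toℚᵘ (ℤ→ℚ a * ℤ→ℚ b) ℚᵘ.≃ mkℚᵘ a 0 ℚᵘ.* mkℚᵘ b 0
  product a b = ℚᵘₚ.≃-trans (ℚₚ.toℚᵘ-homo-* (ℤ→ℚ a) (ℤ→ℚ b))
    (ℚᵘₚ.*-cong (ℚₚ.toℚᵘ-fromℚᵘ (mkℚᵘ a 0)) (ℚₚ.toℚᵘ-fromℚᵘ (mkℚᵘ b 0)))
  numerators : mkℚᵘ a 0 ℚᵘ.* mkℚᵘ b 0 ℚᵘ.≃ mkℚᵘ c 0 ℚᵘ.* mkℚᵘ d 0 → a ℤ.* b ≡ c ℤ.* d
  numerators (*≡* e) = trans (sym (ℤₚ.*-identityʳ (a ℤ.* b))) (trans e (ℤₚ.*-identityʳ (c ℤ.* d)))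

cross-line : ∀ e c p d t → cross e ((p +ᵖ (t ·ᵖ d)) -ᵖ c) ≡ cross e (p -ᵖ c) + t * cross e d
cross-line (e , e′) (c , c′) (p , p′) (d , d′) t =
  solve 9 (λ e e′ c c′ p p′ d d′ t →
    e :* ((p′ :+ t :* d′) :- c′) :- e′ :* ((p :+ t :* d) :- c)
    := (e :* (p′ :- c′) :- e′ :* (p :- c)) :+ t :* (e :* d′ :- e′ :* d))
    refl e e′ c c′ p p′ d d′ t

cross-diff : ∀ e a b c → cross e (a -ᵖ c) - cross e (b -ᵖ c) ≡ cross e (a -ᵖ b)
cross-diff (e , e′) (a , a′) (b , b′) (c , c′) =
  solve 8 (λ e e′ a a′ b b′ c c′ →
    (e :* (a′ :- c′) :- e′ :* (a :- c)) :- (e :* (b′ :- c′) :- e′ :* (b :- c))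
    := e :* (a′ :- b′) :- e′ :* (a :- b))
    refl e e′ a a′ b b′ c c′

cross-anti : ∀ u v → cross u v ≡ - cross v u
cross-anti (a , b) (c , d) =
  solve 4 (λ a b c d → a :* d :- b :* c := :- (c :* b :- d :* a)) refl a b c d

cross-self : ∀ u → cross u u ≡ 0ℚ
cross-self (a , b) = solve 2 (λ a b → a :* b :- b :* a := con 0ℚ) refl a b

cross-zeroˡ : ∀ u → cross (0ℚ , 0ℚ) u ≡ 0ℚ
cross-zeroˡ (a , b) = solve 2 (λ a b → con 0ℚ :* b :- con 0ℚ :* a := con 0ℚ) refl a b

neg-zero : ∀ {a} → a ≡ 0ℚ → - a ≡ 0ℚ
neg-zero refl = refl

cross-anti-zero : ∀ u v → cross u v ≡ 0ℚ → cross v u ≡ 0ℚ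
cross-anti-zero u v eq = trans (cross-anti v u) (neg-zero eq)

-- Cramer's rule: (u × v) d is a linear combination of u and v with coefficients v × d and u × d up
-- to sign.
cross-span : ∀ u v d → cross u v ≢ 0ℚ → cross u d ≡ 0ℚ → cross v d ≡ 0ℚ → d ≡ (0ℚ , 0ℚ)
cross-span (a , b) (a′ , b′) (x , y) uv≢0 ud vd = cong₂ _,_
  (a*b≡0⇒b≡0 uv≢0 (trans
    (solve 6 (λ a b a′ b′ x y → (a :* b′ :- b :* a′) :* x := a′ :* (a :* y :- b :* x) :- a :* (a′ :* y :- b′ :* x)) refl a b a′ b′ x y)
    (zero-combination a′ a)))
  (a*b≡0⇒b≡0 uv≢0 (trans
    (solve 6 (λ a b a′ b′ x y → (a :* b′ :- b :* a′) :* y := b′ :* (a :* y :- b :* x) :- b :* (a′ :* y :- b′ :* x)) refl a b a′ b′ x y)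
    (zero-combination b′ b)))
  where
  zero-combination : ∀ s t → s * (a * y - b * x) - t * (a′ * y - b′ * x) ≡ 0ℚ
  zero-combination s t = trans (cong₂ (λ p q → s * p - t * q) ud vd)
    (solve 2 (λ s t → s :* con 0ℚ :- t :* con 0ℚ := con 0ℚ) refl s t)

p-q≡0⇒p≡q : ∀ p q → p -ᵖ q ≡ (0ℚ , 0ℚ) → p ≡ q
p-q≡0⇒p≡q p q eq = cong₂ _,_ (a-b≡0⇒a≡b (cong proj₁ eq)) (a-b≡0⇒a≡b (cong proj₂ eq))

-- If u and d were independent, e, being parallel to both, would vanish by `cross-span`.
parallel-trans : ∀ e u d → e ≢ (0ℚ , 0ℚ) → cross e u ≡ 0ℚ → cross e d ≡ 0ℚ → cross u d ≡ 0ℚ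
parallel-trans e u d e≢0 eu ed with cross u d ℚₚ.≟ 0ℚ
... | yes ud = ud
... | no ud≢0 = contradiction (cross-span u d e ud≢0 (cross-anti-zero e u eu) (cross-anti-zero e d ed)) e≢0

-- The auxiliary `v` provides the division: crossing d = t u with v gives t = (d × v) / (u × v).
multiple : ∀ u v d → cross u v ≢ 0ℚ → cross u d ≡ 0ℚ → ∃[ t ] d ≡ t ·ᵖ u
multiple u v d uv≢0 ud with inverse uv≢0
... | w , w*uv≡1 = t , p-q≡0⇒p≡q d (t ·ᵖ u) (cross-span u v (d -ᵖ (t ·ᵖ u)) uv≢0 zero₁ zero₂)
  where
  t : ℚ
  t = cross d v * w
  difference : ∀ e → cross e (d -ᵖ (t ·ᵖ u)) ≡ cross e d - t * cross e u
  difference (e , e′) = solve 7 (λ e e′ d d′ u u′ t →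
    e :* (d′ :- t :* u′) :- e′ :* (d :- t :* u) := (e :* d′ :- e′ :* d) :- t :* (e :* u′ :- e′ :* u))
    refl e e′ (proj₁ d) (proj₂ d) (proj₁ u) (proj₂ u) t
  zero₁ : cross u (d -ᵖ (t ·ᵖ u)) ≡ 0ℚ
  zero₁ = trans (difference u) (trans (cong₂ (λ x y → x - t * y) ud (cross-self u))
    (solve 1 (λ t → con 0ℚ :- t :* con 0ℚ := con 0ℚ) refl t))
  zero₂ : cross v (d -ᵖ (t ·ᵖ u)) ≡ 0ℚ
  zero₂ = begin
    cross v (d -ᵖ (t ·ᵖ u))        ≡⟨ difference v ⟩
    cross v d - t * cross v u      ≡⟨ cong₂ (λ x y → x - t * y) (cross-anti v d) (cross-anti v u) ⟩
    - δ - δ * w * - ν              ≡⟨ solve 3 (λ δ w ν → :- δ :- δ :* w :* :- ν := δ :* (w :* ν) :- δ) refl δ w ν ⟩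
    δ * (w * ν) - δ                ≡⟨ cong (λ x → δ * x - δ) w*uv≡1 ⟩
    δ * 1ℚ - δ                     ≡⟨ solve 1 (λ δ → δ :* con 1ℚ :- δ := con 0ℚ) refl δ ⟩
    0ℚ                             ∎
    where open ≡-Reasoning ; δ = cross d v ; ν = cross u v

dot-rotate : ∀ p u → dot p (proj₂ u , - proj₁ u) ≡ cross p u
dot-rotate (x , y) (c , d) = solve 4 (λ x y c d → x :* d :+ y :* :- c := x :* d :- y :* c) refl x y c d

dot-diff : ∀ p q u → dot (p -ᵖ q) u ≡ dot p u - dot q u
dot-diff (x , y) (x′ , y′) (a , b) = solve 6 (λ x y x′ y′ a b →
  (x :- x′) :* a :+ (y :- y′) :* b := (x :* a :+ y :* b) :- (x′ :* a :+ y′ :* b)) refl x y x′ y′ a b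

dot-line : ∀ p d t u → dot (p +ᵖ (t ·ᵖ d)) u ≡ dot p u + t * dot d u
dot-line (x , y) (d , d′) t (a , b) = solve 7 (λ x y d d′ a b t →
  (x :+ t :* d) :* a :+ (y :+ t :* d′) :* b := (x :* a :+ y :* b) :+ t :* (d :* a :+ d′ :* b))
  refl x y d d′ a b t

-- With w = 1 / (u × v), the vector w (y u - x v) is the solution p of p × u = x and p × v = y.
combination-crossˡ : ∀ u v x y w → cross (((y * w) ·ᵖ u) +ᵖ ((- (x * w)) ·ᵖ v)) u ≡ x * (w * cross u v)
combination-crossˡ (c , d) (c′ , d′) x y w = solve 7 (λ c d c′ d′ x y w →
  (y :* w :* c :+ :- (x :* w) :* c′) :* d :- (y :* w :* d :+ :- (x :* w) :* d′) :* c
  := x :* (w :* (c :* d′ :- d :* c′))) refl c d c′ d′ x y w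

combination-crossʳ : ∀ u v x y w → cross (((y * w) ·ᵖ u) +ᵖ ((- (x * w)) ·ᵖ v)) v ≡ y * (w * cross u v)
combination-crossʳ (c , d) (c′ , d′) x y w = solve 7 (λ c d c′ d′ x y w →
  (y :* w :* c :+ :- (x :* w) :* c′) :* d′ :- (y :* w :* d :+ :- (x :* w) :* d′) :* c′
  := y :* (w :* (c :* d′ :- d :* c′))) refl c d c′ d′ x y w

p+[q-p] : ∀ p q → q ≡ p +ᵖ (q -ᵖ p)
p+[q-p] (b , b′) (a , a′) = cong₂ _,_ (split a b) (split a′ b′)
  where
  split : ∀ a b → a ≡ b + (a - b)
  split a b = solve 2 (λ a b → a := b :+ (a :- b)) refl a b

rotate : Pt → Pt
rotate u = proj₂ u , - proj₁ u

abstract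
  moves-independent : ∀ (P : Piece) → cross (move P mv₁) (move P mv₂) ≢ 0ℚ
  moves-independent P eq = nonparallel (trans (cong (ℤ._- (c₂ ℤ.* d₁))
      (trans (ℤ→ℚ-cross c₁ d₂ d₁ c₂ (a-b≡0⇒a≡b {ℤ→ℚ c₁ * ℤ→ℚ d₂} {ℤ→ℚ d₁ * ℤ→ℚ c₂} eq)) (ℤₚ.*-comm d₁ c₂)))
    (ℤₚ.+-inverseʳ (c₂ ℤ.* d₁)))
    where open Piece P

module Directions (m : Move → Pt) (m₁×m₂≢0 : cross (m mv₁) (m mv₂) ≢ 0ℚ) where

  -- The coordinate that labels the lines in direction `m r`; an attack of type r is equality of
  -- this coordinate at two places.
  val : Move → Pt → ℚ
  val r p = dot p (rotate (m r))

  val≡cross : ∀ r p → val r p ≡ cross p (m r)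
  val≡cross r p = dot-rotate p (m r)

  val-diff : ∀ r p q → val r (p -ᵖ q) ≡ val r p - val r q
  val-diff r p q = dot-diff p q (rotate (m r))

  val-line : ∀ r p d t → val r (p +ᵖ (t ·ᵖ d)) ≡ val r p + t * val r d
  val-line r p d t = dot-line p d t (rotate (m r))

  val-move : ∀ r p t → val r (p +ᵖ (t ·ᵖ m r)) ≡ val r p
  val-move r p t = begin
    val r (p +ᵖ (t ·ᵖ m r))    ≡⟨ val-line r p (m r) t ⟩
    val r p + t * val r (m r)  ≡⟨ cong (λ x → val r p + t * x) (trans (val≡cross r (m r)) (cross-self (m r))) ⟩
    val r p + t * 0ℚ           ≡⟨ solve 2 (λ x t → x :+ t :* con 0ℚ := x) refl (val r p) t ⟩
    val r p                    ∎
    where open ≡-Reasoning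

  m×m′≢0 : ∀ r → cross (m r) (m (other r)) ≢ 0ℚ
  m×m′≢0 mv₁ eq = m₁×m₂≢0 eq
  m×m′≢0 mv₂ eq = m₁×m₂≢0 (cross-anti-zero (m mv₂) (m mv₁) eq)

  m≢0 : ∀ r → m r ≢ (0ℚ , 0ℚ)
  m≢0 r eq = m×m′≢0 r (trans (cong (λ u → cross u (m (other r))) eq) (cross-zeroˡ (m (other r))))

  cross-val : ∀ r p q → val r p ≡ val r q → cross (m r) (p -ᵖ q) ≡ 0ℚ
  cross-val r p q eq = cross-anti-zero (p -ᵖ q) (m r)
    (trans (sym (val≡cross r (p -ᵖ q))) (trans (val-diff r p q) (a≡b⇒a-b≡0 eq)))

  val-cross : ∀ r p q → cross (m r) (p -ᵖ q) ≡ 0ℚ → val r p ≡ val r q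
  val-cross r p q eq = a-b≡0⇒a≡b (trans (sym (val-diff r p q))
    (trans (val≡cross r (p -ᵖ q)) (cross-anti-zero (m r) (p -ᵖ q) eq)))

  vals-determine : ∀ r {p q} → val r p ≡ val r q → val (other r) p ≡ val (other r) q → p ≡ q
  vals-determine r {p} {q} eq eq′ = p-q≡0⇒p≡q p q
    (cross-span (m r) (m (other r)) (p -ᵖ q) (m×m′≢0 r) (cross-val r p q eq) (cross-val (other r) p q eq′))

  on-line : ∀ r p q → val r p ≡ val r q → ∃[ t ] q ≡ p +ᵖ (t ·ᵖ m r)
  on-line r p q eq = let (t , eq′) = multiple (m r) (m (other r)) (q -ᵖ p) (m×m′≢0 r) (cross-val r q p (sym eq))
                     in t , trans (p+[q-p] p q) (cong (p +ᵖ_) eq′)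

  with-vals : ∀ x y → ∃[ p ] val mv₁ p ≡ x × val mv₂ p ≡ y
  with-vals x y = p , trans (val≡cross mv₁ p) (trans (combination-crossˡ (m mv₁) (m mv₂) x y w) (vanish x))
                    , trans (val≡cross mv₂ p) (trans (combination-crossʳ (m mv₁) (m mv₂) x y w) (vanish y))
    where
    w : ℚ
    w = proj₁ (inverse m₁×m₂≢0)
    p : Pt
    p = ((y * w) ·ᵖ m mv₁) +ᵖ ((- (x * w)) ·ᵖ m mv₂)
    vanish : ∀ z → z * (w * cross (m mv₁) (m mv₂)) ≡ z
    vanish z = trans (cong (z *_) (proj₂ (inverse m₁×m₂≢0))) (ℚₚ.*-identityʳ z)

other-involutive : ∀ r → other (other r) ≡ r
other-involutive mv₁ = refl
other-involutive mv₂ = refl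

_≟ᵖ_ : DecidableEquality Pt
_≟ᵖ_ = ≡-dec ℚₚ._≟_ ℚₚ._≟_

open DecMembership _≟ᵖ_ using (_∈?_)

-- Affine functions and segments along a line

pos-between : ∀ {g σ s t} → 0ℚ <ℚ g → 0ℚ ≤ℚ g + t * σ → 0ℚ <ℚ s → s <ℚ t → 0ℚ <ℚ g + s * σ
pos-between {g} {σ} {s} {t} g>0 end≥0 s>0 s<t = pos-cancel (ℚₚ.<-trans s>0 s<t)
  (subst (0ℚ <ℚ_) (sym (solve 4 (λ g σ s t → t :* (g :+ s :* σ) := (t :- s) :* g :+ s :* (g :+ t :* σ)) refl g σ s t))
    (pos+nonNeg (pos* (a<b⇒0<b-a s<t) g>0) (nonNeg* (ℚₚ.<⇒≤ s>0) end≥0)))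

nonNeg-between : ∀ {g σ s t} → 0ℚ ≤ℚ g → 0ℚ ≤ℚ g + t * σ → 0ℚ ≤ℚ s → s <ℚ t → 0ℚ ≤ℚ g + s * σ
nonNeg-between {g} {σ} {s} {t} g≥0 end≥0 s≥0 s<t = nonNeg-cancel (ℚₚ.≤-<-trans s≥0 s<t)
  (subst (0ℚ ≤ℚ_) (sym (solve 4 (λ g σ s t → t :* (g :+ s :* σ) := (t :- s) :* g :+ s :* (g :+ t :* σ)) refl g σ s t))
    (nonNeg+ (nonNeg* (a≤b⇒0≤b-a (ℚₚ.<⇒≤ s<t)) g≥0) (nonNeg* s≥0 end≥0)))

root : ∀ {g σ} → 0ℚ ≤ℚ g → σ <ℚ 0ℚ → ∃[ t ] 0ℚ ≤ℚ t × g + t * σ ≡ 0ℚ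
root {g} {σ} g≥0 σ<0 = t , nonNeg-cancel (neg⇒0<- σ<0) (subst (0ℚ ≤ℚ_) (sym -σt≡g) g≥0) , trans
    (solve 3 (λ g t σ → g :+ t :* σ := g :- :- σ :* t) refl g t σ) (a≡b⇒a-b≡0 (sym -σt≡g))
  where
  -σ≢0 : - σ ≢ 0ℚ
  -σ≢0 eq = ℚₚ.<-irrefl (sym eq) (neg⇒0<- σ<0)
  w t : ℚ
  w = proj₁ (inverse -σ≢0)
  t = g * w
  -σt≡g : - σ * t ≡ g
  -σt≡g = trans (solve 3 (λ s g w → s :* (g :* w) := g :* (w :* s)) refl (- σ) g w)
    (trans (cong (g *_) (proj₂ (inverse -σ≢0))) (ℚₚ.*-identityʳ g))

-- The g k are the side values at the start of a ray and the σ k their slopes; the least root among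
-- the decreasing ones is the time of exit. The strict sign of the slope is recorded because it says
-- that the ray leaves the board there.
first-root : ∀ n (g σ : Fin n → ℚ) → (∀ k → 0ℚ ≤ℚ g k) →
             (∀ k → 0ℚ ≤ℚ σ k) ⊎
             (∃[ t ] 0ℚ ≤ℚ t × (∀ k → 0ℚ ≤ℚ g k + t * σ k) × ∃[ k ] g k + t * σ k ≡ 0ℚ × σ k <ℚ 0ℚ)
first-root zero g σ g≥0 = inj₁ λ ()
first-root (suc n) g σ g≥0 = combine (σ zero ℚ.<? 0ℚ) (first-root n (g ∘ suc) (σ ∘ suc) (g≥0 ∘ suc))
  where
  Goal : Set
  Goal = (∀ k → 0ℚ ≤ℚ σ k) ⊎
         (∃[ t ] 0ℚ ≤ℚ t × (∀ k → 0ℚ ≤ℚ g k + t * σ k) × ∃[ k ] g k + t * σ k ≡ 0ℚ × σ k <ℚ 0ℚ)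
  nondecreasing : ∀ {k t} → 0ℚ ≤ℚ σ k → 0ℚ ≤ℚ t → 0ℚ ≤ℚ g k + t * σ k
  nondecreasing {k} σ≥0 t≥0 = nonNeg+ (g≥0 k) (nonNeg* t≥0 σ≥0)
  extend : ∀ {P : Fin (suc n) → Set} → P zero → (∀ k → P (suc k)) → ∀ k → P k
  extend pz ps zero = pz
  extend pz ps (suc k) = ps k
  combine : Dec (σ zero <ℚ 0ℚ) →
            ((∀ k → 0ℚ ≤ℚ σ (suc k)) ⊎ (∃[ t ] 0ℚ ≤ℚ t × (∀ k → 0ℚ ≤ℚ g (suc k) + t * σ (suc k)) ×
              ∃[ k ] g (suc k) + t * σ (suc k) ≡ 0ℚ × σ (suc k) <ℚ 0ℚ)) → Goal
  combine (no σ≮0) (inj₁ σ≥0) = inj₁ (extend (ℚₚ.≮⇒≥ σ≮0) σ≥0)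
  combine (no σ≮0) (inj₂ (t , t≥0 , all , k , z , neg)) =
    inj₂ (t , t≥0 , extend {λ k → 0ℚ ≤ℚ g k + t * σ k} (nondecreasing (ℚₚ.≮⇒≥ σ≮0) t≥0) all , suc k , z , neg)
  combine (yes σ<0) rest = insert rest (root (g≥0 zero) σ<0)
    where
    insert : ((∀ k → 0ℚ ≤ℚ σ (suc k)) ⊎ (∃[ t ] 0ℚ ≤ℚ t × (∀ k → 0ℚ ≤ℚ g (suc k) + t * σ (suc k)) ×
              ∃[ k ] g (suc k) + t * σ (suc k) ≡ 0ℚ × σ (suc k) <ℚ 0ℚ)) →
             (∃[ t ] 0ℚ ≤ℚ t × g zero + t * σ zero ≡ 0ℚ) → Goal
    insert (inj₁ σ≥0) (t , t≥0 , z) = inj₂ (t , t≥0 ,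
      extend {λ k → 0ℚ ≤ℚ g k + t * σ k} (ℚₚ.≤-reflexive (sym z)) (λ k → nondecreasing (σ≥0 k) t≥0) , zero , z , σ<0)
    -- The exit time `u` of the remaining sides stands if the first side is still nonnegative then;
    -- otherwise the root `t` of the first side comes earlier.
    insert (inj₂ (u , u≥0 , all , k , z′ , neg)) (t , t≥0 , z) = compare (0ℚ ℚ.≤? g zero + u * σ zero)
      where
      compare : Dec (0ℚ ≤ℚ g zero + u * σ zero) → Goal
      compare (yes ok) = inj₂ (u , u≥0 , extend {λ k → 0ℚ ≤ℚ g k + u * σ k} ok all , suc k , z′ , neg)
      compare (no neg₀) = inj₂ (t , t≥0 , extend {λ k → 0ℚ ≤ℚ g k + t * σ k} (ℚₚ.≤-reflexive (sym z))
          (λ k → nonNeg-between (g≥0 (suc k)) (all k) t≥0 t<u) , zero , z , σ<0)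
        where
        t<u : t <ℚ u
        t<u = ℚₚ.≰⇒> λ u≤t → neg₀ (subst (0ℚ ≤ℚ_)
          (trans (solve 4 (λ g t u σ → (t :- u) :* :- σ := (g :+ u :* σ) :- (g :+ t :* σ)) refl (g zero) t u (σ zero))
            (trans (cong (λ e → g zero + u * σ zero - e) z) (solve 1 (λ x → x :- con 0ℚ := x) refl (g zero + u * σ zero))))
          (nonNeg* (a≤b⇒0≤b-a u≤t) (ℚₚ.<⇒≤ (neg⇒0<- σ<0))))

x≡x-0 : ∀ x → x ≡ x - 0ℚ
x≡x-0 x = solve 1 (λ x → x := x :- con 0ℚ) refl x

negᵖ : Pt → Pt
negᵖ (x , y) = - x , - y

neg-neg-·ᵖ : ∀ t d → t ·ᵖ d ≡ (- t) ·ᵖ negᵖ d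
neg-neg-·ᵖ t (x , y) = cong₂ _,_ (eq t x) (eq t y)
  where
  eq : ∀ t x → t * x ≡ - t * - x
  eq t x = solve 2 (λ t x → t :* x := :- t :* :- x) refl t x

negᵖ-involutive : ∀ d → negᵖ (negᵖ d) ≡ d
negᵖ-involutive (x , y) = cong₂ _,_ (eq x) (eq y)
  where
  eq : ∀ x → - - x ≡ x
  eq x = solve 1 (λ x → :- :- x := x) refl x

+ᵖ-zero : ∀ p d → p +ᵖ (0ℚ ·ᵖ d) ≡ p
+ᵖ-zero (x , y) (d , d′) = cong₂ _,_ (eq x d) (eq y d′)
  where
  eq : ∀ x d → x + 0ℚ * d ≡ x
  eq x d = solve 2 (λ x d → x :+ con 0ℚ :* d := x) refl x d

+ᵖ-one : ∀ p q → p +ᵖ (1ℚ ·ᵖ (q -ᵖ p)) ≡ q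
+ᵖ-one (x , y) (x′ , y′) = cong₂ _,_ (eq x x′) (eq y y′)
  where
  eq : ∀ x y → x + 1ℚ * (y - x) ≡ y
  eq x y = solve 2 (λ x y → x :+ con 1ℚ :* (y :- x) := y) refl x y

cross-subˡ : ∀ a b d → cross (a -ᵖ b) d ≡ cross a d - cross b d
cross-subˡ (a , a′) (b , b′) (d , d′) = solve 6 (λ a a′ b b′ d d′ →
  (a :- b) :* d′ :- (a′ :- b′) :* d := (a :* d′ :- a′ :* d) :- (b :* d′ :- b′ :* d)) refl a a′ b b′ d d′

-ᵖ-self : ∀ p → p -ᵖ p ≡ (0ℚ , 0ℚ)
-ᵖ-self (x , y) = cong₂ _,_ (ℚₚ.+-inverseʳ x) (ℚₚ.+-inverseʳ y)

cross-zeroʳ : ∀ u → cross u (0ℚ , 0ℚ) ≡ 0ℚ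
cross-zeroʳ (a , b) = solve 2 (λ a b → a :* con 0ℚ :- b :* con 0ℚ := con 0ℚ) refl a b

cross-negʳ : ∀ u v → cross u (negᵖ v) ≡ - cross u v
cross-negʳ (a , b) (c , d) = solve 4 (λ a b c d → a :* :- d :- b :* :- c := :- (a :* d :- b :* c)) refl a b c d

-- Definitionally `OnSegment` with the ends as separate arguments, stated without board and piece.
OnSeg : Pt → Pt → Pt → Set
OnSeg p a b = ∃[ t ] 0ℚ ≤ℚ t × t ≤ℚ 1ℚ × p ≡ a +ᵖ (t ·ᵖ (b -ᵖ a))

OnSeg-sym : ∀ {p a b} → OnSeg p a b → OnSeg p b a
OnSeg-sym {p} {a , a′} {b , b′} (t , t≥0 , t≤1 , eq) = 1ℚ - t , a≤b⇒0≤b-a t≤1 ,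
  0≤b-a⇒a≤b (subst (0ℚ ≤ℚ_) (solve 1 (λ t → t := con 1ℚ :- (con 1ℚ :- t)) refl t) t≥0) ,
  trans eq (cong₂ _,_ (flip a b) (flip a′ b′))
  where
  flip : ∀ a b → a + t * (b - a) ≡ b + (1ℚ - t) * (a - b)
  flip a b = solve 3 (λ a b t → a :+ t :* (b :- a) := b :+ (con 1ℚ :- t) :* (a :- b)) refl a b t

-- The segment parameter of p is -s/(u-s).
between-opposite : ∀ p d {s u} → s <ℚ 0ℚ → 0ℚ <ℚ u → OnSeg p (p +ᵖ (s ·ᵖ d)) (p +ᵖ (u ·ᵖ d))
between-opposite (x , y) (d , d′) {s} {u} s<0 u>0 = t , t≥0 , t≤1 , cong₂ _,_ (at x d) (at y d′)
  where
  u-s>0 : 0ℚ <ℚ u - s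
  u-s>0 = a<b⇒0<b-a (ℚₚ.<-trans s<0 u>0)
  u-s≢0 : u - s ≢ 0ℚ
  u-s≢0 eq = ℚₚ.<-irrefl (sym eq) u-s>0
  w t : ℚ
  w = proj₁ (inverse u-s≢0)
  t = - s * w
  t[u-s] : (u - s) * t ≡ - s
  t[u-s] = trans (solve 3 (λ e s w → e :* (:- s :* w) := :- s :* (w :* e)) refl (u - s) s w)
    (trans (cong (- s *_) (proj₂ (inverse u-s≢0))) (ℚₚ.*-identityʳ (- s)))
  t≥0 : 0ℚ ≤ℚ t
  t≥0 = nonNeg-cancel u-s>0 (subst (0ℚ ≤ℚ_) (sym t[u-s]) (ℚₚ.<⇒≤ (neg⇒0<- s<0)))
  t≤1 : t ≤ℚ 1ℚ
  t≤1 = 0≤b-a⇒a≤b (nonNeg-cancel u-s>0 (subst (0ℚ ≤ℚ_) (sym (trans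
    (solve 3 (λ u s t → (u :- s) :* (con 1ℚ :- t) := u :- s :- (u :- s) :* t) refl u s t)
    (trans (cong (λ e → u - s - e) t[u-s]) (solve 2 (λ u s → u :- s :- :- s := u) refl u s)))) (ℚₚ.<⇒≤ u>0)))
  at : ∀ x d → x ≡ x + s * d + t * (x + u * d - (x + s * d))
  at x d = sym (trans (solve 5 (λ x d s u t → x :+ s :* d :+ t :* (x :+ u :* d :- (x :+ s :* d))
      := x :+ (s :+ (u :- s) :* t) :* d) refl x d s u t)
    (trans (cong (λ e → x + (s + e) * d) t[u-s]) (solve 3 (λ x s d → x :+ (s :+ :- s) :* d := x) refl x s d)))

-- Convex boards

module Geometry (B : Board) (m : Move → Pt) (m₁×m₂≢0 : cross (m mv₁) (m mv₂) ≢ 0ℚ) where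
  open Board B
  open Directions m m₁×m₂≢0 public

  edge : Fin n → Pt
  edge k = corner (next k) -ᵖ corner k

  slope : Fin n → Pt → ℚ
  slope k d = cross (edge k) d

  side-line : ∀ k p d t → sideVal B k (p +ᵖ (t ·ᵖ d)) ≡ sideVal B k p + t * slope k d
  side-line k p d t = cross-line (edge k) (corner k) p d t

  side-diff : ∀ k p q → sideVal B k p - sideVal B k q ≡ slope k (p -ᵖ q)
  side-diff k p q = cross-diff (edge k) p q (corner k)

  same-side : ∀ k p q → sideVal B k p ≡ sideVal B k q → slope k (p -ᵖ q) ≡ 0ℚ
  same-side k p q eq = trans (sym (side-diff k p q)) (a≡b⇒a-b≡0 eq)

  same-side⁻ : ∀ k p q → slope k (p -ᵖ q) ≡ 0ℚ → sideVal B k p ≡ sideVal B k q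
  same-side⁻ k p q eq = a-b≡0⇒a≡b (trans (side-diff k p q) eq)

  InB? : ∀ p → Dec (InB B p)
  InB? p = Finₚ.all? λ k → 0ℚ ℚ.≤? sideVal B k p

  Interior? : ∀ p → Dec (Interior B p)
  Interior? p = Finₚ.all? λ k → 0ℚ ℚ.<? sideVal B k p

  OnBoundary? : ∀ p → Dec (OnBoundary B p)
  OnBoundary? p = InB? p ×-dec ¬? (Interior? p)

  interior⇒InB : ∀ p → Interior B p → InB B p
  interior⇒InB p p° k = ℚₚ.<⇒≤ (p° k)

  boundary-side : ∀ p → OnBoundary B p → ∃[ k ] sideVal B k p ≡ 0ℚ
  boundary-side p (inB , ¬int) = let (k , ¬pos) = Finₚ.¬∀⟶∃¬ n _ (λ k → 0ℚ ℚ.<? sideVal B k p) ¬int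
                                   in k , ≤0⇒≡0 (inB k) ¬pos

  side⇒boundary : ∀ p k → InB B p → sideVal B k p ≡ 0ℚ → OnBoundary B p
  side⇒boundary p k inB eq = inB , λ int → ℚₚ.<-irrefl (sym eq) (int k)

  interior-or-boundary : ∀ p → InB B p → Interior B p ⊎ OnBoundary B p
  interior-or-boundary p inB with Interior? p
  ... | yes int = inj₁ int
  ... | no ¬int = inj₂ (inB , ¬int)

  side-corner : ∀ k → sideVal B k (corner k) ≡ 0ℚ
  side-corner k = trans (cong (cross (edge k)) (-ᵖ-self (corner k))) (cross-zeroʳ (edge k))

  side-next-corner : ∀ k → sideVal B k (corner (next k)) ≡ 0ℚ
  side-next-corner k = cross-self (edge k)

  -- Strict convexity at the corner two further on, measured from the corner `next k`, which lies on
  -- side k.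
  turn : ∀ k → 0ℚ <ℚ slope k (edge (next k))
  turn k = subst (0ℚ <ℚ_) (trans (trans (x≡x-0 (sideVal B k (corner (next (next k)))))
                   (cong (λ e → sideVal B k (corner (next (next k))) - e) (sym (side-next-corner k))))
                   (side-diff k (corner (next (next k))) (corner (next k))))
             (convex k (next (next k)) (next²≢ k three≤n) (next≢ (next k) three≤n))

  edge≢0 : ∀ k → edge k ≢ (0ℚ , 0ℚ)
  edge≢0 k eq with previous k
  ... | j , refl = ℚₚ.<-irrefl (sym (trans (cong (cross (edge j)) eq) (cross-zeroʳ (edge j)))) (turn j)

  turn≢0 : ∀ k → cross (edge k) (edge (next k)) ≢ 0ℚ
  turn≢0 k eq = ℚₚ.<-irrefl (sym eq) (turn k)

  corner-InB : ∀ j → InB B (corner j)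
  corner-InB j k with j Fin.≟ k | j Fin.≟ next k
  ... | yes refl | _ = ℚₚ.≤-reflexive (sym (side-corner k))
  ... | no _ | yes refl = ℚₚ.≤-reflexive (sym (side-next-corner k))
  ... | no j≢k | no j≢k′ = ℚₚ.<⇒≤ (convex k j j≢k j≢k′)

  corner-side : ∀ j k → sideVal B k (corner j) ≡ 0ℚ → j ≡ k ⊎ j ≡ next k
  corner-side j k eq with j Fin.≟ k | j Fin.≟ next k
  ... | yes j≡k | _ = inj₁ j≡k
  ... | no _ | yes j≡k′ = inj₂ j≡k′
  ... | no j≢k | no j≢k′ = contradiction (convex k j j≢k j≢k′) (ℚₚ.<-irrefl (sym eq))

  -- Consecutive sides are independent, so the two fixations at a corner already determine the
  -- point.
  corner-unique : ∀ j x → sideVal B j x ≡ 0ℚ → sideVal B (next j) x ≡ 0ℚ → x ≡ corner (next j)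
  corner-unique j x eq eq′ = p-q≡0⇒p≡q x c (cross-span (edge j) (edge (next j)) (x -ᵖ c) (turn≢0 j)
      (same-side j x c (trans eq (sym (side-next-corner j)))) (same-side (next j) x c (trans eq′ (sym (side-corner (next j))))))
    where
    c : Pt
    c = corner (next j)

  -- A board point on the line of side k lies between the ends of that side: the preceding side
  -- gives t ≥ 0 and the following one t ≤ 1.
  module OnSideLine (k : Fin n) (p : Pt) (inB : InB B p) (t : ℚ) (p≡ : p ≡ corner k +ᵖ (t ·ᵖ edge k)) where

    side-p : ∀ l → sideVal B l p ≡ sideVal B l (corner k) + t * slope l (edge k)
    side-p l = trans (cong (sideVal B l) p≡) (side-line l (corner k) (edge k) t)

    t≥0 : 0ℚ ≤ℚ t
    t≥0 = lower (proj₁ (previous k)) (proj₂ (previous k))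
      where
      lower : ∀ i → next i ≡ k → 0ℚ ≤ℚ t
      lower i i+1≡k = nonNeg-cancel {slope i (edge k)} {t}
        (subst (λ k → 0ℚ <ℚ slope i (edge k)) i+1≡k (turn i))
        (subst (0ℚ ≤ℚ_) (trans (side-p i) (0+ts (sideVal B i (corner k)) (slope i (edge k)) t
          (subst (λ k → sideVal B i (corner k) ≡ 0ℚ) i+1≡k (side-next-corner i)))) (inB i))
        where
        0+ts : ∀ c s t → c ≡ 0ℚ → c + t * s ≡ s * t
        0+ts c s t refl = solve 2 (λ t s → con 0ℚ :+ t :* s := s :* t) refl t s

    side-ends : ∀ l → sideVal B l p ≡ t * sideVal B l (corner (next k)) + (1ℚ - t) * sideVal B l (corner k)
    side-ends l = trans (side-p l) (interpolate (sideVal B l (corner k)) (sideVal B l (corner (next k))) (slope l (edge k)) t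
        (side-diff l (corner (next k)) (corner k)))
      where
      interpolate : ∀ a b s t → b - a ≡ s → a + t * s ≡ t * b + (1ℚ - t) * a
      interpolate a b s t refl = solve 3 (λ a b t → a :+ t :* (b :- a) := t :* b :+ (con 1ℚ :- t) :* a) refl a b t

    1-t≥0 : 0ℚ ≤ℚ 1ℚ - t
    1-t≥0 = nonNeg-cancel {slope k (edge (next k))} {1ℚ - t} (turn k) (subst (0ℚ ≤ℚ_)
      (trans (side-ends (next k)) (rearrange (sideVal B (next k) (corner k)) (sideVal B (next k) (corner (next k)))
        (slope (next k) (edge k)) (slope k (edge (next k))) t (side-corner (next k))
        (side-diff (next k) (corner (next k)) (corner k)) (cross-anti (edge (next k)) (edge k)))) (inB (next k)))
      where
      rearrange : ∀ c b s s′ t → b ≡ 0ℚ → b - c ≡ s → s ≡ - s′ → t * b + (1ℚ - t) * c ≡ s′ * (1ℚ - t)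
      rearrange c b s s′ t refl refl eq = trans
        (solve 2 (λ c t → t :* con 0ℚ :+ (con 1ℚ :- t) :* c := :- (con 0ℚ :- c) :* (con 1ℚ :- t)) refl c t)
        (trans (cong (λ e → - e * (1ℚ - t)) eq) (solve 2 (λ s t → :- :- s :* (con 1ℚ :- t) := s :* (con 1ℚ :- t)) refl s′ t))

    at-start : t ≡ 0ℚ → IsCorner B p
    at-start t≡0 = k , sym (trans p≡ (trans (cong (λ t → corner k +ᵖ (t ·ᵖ edge k)) t≡0) (+ᵖ-zero (corner k) (edge k))))

    at-end : t ≡ 1ℚ → IsCorner B p
    at-end t≡1 = next k , sym (trans p≡ (trans (cong (λ t → corner k +ᵖ (t ·ᵖ edge k)) t≡1) (+ᵖ-one (corner k) (corner (next k)))))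

    module _ (j : Fin n) (k≢j : k ≢ j) (p∈j : sideVal B j p ≡ 0ℚ) where

      combination : t * sideVal B j (corner (next k)) + (1ℚ - t) * sideVal B j (corner k) ≡ 0ℚ
      combination = trans (sym (side-ends j)) p∈j

      end∈j : t ≢ 0ℚ → sideVal B j (corner (next k)) ≡ 0ℚ
      end∈j t≢0 = a*b≡0⇒b≡0 {t} t≢0 (nonNeg-sum-zero (nonNeg* t≥0 (corner-InB (next k) j))
        (nonNeg* 1-t≥0 (corner-InB k j)) combination)

      start∈j : 1ℚ - t ≢ 0ℚ → sideVal B j (corner k) ≡ 0ℚ
      start∈j 1-t≢0 = a*b≡0⇒b≡0 {1ℚ - t} 1-t≢0 (nonNeg-sum-zero (nonNeg* 1-t≥0 (corner-InB k j))
        (nonNeg* t≥0 (corner-InB (next k) j))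
        (trans (ℚₚ.+-comm ((1ℚ - t) * sideVal B j (corner k)) (t * sideVal B j (corner (next k)))) combination))

      adjacent : k ≡ j ⊎ k ≡ next j → next k ≡ j ⊎ next k ≡ next j → ⊥
      adjacent (inj₁ k≡j) _ = k≢j k≡j
      adjacent (inj₂ _) (inj₂ eq) = k≢j (next-injective eq)
      adjacent (inj₂ refl) (inj₁ eq) = next²≢ j three≤n eq

      is-corner : IsCorner B p
      is-corner = cases (t ℚₚ.≟ 0ℚ) (1ℚ - t ℚₚ.≟ 0ℚ)
        where
        cases : Dec (t ≡ 0ℚ) → Dec (1ℚ - t ≡ 0ℚ) → IsCorner B p
        cases (yes t≡0) _ = at-start t≡0
        cases (no _) (yes 1-t≡0) = at-end (sym (a-b≡0⇒a≡b {1ℚ} {t} 1-t≡0))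
        cases (no t≢0) (no 1-t≢0) =
          ⊥-elim (adjacent (corner-side k j (start∈j 1-t≢0)) (corner-side (next k) j (end∈j t≢0)))

  -- On side k the value of side j is a convex combination of its nonnegative values at the two
  -- ends. If it vanished strictly inside, both ends would lie on the line of side j, against strict
  -- convexity.
  two-sides⇒corner : ∀ p k j → InB B p → k ≢ j → sideVal B k p ≡ 0ℚ → sideVal B j p ≡ 0ℚ → IsCorner B p
  two-sides⇒corner p k j inB k≢j p∈k p∈j = OnSideLine.is-corner k p inB (proj₁ along)
      (trans (p+[q-p] (corner k) p) (cong (corner k +ᵖ_) (proj₂ along))) j k≢j p∈j
    where
    along : ∃[ t ] p -ᵖ corner k ≡ t ·ᵖ edge k
    along = multiple (edge k) (edge (next k)) (p -ᵖ corner k) (turn≢0 k) p∈k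

-- The maps s₁ and s₂

module Dynamics (B : Board) (m : Move → Pt) (m₁×m₂≢0 : cross (m mv₁) (m mv₂) ≢ 0ℚ) where
  open Board B
  open Geometry B m m₁×m₂≢0 public

  interior-between : ∀ o d s t → Interior B o → InB B (o +ᵖ (t ·ᵖ d)) → 0ℚ <ℚ s → s <ℚ t → Interior B (o +ᵖ (s ·ᵖ d))
  interior-between o d s t o° inB s>0 s<t k = subst (0ℚ <ℚ_) (sym (side-line k o d s))
    (pos-between {sideVal B k o} {slope k d} {s} {t} (o° k) (subst (0ℚ ≤ℚ_) (side-line k o d t) (inB k)) s>0 s<t)

  -- Everything strictly between an interior point and a board point is interior, so the nearer of
  -- two boundary points on a ray would be interior.
  same-parameter : ∀ o d s t → Interior B o → OnBoundary B (o +ᵖ (s ·ᵖ d)) → OnBoundary B (o +ᵖ (t ·ᵖ d)) →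
                   0ℚ <ℚ s → 0ℚ <ℚ t → s ≡ t
  same-parameter o d s t o° (x∈B , ¬x°) (y∈B , ¬y°) s>0 t>0 with ℚₚ.<-cmp s t
  ... | tri< s<t _ _ = ⊥-elim (¬x° (interior-between o d s t o° y∈B s>0 s<t))
  ... | tri≈ _ s≡t _ = s≡t
  ... | tri> _ _ t<s = ⊥-elim (¬y° (interior-between o d t s o° x∈B t>0 t<s))

  same-parameter⁻ : ∀ o d s t → Interior B o → OnBoundary B (o +ᵖ (s ·ᵖ d)) → OnBoundary B (o +ᵖ (t ·ᵖ d)) →
                    s <ℚ 0ℚ → t <ℚ 0ℚ → s ≡ t
  same-parameter⁻ o d s t o° bs bt s<0 t<0 = ℚₚ.neg-injective
    (same-parameter o (negᵖ d) (- s) (- t) o° (reflect s bs) (reflect t bt) (neg⇒0<- s<0) (neg⇒0<- t<0))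
    where
    reflect : ∀ s → OnBoundary B (o +ᵖ (s ·ᵖ d)) → OnBoundary B (o +ᵖ ((- s) ·ᵖ negᵖ d))
    reflect s = subst (λ e → OnBoundary B (o +ᵖ e)) (neg-neg-·ᵖ s d)

  boundary-sign : ∀ o d t → Interior B o → OnBoundary B (o +ᵖ (t ·ᵖ d)) → 0ℚ <ℚ t ⊎ t <ℚ 0ℚ
  boundary-sign o d t o° (_ , ¬x°) with ℚₚ.<-cmp t 0ℚ
  ... | tri< t<0 _ _ = inj₂ t<0
  ... | tri≈ _ t≡0 _ = ⊥-elim (¬x° (subst (Interior B) (sym (trans (cong (λ t → o +ᵖ (t ·ᵖ d)) t≡0) (+ᵖ-zero o d))) o°))
  ... | tri> _ _ t>0 = inj₁ t>0

  -- A `Step` in symmetric form, with both ends on the boundary and the line given by its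
  -- coordinate, so that it can be reversed.
  record Link (r : Move) (a b : Pt) : Set where
    constructor link
    field
      source   : OnBoundary B a
      target   : OnBoundary B b
      distinct : a ≢ b
      aligned  : val r a ≡ val r b
      inner    : Pt
      inner°   : Interior B inner
      inner-on : val r inner ≡ val r a

  Link-sym : ∀ {r a b} → Link r a b → Link r b a
  Link-sym (link ba bb a≢b ab o o° oa) = link bb ba (λ e → a≢b (sym e)) (sym ab) o o° (trans oa ab)

  module OnLink (r : Move) (o : Pt) (o° : Interior B o) where

    record Position (a : Pt) : Set where
      constructor at
      field
        parameter : ℚ
        position  : a ≡ o +ᵖ (parameter ·ᵖ m r)
        sign      : 0ℚ <ℚ parameter ⊎ parameter <ℚ 0ℚ

    locate : ∀ a → OnBoundary B a → val r o ≡ val r a → Position a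
    locate a ba oa = let (t , eq) = on-line r o a oa
                     in at t eq (boundary-sign o (m r) t o° (subst (OnBoundary B) eq ba))

    opposite-or-equal : ∀ {a b} → OnBoundary B a → OnBoundary B b → (pa : Position a) (pb : Position b) →
      a ≡ b ⊎ (Position.parameter pa <ℚ 0ℚ × 0ℚ <ℚ Position.parameter pb)
            ⊎ (Position.parameter pb <ℚ 0ℚ × 0ℚ <ℚ Position.parameter pa)
    opposite-or-equal ba bb (at s refl (inj₁ s>0)) (at t refl (inj₁ t>0)) =
      inj₁ (cong (λ t → o +ᵖ (t ·ᵖ m r)) (same-parameter o (m r) s t o° ba bb s>0 t>0))
    opposite-or-equal ba bb (at s refl (inj₁ s>0)) (at t refl (inj₂ t<0)) = inj₂ (inj₂ (t<0 , s>0))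
    opposite-or-equal ba bb (at s refl (inj₂ s<0)) (at t refl (inj₁ t>0)) = inj₂ (inj₁ (s<0 , t>0))
    opposite-or-equal ba bb (at s refl (inj₂ s<0)) (at t refl (inj₂ t<0)) =
      inj₁ (cong (λ t → o +ᵖ (t ·ᵖ m r)) (same-parameter⁻ o (m r) s t o° ba bb s<0 t<0))

  between : ∀ r {a b} p → Interior B p → OnBoundary B a → OnBoundary B b → a ≢ b →
            val r p ≡ val r a → val r p ≡ val r b → OnSeg p a b
  between r {a} {b} p p° ba bb a≢b pa pb = conclude (locate a ba pa) (locate b bb pb)
    where
    open OnLink r p p°
    conclude : Position a → Position b → OnSeg p a b
    conclude qa qb with opposite-or-equal ba bb qa qb
    ... | inj₁ a≡b = contradiction a≡b a≢b
    ... | inj₂ (inj₁ (s<0 , t>0)) = subst₂ (OnSeg p) (sym (Position.position qa)) (sym (Position.position qb))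
            (between-opposite p (m r) s<0 t>0)
    ... | inj₂ (inj₂ (t<0 , s>0)) = OnSeg-sym {p} {b} {a} (subst₂ (OnSeg p) (sym (Position.position qb)) (sym (Position.position qa))
            (between-opposite p (m r) t<0 s>0))

  -- Seen from the interior point, neither b nor c is on the side of a; hence they are on the same
  -- side and coincide.
  Link-functional : ∀ {r a b c} → Link r a b → Link r a c → b ≡ c
  Link-functional {r} {a} {b} {c} (link ba bb a≢b ab o o° oa) (link _ bc a≢c ac _ _ _) =
    conclude (locate a ba oa) (locate b bb (trans oa ab)) (locate c bc (trans oa ac))
    where
    open OnLink r o o°
    conclude : Position a → Position b → Position c → b ≡ c
    conclude qa qb qc with opposite-or-equal bb bc qb qc | opposite-or-equal ba bb qa qb | opposite-or-equal ba bc qa qc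
    ... | inj₁ b≡c | _ | _ = b≡c
    ... | inj₂ _ | inj₁ a≡b | _ = contradiction a≡b a≢b
    ... | inj₂ _ | inj₂ _ | inj₁ a≡c = contradiction a≡c a≢c
    ... | inj₂ (inj₁ (b<0 , c>0)) | inj₂ (inj₁ (a<0 , b>0)) | _ = ⊥-elim (ℚₚ.<-asym b<0 b>0)
    ... | inj₂ (inj₁ (b<0 , c>0)) | inj₂ (inj₂ (_ , a>0)) | inj₂ (inj₁ (a<0 , _)) = ⊥-elim (ℚₚ.<-asym a<0 a>0)
    ... | inj₂ (inj₁ (b<0 , c>0)) | inj₂ (inj₂ (_ , a>0)) | inj₂ (inj₂ (c<0 , _)) = ⊥-elim (ℚₚ.<-asym c<0 c>0)
    ... | inj₂ (inj₂ (c<0 , b>0)) | inj₂ (inj₂ (b<0 , _)) | _ = ⊥-elim (ℚₚ.<-asym b<0 b>0)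
    ... | inj₂ (inj₂ (c<0 , b>0)) | inj₂ (inj₁ (a<0 , _)) | inj₂ (inj₁ (_ , c>0)) = ⊥-elim (ℚₚ.<-asym c<0 c>0)
    ... | inj₂ (inj₂ (c<0 , b>0)) | inj₂ (inj₁ (a<0 , _)) | inj₂ (inj₂ (_ , a>0)) = ⊥-elim (ℚₚ.<-asym a<0 a>0)

  midpoint : Pt → Pt → Pt
  midpoint a b = a +ᵖ (½ ·ᵖ (b -ᵖ a))

  side-midpoint : ∀ k a b → sideVal B k (midpoint a b) ≡ ½ * (sideVal B k a + sideVal B k b)
  side-midpoint k a b = trans (side-line k a (b -ᵖ a) ½)
      (average (sideVal B k a) (sideVal B k b) (slope k (b -ᵖ a)) (side-diff k b a))
    where
    average : ∀ a b s → b - a ≡ s → a + ½ * s ≡ ½ * (a + b)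
    average a b s refl = solve 2 (λ a b → a :+ con ½ :* (b :- a) := con ½ :* (a :+ b)) refl a b

  val-midpoint : ∀ r a b → val r a ≡ val r b → val r (midpoint a b) ≡ val r a
  val-midpoint r a b eq = trans (val-line r a (b -ᵖ a) ½) (collapse (val r a) (val r b) (val r (b -ᵖ a)) eq (val-diff r b a))
    where
    collapse : ∀ a b s → a ≡ b → s ≡ b - a → a + ½ * s ≡ a
    collapse a b s refl refl = solve 1 (λ a → a :+ con ½ :* (a :- a) := a) refl a

  CommonSide : Pt → Pt → Set
  CommonSide a b = ∃[ k ] sideVal B k a ≡ 0ℚ × sideVal B k b ≡ 0ℚ

  -- If the midpoint is not interior, it lies on a side, and then so do both ends.
  link-or-common-side : ∀ r a b → OnBoundary B a → OnBoundary B b → a ≢ b → val r a ≡ val r b →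
                        Link r a b ⊎ CommonSide a b
  link-or-common-side r a b ba bb a≢b ab = cases (interior-or-boundary (midpoint a b) mid∈B)
    where
    mid∈B : InB B (midpoint a b)
    mid∈B k = subst (0ℚ ≤ℚ_) (sym (side-midpoint k a b))
      (nonNeg* (ℚₚ.nonNegative⁻¹ ½) (nonNeg+ (proj₁ ba k) (proj₁ bb k)))
    cases : Interior B (midpoint a b) ⊎ OnBoundary B (midpoint a b) → Link r a b ⊎ CommonSide a b
    cases (inj₁ mid°) = inj₁ (link ba bb a≢b ab (midpoint a b) mid° (val-midpoint r a b ab))
    cases (inj₂ bm) = let (k , eq) = boundary-side (midpoint a b) bm in inj₂ (k , both k eq)
      where
      both : ∀ k → sideVal B k (midpoint a b) ≡ 0ℚ → sideVal B k a ≡ 0ℚ × sideVal B k b ≡ 0ℚ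
      both k eq = nonNeg-sum-zero (proj₁ ba k) (proj₁ bb k) a+b≡0
                , nonNeg-sum-zero (proj₁ bb k) (proj₁ ba k) (trans (ℚₚ.+-comm (sideVal B k b) (sideVal B k a)) a+b≡0)
        where
        a+b≡0 : sideVal B k a + sideVal B k b ≡ 0ℚ
        a+b≡0 = a*b≡0⇒b≡0 {½} (λ ()) (trans (sym (side-midpoint k a b)) eq)

  common-side-parallel : ∀ r k a b → a ≢ b → val r a ≡ val r b → sideVal B k a ≡ 0ℚ → sideVal B k b ≡ 0ℚ →
                         slope k (m r) ≡ 0ℚ
  common-side-parallel r k a b a≢b ab ak bk = parallel-trans (a -ᵖ b) (edge k) (m r) (λ e → a≢b (p-q≡0⇒p≡q a b e))
    (cross-anti-zero (edge k) (a -ᵖ b) (same-side k a b (trans ak (sym bk))))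
    (cross-anti-zero (m r) (a -ᵖ b) (cross-val r a b ab))

  parallel-side-val : ∀ r k x y → slope k (m r) ≡ 0ℚ → sideVal B k x ≡ sideVal B k y → val r x ≡ val r y
  parallel-side-val r k x y par eq = val-cross r x y
    (parallel-trans (edge k) (m r) (x -ᵖ y) (edge≢0 k) par (same-side k x y eq))

  parallel-side-const : ∀ r k x y → slope k (m r) ≡ 0ℚ → val r x ≡ val r y → sideVal B k x ≡ sideVal B k y
  parallel-side-const r k x y par eq = same-side⁻ k x y
    (parallel-trans (m r) (edge k) (x -ᵖ y) (m≢0 r) (cross-anti-zero (edge k) (m r) par) (cross-val r x y eq))

  -- Were the side parallel to the move, the line of the link would be the line of the side, which
  -- contains no interior point.
  Link-transversal : ∀ {r a b} k → Link r a b → sideVal B k a ≡ 0ℚ → slope k (m r) ≢ 0ℚ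
  Link-transversal {r} {a} k (link _ _ _ _ o o° oa) ak par =
    ℚₚ.<-irrefl (sym (trans (parallel-side-const r k o a par oa) ak)) (o° k)

  transversal-determines : ∀ r k x y → slope k (m r) ≢ 0ℚ → val r x ≡ val r y → sideVal B k x ≡ sideVal B k y → x ≡ y
  transversal-determines r k x y tr vr sk = p-q≡0⇒p≡q x y
    (cross-span (edge k) (m r) (x -ᵖ y) tr (same-side k x y sk) (cross-val r x y vr))

  common-side⇒¬Link : ∀ {r a b} → Link r a b → CommonSide a b → ⊥
  common-side⇒¬Link {r} {a} {b} l (k , ak , bk) = Link-transversal k l ak
    (common-side-parallel r k a b (Link.distinct l) (Link.aligned l) ak bk)

  -- No search for an interior point is required: the two alternatives of `link-or-common-side`
  -- exclude each other.
  Link? : ∀ r a b → Dec (Link r a b)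
  Link? r a b = cases (OnBoundary? a) (OnBoundary? b) (a ≟ᵖ b) (val r a ℚₚ.≟ val r b)
    where
    cases : Dec (OnBoundary B a) → Dec (OnBoundary B b) → Dec (a ≡ b) → Dec (val r a ≡ val r b) → Dec (Link r a b)
    cases (no ¬ba) _ _ _ = no λ l → ¬ba (Link.source l)
    cases (yes _) (no ¬bb) _ _ = no λ l → ¬bb (Link.target l)
    cases (yes _) (yes _) (yes a≡b) _ = no λ l → Link.distinct l a≡b
    cases (yes _) (yes _) (no _) (no ¬ab) = no λ l → ¬ab (Link.aligned l)
    cases (yes ba) (yes bb) (no a≢b) (yes ab) = decide (link-or-common-side r a b ba bb a≢b ab)
      where
      decide : Link r a b ⊎ CommonSide a b → Dec (Link r a b)
      decide (inj₁ l) = yes l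
      decide (inj₂ common) = no λ l → common-side⇒¬Link l common

  -- Boundedness of the board. If no side value decreased along d, then `cross (corner k) d` would
  -- not decrease around the cycle, hence be constant, and d would be parallel to two independent
  -- sides.
  slopes-not-all-nonNeg : ∀ d → (∀ k → 0ℚ ≤ℚ slope k d) → d ≡ (0ℚ , 0ℚ)
  slopes-not-all-nonNeg d slopes≥0 = cross-span (edge k₀) (edge (next k₀)) d (turn≢0 k₀) (flat k₀) (flat (next k₀))
    where
    k₀ : Fin n
    k₀ = fromℕ< {0} (ℕₚ.<-≤-trans (s≤s z≤n) three≤n)
    F : Fin n → ℚ
    F k = cross (corner k) d
    slope≡ : ∀ k → slope k d ≡ F (next k) - F k
    slope≡ k = cross-subˡ (corner (next k)) (corner k) d
    F↑ : ∀ k → F k ≤ℚ F (next k)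
    F↑ k = 0≤b-a⇒a≤b {F k} {F (next k)} (subst (0ℚ ≤ℚ_) (slope≡ k) (slopes≥0 k))
    flat : ∀ k → slope k d ≡ 0ℚ
    flat k = trans (slope≡ k) (a≡b⇒a-b≡0 {F (next k)} {F k} (cyclic-constant F F↑ (next k) k))

  -- `outward` makes `place` the last board point of the ray: beyond it the value of `side` is
  -- negative.
  record Exit (p d : Pt) : Set where
    constructor exit
    field
      time      : ℚ
      time≥0    : 0ℚ ≤ℚ time
      inside    : InB B (p +ᵖ (time ·ᵖ d))
      side      : Fin n
      on-side   : sideVal B side (p +ᵖ (time ·ᵖ d)) ≡ 0ℚ
      outward   : slope side d <ℚ 0ℚ

    place : Pt
    place = p +ᵖ (time ·ᵖ d)

    place-boundary : OnBoundary B place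
    place-boundary = side⇒boundary place side inside on-side

  find-exit : ∀ p d → InB B p → d ≢ (0ℚ , 0ℚ) → Exit p d
  find-exit p d p∈B d≢0 with first-root n (λ k → sideVal B k p) (λ k → slope k d) p∈B
  ... | inj₁ slopes≥0 = contradiction (slopes-not-all-nonNeg d slopes≥0) d≢0
  ... | inj₂ (t , t≥0 , all , k , z , neg) = exit t t≥0 (λ k → subst (0ℚ ≤ℚ_) (sym (side-line k p d t)) (all k))
          k (trans (side-line k p d t) z) neg

  neg-m≢0 : ∀ r → negᵖ (m r) ≢ (0ℚ , 0ℚ)
  neg-m≢0 r eq = m≢0 r (cong₂ _,_ (un-neg (cong proj₁ eq)) (un-neg (cong proj₂ eq)))
    where
    un-neg : ∀ {x} → - x ≡ 0ℚ → x ≡ 0ℚ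
    un-neg {x} e = ℚₚ.neg-injective {x} {0ℚ} e

  val-neg-move : ∀ r p t → val r (p +ᵖ (t ·ᵖ negᵖ (m r))) ≡ val r p
  val-neg-move r p t = trans (cong (λ e → val r (p +ᵖ e)) (reflected t (m r))) (val-move r p (- t))
    where
    reflected : ∀ t d → t ·ᵖ negᵖ d ≡ (- t) ·ᵖ d
    reflected t (x , y) = cong₂ _,_ (eq x) (eq y)
      where
      eq : ∀ x → t * - x ≡ - t * x
      eq x = solve 2 (λ t x → t :* :- x := :- t :* x) refl t x

  -- The linked point is in the board, so the exit is not before it and differs from `a`. A common
  -- side of `a` and the exit would be parallel to the move, which the given link forbids.
  exit-linked : ∀ r d a λ′ → (∀ t → val r (a +ᵖ (t ·ᵖ d)) ≡ val r a) → (e : Exit a d) →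
                Link r a (a +ᵖ (λ′ ·ᵖ d)) → 0ℚ <ℚ λ′ → Link r a (Exit.place e)
  exit-linked r d a λ′ on-d e l λ′>0 = conclude (link-or-common-side r a place (Link.source l) place-boundary a≢b (sym (on-d t)))
    where
    open Exit e renaming (time to t)
    beyond : ∀ s l t σ → s + t * σ ≡ 0ℚ → s + l * σ ≡ (t - l) * - σ
    beyond s l t σ eq = trans (solve 4 (λ s l t σ → s :+ l :* σ := s :+ t :* σ :+ (t :- l) :* :- σ) refl s l t σ)
      (trans (cong (_+ (t - l) * - σ) eq) (ℚₚ.+-identityˡ ((t - l) * - σ)))
    λ′≤t : λ′ ≤ℚ t
    λ′≤t = 0≤b-a⇒a≤b (nonNeg-cancel {(- slope side d)} {t - λ′} (neg⇒0<- outward) (subst (0ℚ ≤ℚ_)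
      (trans (trans (side-line side a d λ′) (beyond (sideVal B side a) λ′ t (slope side d)
        (trans (sym (side-line side a d t)) on-side))) (ℚₚ.*-comm (t - λ′) (- slope side d)))
      (proj₁ (Link.target l) side)))
    t≢0 : t ≢ 0ℚ
    t≢0 eq = ℚₚ.<-irrefl (sym eq) (ℚₚ.<-≤-trans λ′>0 λ′≤t)
    a≢b : a ≢ place
    a≢b eq = ℚₚ.<-irrefl (a*b≡0⇒b≡0 {t} t≢0 (trans (solve 3 (λ s t σ → t :* σ := s :+ t :* σ :- s) refl (sideVal B side a) t (slope side d))
      (a≡b⇒a-b≡0 (trans (sym (side-line side a d t)) (cong (sideVal B side) (sym eq)))))) outward
    conclude : Link r a place ⊎ CommonSide a place → Link r a place
    conclude (inj₁ l′) = l′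
    conclude (inj₂ (k , ak , bk)) =
      contradiction (common-side-parallel r k a place a≢b (sym (on-d t)) ak bk) (Link-transversal k l ak)

  -- By `exit-linked` the exits along `m r` and its opposite are the only candidates to be tested.
  successor : ∀ r a → OnBoundary B a → (∃[ b ] Link r a b) ⊎ (∀ b → ¬ Link r a b)
  successor r a ba = cases (Link? r a (Exit.place e⁺)) (Link? r a (Exit.place e⁻))
    where
    e⁺ : Exit a (m r)
    e⁺ = find-exit a (m r) (proj₁ ba) (m≢0 r)
    e⁻ : Exit a (negᵖ (m r))
    e⁻ = find-exit a (negᵖ (m r)) (proj₁ ba) (neg-m≢0 r)
    cases : Dec (Link r a (Exit.place e⁺)) → Dec (Link r a (Exit.place e⁻)) → (∃[ b ] Link r a b) ⊎ (∀ b → ¬ Link r a b)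
    cases (yes l) _ = inj₁ (Exit.place e⁺ , l)
    cases (no _) (yes l) = inj₁ (Exit.place e⁻ , l)
    cases (no ¬l⁺) (no ¬l⁻) = inj₂ none
      where
      none : ∀ b → ¬ Link r a b
      none b l = signed (on-line r a b (Link.aligned l))
        where
        signed : ∃[ t ] b ≡ a +ᵖ (t ·ᵖ m r) → ⊥
        signed (t , eq) = compare (ℚₚ.<-cmp t 0ℚ)
          where
          l′ : Link r a (a +ᵖ (t ·ᵖ m r))
          l′ = subst (Link r a) eq l
          compare : Tri (t <ℚ 0ℚ) (t ≡ 0ℚ) (0ℚ <ℚ t) → ⊥
          compare (tri< t<0 _ _) = ¬l⁻ (exit-linked r (negᵖ (m r)) a (- t) (val-neg-move r a) e⁻
                (subst (λ e → Link r a (a +ᵖ e)) (neg-neg-·ᵖ t (m r)) l′) (neg⇒0<- t<0))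
          compare (tri≈ _ t≡0 _) = Link.distinct l′ (sym (trans (cong (λ t → a +ᵖ (t ·ᵖ m r)) t≡0) (+ᵖ-zero a (m r))))
          compare (tri> _ _ t>0) = ¬l⁺ (exit-linked r (m r) a t (val-move r a) e⁺ l′ t>0)

  opposite-exit : ∀ r d p b s → (∀ t → val r (p +ᵖ (t ·ᵖ d)) ≡ val r p) → Interior B p → OnBoundary B b →
                  b ≡ p +ᵖ (s ·ᵖ negᵖ d) → 0ℚ <ℚ s → val r p ≡ val r b → Exit p d → ∃[ b′ ] Link r b b′
  opposite-exit r d p b s on-d p° bb b≡ s>0 pb e = place , link bb place-boundary
      (λ eq → ℚₚ.<-irrefl (sym (trans (cong (sideVal B side) eq) on-side)) b>0)
      (trans (sym pb) (sym (on-d time))) p p° pb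
    where
    open Exit e
    b>0 : 0ℚ <ℚ sideVal B side b
    b>0 = subst (0ℚ <ℚ_) (sym (trans (cong (sideVal B side) b≡) (trans (side-line side p (negᵖ d) s)
        (cong (λ x → sideVal B side p + s * x) (cross-negʳ (edge side) d)))))
      (pos+nonNeg (p° side) (ℚₚ.<⇒≤ (pos* s>0 (neg⇒0<- outward))))

  -- The ray from p pointing away from b exits through a side whose value falls along it; that value
  -- is positive at b and zero at the exit, so the two differ.
  opposite : ∀ r p b → Interior B p → OnBoundary B b → val r p ≡ val r b → ∃[ b′ ] Link r b b′
  opposite r p b p° bb pb = conclude (on-line r p b pb)
    where
    conclude : ∃[ t ] b ≡ p +ᵖ (t ·ᵖ m r) → ∃[ b′ ] Link r b b′
    conclude (t , eq) with boundary-sign p (m r) t p° (subst (OnBoundary B) eq bb)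
    ... | inj₁ t>0 = opposite-exit r (negᵖ (m r)) p b t (val-neg-move r p) p° bb
            (trans eq (cong (λ d → p +ᵖ (t ·ᵖ d)) (sym (negᵖ-involutive (m r))))) t>0 pb
            (find-exit p (negᵖ (m r)) (interior⇒InB p p°) (neg-m≢0 r))
    ... | inj₂ t<0 = opposite-exit r (m r) p b (- t) (val-move r p) p° bb
            (trans eq (cong (p +ᵖ_) (neg-neg-·ᵖ t (m r)))) (neg⇒0<- t<0) pb
            (find-exit p (m r) (interior⇒InB p p°) (m≢0 r))

Unique-resp-↭ : {A : Set} {xs ys : List A} → xs ↭ ys → Unique xs → Unique ys
Unique-resp-↭ {A} p = Permutationₛ.Unique-resp-↭ (setoid A) (↭⇒↭ₛ p)

lookup-injective : {A : Set} {xs : List A} → Unique xs → ∀ i j → lookup xs i ≡ lookup xs j → i ≡ j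
lookup-injective {xs = _ ∷ _} _ zero zero _ = refl
lookup-injective {xs = _ ∷ xs} (x∉ ∷ _) zero (suc j) eq = contradiction eq (All.lookup x∉ (∈-lookup j))
lookup-injective {xs = _ ∷ xs} (x∉ ∷ _) (suc i) zero eq = contradiction (sym eq) (All.lookup x∉ (∈-lookup i))
lookup-injective {xs = _ ∷ _} (_ ∷ u) (suc i) (suc j) eq = cong suc (lookup-injective u i j eq)

Image : ∀ {q} → (Fin q → Pt) → Pt → Set
Image z p = ∃[ i ] z i ≡ p

-- Pigeonhole, the source of every bound on lengths by q.
unique⊆image⇒length≤ : ∀ {q} (z : Fin q → Pt) {L} → Unique L → (∀ {p} → p ∈ L → Image z p) → length L ℕ.≤ q
unique⊆image⇒length≤ z {L} u L⊆z = Finₚ.injective⇒≤ {f = index} (λ {i} {j} eq → lookup-injective u i j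
    (trans (sym (proj₂ (L⊆z (∈-lookup i)))) (trans (cong z eq) (proj₂ (L⊆z (∈-lookup j))))))
  where
  index : Fin (length L) → Fin _
  index i = proj₁ (L⊆z (∈-lookup i))

same-or-other : ∀ k r → k ≡ r ⊎ k ≡ other r
same-or-other mv₁ mv₁ = inj₁ refl
same-or-other mv₁ mv₂ = inj₂ refl
same-or-other mv₂ mv₁ = inj₂ refl
same-or-other mv₂ mv₂ = inj₁ refl

other≢ : ∀ r → other r ≢ r
other≢ mv₁ ()
other≢ mv₂ ()

-- Trajectories inside a configuration

module Paths (B : Board) (P : Piece) (m : Move → Pt) (m₁×m₂≢0 : cross (m mv₁) (m mv₂) ≢ 0ℚ) where
  open Board B
  open Dynamics B m m₁×m₂≢0 public

  last : Pt → List Pt → Pt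
  last = lastPt B P

  segs : List Pt → List (Pt × Pt)
  segs = segments B P

  -- In Path s r x xs the path leaves x in direction r and would leave its last point in direction s;
  -- closing it up into a cycle therefore means s ≡ other r together with a link in direction s.
  data Path (s : Move) : Move → Pt → List Pt → Set where
    single : ∀ {x} → OnBoundary B x → Path s s x []
    step   : ∀ {r x y ys} → Link r x y → Path s (other r) y ys → Path s r x (y ∷ ys)

  path-boundary : ∀ {s r x xs} → Path s r x xs → All (OnBoundary B) (x ∷ xs)
  path-boundary (single bx) = bx ∷ []
  path-boundary (step l p) = Link.source l ∷ path-boundary p

  last∈ : ∀ x xs → last x xs ∈ x ∷ xs
  last∈ x [] = here refl
  last∈ x (y ∷ ys) = there (last∈ y ys)

  Adjacent : List Pt → Pt → Pt → Set
  Adjacent L a b = (a , b) ∈ segs L ⊎ (b , a) ∈ segs L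

  segs⇒∈ : ∀ L {a b} → (a , b) ∈ segs L → a ∈ L × b ∈ L
  segs⇒∈ (x ∷ y ∷ ys) (here refl) = here refl , there (here refl)
  segs⇒∈ (x ∷ y ∷ ys) (there ab∈) = let (a∈ , b∈) = segs⇒∈ (y ∷ ys) ab∈ in there a∈ , there b∈

  adjacent⇒∈ : ∀ L {a b} → Adjacent L a b → b ∈ L
  adjacent⇒∈ L (inj₁ ab∈) = proj₂ (segs⇒∈ L ab∈)
  adjacent⇒∈ L (inj₂ ba∈) = proj₁ (segs⇒∈ L ba∈)

  -- A boundary point has at most one link per move. Inner points of a path spend both on the path,
  -- so only the head in direction `other r` and the last point in direction `s` have one to spare.
  neighbour : ∀ {s r x xs y k c} → Path s r x xs → y ∈ x ∷ xs → Link k y c →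
              Adjacent (x ∷ xs) y c ⊎ (y ≡ x × k ≡ other r) ⊎ (y ≡ last x xs × k ≡ s)
  neighbour {s} {k = k} (single _) (here refl) l with same-or-other k s
  ... | inj₁ k≡s  = inj₂ (inj₂ (refl , k≡s))
  ... | inj₂ k≡s′ = inj₂ (inj₁ (refl , k≡s′))
  neighbour {r = r} {k = k} (step l′ p) (here refl) l with same-or-other k r
  ... | inj₁ refl = inj₁ (inj₁ (here (cong (_ ,_) (Link-functional l l′))))
  ... | inj₂ k≡r′ = inj₂ (inj₁ (refl , k≡r′))
  neighbour {r = r} (step l′ p) (there y∈) l with neighbour p y∈ l
  ... | inj₁ (inj₁ yc∈) = inj₁ (inj₁ (there yc∈))
  ... | inj₁ (inj₂ cy∈) = inj₁ (inj₂ (there cy∈))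
  ... | inj₂ (inj₂ end) = inj₂ (inj₂ end)
  -- The spare move at the head of the tail is the one by which the path arrived there, so the link
  -- leads back to x.
  ... | inj₂ (inj₁ (refl , k≡r″)) with trans k≡r″ (other-involutive r)
  ...   | refl = inj₁ (inj₂ (here (cong (_, _) (Link-functional l (Link-sym l′)))))

  -- Seen from y, the link leads to x. It is no link of the tail, which does not contain x, and it
  -- does not use the arrival move, so y is the last point.
  path-back : ∀ {s r x xs y} → Unique (x ∷ xs) → Path s r x xs → y ∈ x ∷ xs → Link (other r) x y →
              y ≡ last x xs × s ≡ other r
  path-back _ _ (here refl) l = contradiction refl (Link.distinct l)
  path-back {r = r} {x} u (step {ys = ys} l′ p) (there y∈) l with neighbour p y∈ (Link-sym l)
  ... | inj₁ adj = contradiction (adjacent⇒∈ (_ ∷ ys) adj) (Uniqueₚ.Unique[x∷xs]⇒x∉xs u)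
  ... | inj₂ (inj₁ (_ , eq)) = contradiction (sym eq) (other≢ (other r))
  ... | inj₂ (inj₂ (eq , eq′)) = eq , sym eq′

  spread-to-head : ∀ {s r x xs y} (S : Pt → Set) → Path s r x xs →
                   (∀ {a b k} → a ∈ x ∷ xs → b ∈ x ∷ xs → Link k a b → S a → S b) → y ∈ x ∷ xs → S y → S x
  spread-to-head S p closed (here refl) Sy = Sy
  spread-to-head S (step l p) closed (there y∈) Sy = closed (there (here refl)) (here refl) (Link-sym l)
    (spread-to-head S p (λ a∈ b∈ → closed (there a∈) (there b∈)) y∈ Sy)

  spread-from-head : ∀ {s r x xs y} (S : Pt → Set) → Path s r x xs →
                     (∀ {a b k} → a ∈ x ∷ xs → b ∈ x ∷ xs → Link k a b → S a → S b) → S x → y ∈ x ∷ xs → S y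
  spread-from-head S p closed Sx (here refl) = Sx
  spread-from-head S (step l p) closed Sx (there y∈) = spread-from-head S p
    (λ a∈ b∈ → closed (there a∈) (there b∈)) (closed (here refl) (there (here refl)) l Sx) y∈

  spread : ∀ {s r x xs y z} (S : Pt → Set) → Path s r x xs →
           (∀ {a b k} → a ∈ x ∷ xs → b ∈ x ∷ xs → Link k a b → S a → S b) → y ∈ x ∷ xs → S y → z ∈ x ∷ xs → S z
  spread S p closed y∈ Sy z∈ = spread-from-head S p closed (spread-to-head S p closed y∈ Sy) z∈

  -- Reversal with an accumulator: `acc` leaves x by the move that the path does not use there, so
  -- alternation survives. The permutation carries over uniqueness and containment.
  reverse-onto : ∀ {s r t x xs acc} → Path s r x xs → Path t (other r) x acc →
                 ∃[ ys ] Path t (other s) (last x xs) ys × last (last x xs) ys ≡ last x acc ×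
                         last x xs ∷ ys ↭ x ∷ xs ++ acc
  reverse-onto (single _) q = _ , q , refl , ↭-refl
  reverse-onto {t = t} {x} {acc = acc} (step {r} {y = y} {ys} l p) q
    with reverse-onto p (subst (λ k → Path t k y (x ∷ acc)) (sym (other-involutive r)) (step (Link-sym l) q))
  ... | zs , path , eq , perm = zs , path , eq , ↭-trans perm (↭ₚ.shift x (y ∷ ys) acc)

  reverse-path : ∀ {s r x xs} → Path s r x xs →
                 ∃[ ys ] Path (other r) (other s) (last x xs) ys × last (last x xs) ys ≡ x × last x xs ∷ ys ↭ x ∷ xs
  reverse-path {x = x} {xs} p with reverse-onto p (single (All.lookup (path-boundary p) (here refl)))
  ... | ys , path , eq , perm = ys , path , eq , ↭-trans perm (↭ₚ.++-identityʳ (x ∷ xs))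

  module _ {q} (z : Fin q → Pt) where

    Stuck : Move → Pt → Set
    Stuck k a = ∀ b → Image z b → ¬ Link k a b

    record Extension (s : Move) (x : Pt) (xs : List Pt) : Set where
      field
        {r}      : Move
        {head}   : Pt
        {rest}   : List Pt
        path     : Path s r head rest
        unique   : Unique (head ∷ rest)
        ⊆image   : All (Image z) (head ∷ rest)
        extends  : ∀ {p} → p ∈ x ∷ xs → p ∈ head ∷ rest
        same-end : last head rest ≡ last x xs
        ending   : s ≡ other r × Link s (last head rest) head ⊎ Stuck (other r) head

    -- The path grows at its head. Its points are distinct places of z, at most q of them, so fuel
    -- bringing the total to q + 1 cannot run out.
    extend : ∀ fuel {s r x xs} → Path s r x xs → Unique (x ∷ xs) → All (Image z) (x ∷ xs) →
             length (x ∷ xs) ℕ.+ fuel ≡ suc q → Extension s x xs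
    extend zero {x = x} {xs} p u L⊆z eq = contradiction
      (ℕₚ.≤-trans (ℕₚ.≤-reflexive (trans (sym eq) (ℕₚ.+-identityʳ _))) (unique⊆image⇒length≤ z u (All.lookup L⊆z)))
      (ℕₚ.<-irrefl refl)
    extend (suc fuel) {s} {r} {x} {xs} p u L⊆z eq = search (Finₚ.any? λ i → Link? (other r) x (z i))
      where
      search : Dec (∃[ i ] Link (other r) x (z i)) → Extension s x xs
      search (no none) = record { path = p ; unique = u ; ⊆image = L⊆z ; extends = λ p∈ → p∈ ; same-end = refl
        ; ending = inj₂ λ { b (i , refl) l → none (i , l) } }
      search (yes (i , l)) = visited (z i ∈? (x ∷ xs))
        where
        visited : Dec (z i ∈ x ∷ xs) → Extension s x xs
        -- By `path-back` a place met again is the far end, and the chain closes up.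
        visited (yes y∈) = record { path = p ; unique = u ; ⊆image = L⊆z ; extends = λ p∈ → p∈ ; same-end = refl
          ; ending = inj₁ (proj₂ back , subst₂ (λ k y → Link k y x) (sym (proj₂ back)) (proj₁ back) (Link-sym l)) }
          where
          back : z i ≡ last x xs × s ≡ other r
          back = path-back u p y∈ l
        visited (no y∉) = record { Extension E ; extends = λ p∈ → Extension.extends E (there p∈) }
          where
          E : Extension s (z i) (x ∷ xs)
          E = extend fuel (step (Link-sym l) (subst (λ k → Path s k x xs) (sym (other-involutive r)) p))
                (Allₚ.¬Any⇒All¬ (x ∷ xs) y∉ ∷ u) ((i , refl) ∷ L⊆z) (trans (cong suc (sym (ℕₚ.+-suc _ fuel))) eq)

    record Component (b : Pt) : Set where
      field
        {s r}    : Move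
        {head}   : Pt
        {rest}   : List Pt
        path     : Path s r head rest
        unique   : Unique (head ∷ rest)
        ⊆image   : All (Image z) (head ∷ rest)
        contains : b ∈ head ∷ rest
        ending   : s ≡ other r × Link s (last head rest) head ⊎ Stuck (other r) head × Stuck s (last head rest)

      points : List Pt
      points = head ∷ rest

    extension-length : ∀ {x xs} → Unique (x ∷ xs) → All (Image z) (x ∷ xs) →
                       ∃[ fuel ] length (x ∷ xs) ℕ.+ fuel ≡ suc q
    extension-length u L⊆z = _ , ℕₚ.m+[n∸m]≡n (ℕₚ.m≤n⇒m≤1+n (unique⊆image⇒length≤ z u (All.lookup L⊆z)))

    -- Grow from b at the head; unless the chain has closed up, reverse it and grow at the other
    -- end.
    component : ∀ b → OnBoundary B b → Image z b → Component b
    component b bb b∈z = finish (extend (proj₁ len₁) p₁ ([] ∷ []) (b∈z ∷ []) (proj₂ len₁))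
      where
      -- On one point the choice is arbitrary: `mv₂` remains free at the head and `mv₁` at the other
      -- end.
      p₁ : Path mv₁ mv₁ b []
      p₁ = single bb
      len₁ : ∃[ fuel ] 1 ℕ.+ fuel ≡ suc q
      len₁ = extension-length ([] ∷ []) (b∈z ∷ [])
      finish : Extension mv₁ b [] → Component b
      finish record { path = p ; unique = u ; ⊆image = L⊆z ; extends = ext ; ending = inj₁ closed } =
        record { path = p ; unique = u ; ⊆image = L⊆z ; contains = ext (here refl) ; ending = inj₁ closed }
      finish record { r = r ; head = head ; rest = rest ; path = p ; unique = u ; ⊆image = L⊆z ; extends = ext ; ending = inj₂ stuck }
        with reverse-path p
      ... | ys , p′ , end , perm = both (extend (proj₁ len₂) p′ u′ L⊆z′ (proj₂ len₂))
        where
        u′ : Unique (last head rest ∷ ys)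
        u′ = Unique-resp-↭ (↭-sym perm) u
        L⊆z′ : All (Image z) (last head rest ∷ ys)
        L⊆z′ = ↭ₚ.All-resp-↭ (↭-sym perm) L⊆z
        len₂ : ∃[ fuel ] length (last head rest ∷ ys) ℕ.+ fuel ≡ suc q
        len₂ = extension-length u′ L⊆z′
        both : Extension (other r) (last head rest) ys → Component b
        both record { head = h ; rest = t ; path = p ; unique = u ; ⊆image = L⊆z ; extends = ext′ ; same-end = eq ; ending = e } =
          record { path = p ; unique = u ; ⊆image = L⊆z
                 ; contains = ext′ (↭ₚ.∈-resp-↭ (↭-sym perm) (ext (here refl))) ; ending = inj₂ (decide e) }
          where
          final : last h t ≡ head
          final = trans eq end
          decide : ∀ {r′} → other r ≡ other r′ × Link (other r) (last h t) h ⊎ Stuck (other r′) h →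
                   Stuck (other r′) h × Stuck (other r) (last h t)
          -- The end that was stuck before the reversal is now the last point, so the second growth
          -- cannot close up.
          decide (inj₁ (_ , l)) = contradiction (subst (λ a → Link (other r) a h) final l) (stuck h (All.lookup L⊆z (here refl)))
          decide (inj₂ stuck′) = stuck′ , subst (Stuck (other r)) (sym final) stuck

    Closed : (Pt → Set) → Set
    Closed S = ∀ {a c k} → S a → Image z c → Link k a c → S c

    -- A link out of the path starts at an end in its spare direction, where it is either the
    -- closing link or excluded by stuckness.
    component-closed : ∀ {b} (C : Component b) → Closed (_∈ Component.points C)
    component-closed C {a} {c} {k} a∈ c∈z l = cases (neighbour path a∈ l) ending
      where
      open Component C
      cases : Adjacent points a c ⊎ (a ≡ head × k ≡ other r) ⊎ (a ≡ last head rest × k ≡ s) →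
              (s ≡ other r × Link s (last head rest) head ⊎ Stuck (other r) head × Stuck s (last head rest)) → c ∈ points
      cases (inj₁ adj) _ = adjacent⇒∈ points adj
      cases (inj₂ (inj₁ (refl , refl))) (inj₁ (refl , l′)) =
        subst (_∈ points) (sym (Link-functional l (Link-sym l′))) (last∈ head rest)
      cases (inj₂ (inj₂ (refl , refl))) (inj₁ (_ , l′)) = subst (_∈ points) (sym (Link-functional l l′)) (here refl)
      cases (inj₂ (inj₁ (refl , refl))) (inj₂ (stuck , _)) = contradiction l (stuck c c∈z)
      cases (inj₂ (inj₂ (refl , refl))) (inj₂ (_ , stuck)) = contradiction l (stuck c c∈z)

_≟ᵐ_ : (k r : Move) → Dec (k ≡ r)
mv₁ ≟ᵐ mv₁ = yes refl
mv₁ ≟ᵐ mv₂ = no λ ()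
mv₂ ≟ᵐ mv₁ = no λ ()
mv₂ ≟ᵐ mv₂ = yes refl

x+1*d≡x⇒d≡0 : ∀ x d → x + 1ℚ * d ≡ x → d ≡ 0ℚ
x+1*d≡x⇒d≡0 x d eq = trans (solve 2 (λ x d → d := x :+ con 1ℚ :* d :- x) refl x d) (a≡b⇒a-b≡0 eq)

cross-scaleʳ : ∀ u c v → cross u (c ·ᵖ v) ≡ c * cross u v
cross-scaleʳ (a , b) c (d , e) = solve 5 (λ a b c d e → a :* (c :* e) :- b :* (c :* d) := c :* (a :* e :- b :* d)) refl a b c d e

cross-scaleˡ : ∀ u c v → cross (c ·ᵖ u) v ≡ c * cross u v
cross-scaleˡ (a , b) c (d , e) = solve 5 (λ a b c d e → c :* a :* e :- c :* b :* d := c :* (a :* e :- b :* d)) refl a b c d e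

-- Full rank

module Rigidity (B : Board) (P : Piece) (m : Move → Pt) (m₁×m₂≢0 : cross (m mv₁) (m mv₂) ≢ 0ℚ) where
  open Board B
  open Paths B P m m₁×m₂≢0 public

  AttackPreserving : (Pt → Set) → (Pt → Pt) → Set
  AttackPreserving X f = ∀ r p p′ → X p → X p′ → val r p ≡ val r p′ → val r (f p) ≡ val r (f p′)

  FixationPreserving : (Pt → Set) → (Pt → Pt) → Set
  FixationPreserving X f = ∀ k p → X p → sideVal B k p ≡ 0ℚ → sideVal B k (f p) ≡ 0ℚ

  Respects : (Pt → Set) → (Pt → Pt) → Set
  Respects X f = AttackPreserving X f × FixationPreserving X f

  -- Two pieces at the same place attack each other along both moves, so a solution of the system of all
  -- hyperplanes through a configuration depends only on the set X of places and is a map f on places.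
  Rigid : (Pt → Set) → Set
  Rigid X = ∀ f → Respects X f → ∀ p → X p → f p ≡ p

  Respects-⊆ : ∀ X Y f → (∀ {p} → Y p → X p) → Respects X f → Respects Y f
  Respects-⊆ X Y f Y⊆X (att , fix) = (λ r p p′ yp yp′ → att r p p′ (Y⊆X yp) (Y⊆X yp′)) , (λ k p yp → fix k p (Y⊆X yp))

  -- The link confines f b to the line through the fixed point a, and the fixation at b to a side
  -- transversal to that line.
  fixed-link : ∀ {X f r a b} → Respects X f → X a → X b → Link r a b → f a ≡ a → f b ≡ b
  fixed-link {f = f} {r} {a} {b} (att , fix) xa xb l fa≡a = conclude (boundary-side b (Link.target l))
    where
    conclude : ∃[ k ] sideVal B k b ≡ 0ℚ → f b ≡ b
    conclude (k , bk) = transversal-determines r k (f b) b (Link-transversal k (Link-sym l) bk)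
      (trans (sym (att r a b xa xb (Link.aligned l))) (trans (cong (val r) fa≡a) (Link.aligned l)))
      (trans (fix k b xb bk) (sym bk))

  fixed-corner : ∀ {X f c} → Respects X f → X c → IsCorner B c → f c ≡ c
  fixed-corner {f = f} (att , fix) xc (k , refl) = conclude (previous k)
    where
    conclude : ∃[ j ] next j ≡ k → f (corner k) ≡ corner k
    conclude (j , refl) = corner-unique j (f (corner k)) (fix j (corner k) xc (side-next-corner j))
      (fix k (corner k) xc (side-corner k))

  corner-path-rigid : ∀ {s r x xs} → Path s r x xs → Any (IsCorner B) (x ∷ xs) → Rigid (_∈ x ∷ xs)
  corner-path-rigid p corner∈ f resp y y∈ = conclude (find corner∈)
    where
    conclude : ∃[ c ] c ∈ _ × IsCorner B c → f y ≡ y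
    conclude (c , c∈ , isC) = spread (λ p → f p ≡ p) p (λ a∈ b∈ l → fixed-link {f = f} resp a∈ b∈ l)
      c∈ (fixed-corner {f = f} resp c∈ isC) y∈

  -- Moves every line along a move as a whole, from coordinate t to `U r t`; attacks are then
  -- preserved automatically.
  move-by : (Move → ℚ → ℚ) → Pt → Pt
  move-by U p = proj₁ (with-vals (U mv₁ (val mv₁ p)) (U mv₂ (val mv₂ p)))

  val-move-by : ∀ U r p → val r (move-by U p) ≡ U r (val r p)
  val-move-by U mv₁ p = proj₁ (proj₂ (with-vals (U mv₁ (val mv₁ p)) (U mv₂ (val mv₂ p))))
  val-move-by U mv₂ p = proj₂ (proj₂ (with-vals (U mv₁ (val mv₁ p)) (U mv₂ (val mv₂ p))))

  move-by-attack : ∀ X U → AttackPreserving X (move-by U)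
  move-by-attack X U r p p′ _ _ eq = trans (val-move-by U r p) (trans (cong (U r) eq) (sym (val-move-by U r p′)))

  move-by-agrees : ∀ U p p′ → (∀ r → U r (val r p) ≡ val r p′) → move-by U p ≡ p′
  move-by-agrees U p p′ eq = vals-determine mv₁ (trans (val-move-by U mv₁ p) (eq mv₁)) (trans (val-move-by U mv₂ p) (eq mv₂))

  module _ {q} (z : Fin q → Pt) (z∈B : ∀ i → InB B (z i)) where

    image⊆B : ∀ {p} → Image z p → InB B p
    image⊆B (i , refl) = z∈B i

    -- A solution on L extends to all of z: move every r-line along with the points of L on it. By closedness
    -- a boundary point off L can share a line with L only along a side parallel to it, and such a line stays put.
    closed⇒rigid : ∀ L → All (OnBoundary B) L → All (Image z) L → Closed z (_∈ L) → Rigid (Image z) → Rigid (_∈ L)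
    closed⇒rigid L bL L⊆z closed rigid f (att , fix) p p∈ =
      trans (sym (on-L p p∈)) (rigid (move-by U) (move-by-attack (Image z) U , fixations) p (All.lookup L⊆z p∈))
      where
      U : Move → ℚ → ℚ
      U r t = choose (Any.any? (λ b → val r b ℚₚ.≟ t) L)
        where
        choose : Dec (Any (λ b → val r b ≡ t) L) → ℚ
        choose (yes b∈) = val r (f (proj₁ (find b∈)))
        choose (no _) = t
      -- `U` reads off some point of L on the line; `hit` covers every such point, so the choice is
      -- immaterial.
      U-on : ∀ r t v → (∀ b → b ∈ L → val r b ≡ t → val r (f b) ≡ v) → (¬ Any (λ b → val r b ≡ t) L → t ≡ v) → U r t ≡ v
      U-on r t v hit miss with Any.any? (λ b → val r b ℚₚ.≟ t) L
      ... | yes b∈ = hit (proj₁ (find b∈)) (proj₁ (proj₂ (find b∈))) (proj₂ (proj₂ (find b∈)))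
      ... | no none = miss none
      on-L : ∀ p → p ∈ L → move-by U p ≡ f p
      on-L p p∈ = move-by-agrees U p (f p) λ r → U-on r (val r p) (val r (f p))
        (λ b b∈ eq → att r b p b∈ p∈ eq) (λ none → contradiction (lose p∈ refl) none)
      off-L : ∀ p → Image z p → OnBoundary B p → p ∉ L → move-by U p ≡ p
      off-L p p∈z bp p∉ = move-by-agrees U p p λ r → U-on r (val r p) (val r p) (hit r) (λ _ → refl)
        where
        hit : ∀ r b → b ∈ L → val r b ≡ val r p → val r (f b) ≡ val r p
        hit r b b∈ eq = cases (link-or-common-side r b p (All.lookup bL b∈) bp b≢p eq)
          where
          b≢p : b ≢ p
          b≢p b≡p = p∉ (subst (_∈ L) b≡p b∈)
          cases : Link r b p ⊎ CommonSide b p → val r (f b) ≡ val r p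
          cases (inj₁ l) = contradiction (closed b∈ p∈z l) p∉
          cases (inj₂ (k , bk , pk)) = trans (parallel-side-val r k (f b) b
            (common-side-parallel r k b p b≢p eq bk pk) (trans (fix k b b∈ bk) (sym bk))) eq
      fixations : FixationPreserving (Image z) (move-by U)
      fixations k p p∈z pk = cases (p ∈? L)
        where
        cases : Dec (p ∈ L) → sideVal B k (move-by U p) ≡ 0ℚ
        cases (yes p∈) = trans (cong (sideVal B k) (on-L p p∈)) (fix k p p∈ pk)
        cases (no p∉) = trans (cong (sideVal B k) (off-L p p∈z (side⇒boundary p k (image⊆B p∈z) pk) p∉)) pk

    -- Otherwise every point on the r-line of p is interior, and translating that line leaves all fixations intact.
    interior-aligned : Rigid (Image z) → ∀ p → Image z p → ∀ r →
                       ∃[ b ] Image z b × OnBoundary B b × val r b ≡ val r p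
    interior-aligned rigid p p∈z r = search (Finₚ.any? λ i → OnBoundary? (z i) ×-dec (val r (z i) ℚₚ.≟ val r p))
      where
      search : Dec (∃[ i ] OnBoundary B (z i) × val r (z i) ≡ val r p) →
               ∃[ b ] Image z b × OnBoundary B b × val r b ≡ val r p
      search (yes (i , bi , eq)) = z i , (i , refl) , bi , eq
      search (no none) = contradiction moved x+1≢x
        where
        shift-dec : ∀ {k t} → Dec (k ≡ r) → Dec (t ≡ val r p) → ℚ
        shift-dec {t = t} (yes _) (yes _) = t + 1ℚ
        shift-dec {t = t} (yes _) (no _) = t
        shift-dec {t = t} (no _) _ = t
        U : Move → ℚ → ℚ
        U k t = shift-dec {k} {t} (k ≟ᵐ r) (t ℚₚ.≟ val r p)
        U-hit : U r (val r p) ≡ val r p + 1ℚ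
        U-hit with r ≟ᵐ r | val r p ℚₚ.≟ val r p
        ... | yes _ | yes _ = refl
        ... | yes _ | no ≢ = contradiction refl ≢
        ... | no ≢ | _ = contradiction refl ≢
        U-miss : ∀ k t → t ≢ val r p ⊎ k ≢ r → U k t ≡ t
        U-miss k t miss = by (k ≟ᵐ r) (t ℚₚ.≟ val r p) miss
          where
          by : (dk : Dec (k ≡ r)) (dt : Dec (t ≡ val r p)) → t ≢ val r p ⊎ k ≢ r → shift-dec {k} {t} dk dt ≡ t
          by (yes _) (no _) _ = refl
          by (no _) _ _ = refl
          by (yes k≡r) (yes t≡) (inj₁ t≢) = contradiction t≡ t≢
          by (yes k≡r) (yes t≡) (inj₂ k≢) = contradiction k≡r k≢
        off-line : ∀ k x → Image z x → sideVal B k x ≡ 0ℚ → move-by U x ≡ x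
        off-line k x (i , refl) xk = move-by-agrees U x x λ k′ → U-miss k′ (val k′ x) (missed k′)
          where
          missed : ∀ k′ → val k′ x ≢ val r p ⊎ k′ ≢ r
          missed k′ with k′ ≟ᵐ r
          ... | no k′≢r = inj₂ k′≢r
          ... | yes refl = inj₁ λ eq → none (i , side⇒boundary x k (z∈B i) xk , eq)
        respects : Respects (Image z) (move-by U)
        respects = move-by-attack (Image z) U ,
          λ k x x∈z xk → trans (cong (sideVal B k) (off-line k x x∈z xk)) xk
        moved : val r p + 1ℚ ≡ val r p
        moved = trans (sym U-hit) (trans (sym (val-move-by U r p)) (cong (val r) (rigid (move-by U) respects p p∈z)))

  -- Sliding an open chain along its sides

  Tangent : Pt → Pt → Set
  Tangent p d = ∀ k → sideVal B k p ≡ 0ℚ → slope k d ≡ 0ℚ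

  -- A solution of the homogeneous equations of the path: every point keeps its sides, and linked
  -- consecutive points change their common line coordinate equally.
  record Displacement (x : Pt) (xs : List Pt) (d : Pt) : Set where
    field
      δ        : Pt → Pt
      initial  : δ x ≡ d
      tangent  : ∀ {p} → p ∈ x ∷ xs → Tangent p (δ p)
      parallel : ∀ {a b k} → (a , b) ∈ segs (x ∷ xs) → Link k a b → val k (δ a) ≡ val k (δ b)

  side-tangent : ∀ c y k → InB B y → ¬ IsCorner B y → sideVal B k y ≡ 0ℚ → Tangent y (c ·ᵖ edge k)
  side-tangent c y k y∈B ¬corner yk j yj with j Fin.≟ k
  ... | yes refl = trans (cross-scaleʳ (edge k) c (edge k)) (trans (cong (c *_) (cross-self (edge k))) (ℚₚ.*-zeroʳ c))
  ... | no j≢k = contradiction (two-sides⇒corner y j k y∈B j≢k yj yk) ¬corner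

  -- y slides along its side, which is transversal to the move r because the r-line of y enters the interior.
  tangent-with-val : ∀ {r x y} → Link r x y → ¬ IsCorner B y → ∀ v → ∃[ d ] Tangent y d × val r d ≡ v
  tangent-with-val {r} {x} {y} l ¬corner v = conclude (boundary-side y (Link.target l))
    where
    conclude : ∃[ k ] sideVal B k y ≡ 0ℚ → ∃[ d ] Tangent y d × val r d ≡ v
    conclude (k , yk) = (v * w) ·ᵖ edge k , side-tangent (v * w) y k (proj₁ (Link.target l)) ¬corner yk , val≡v
      where
      σ≢0 : slope k (m r) ≢ 0ℚ
      σ≢0 = Link-transversal k (Link-sym l) yk
      w : ℚ
      w = proj₁ (inverse σ≢0)
      val≡v : val r ((v * w) ·ᵖ edge k) ≡ v
      val≡v = trans (val≡cross r ((v * w) ·ᵖ edge k)) (trans (cross-scaleˡ (edge k) (v * w) (m r))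
        (trans (ℚₚ.*-assoc v w (slope k (m r))) (trans (cong (v *_) (proj₂ (inverse σ≢0))) (ℚₚ.*-identityʳ v))))

  -- The displacement of x prescribes the change of the line coordinate at y; y slides along its
  -- side to match it, and so on down the path.
  displacement : ∀ {s r x xs} → Path s r x xs → Unique (x ∷ xs) → All (λ p → ¬ IsCorner B p) (x ∷ xs) →
                 ∀ d → Tangent x d → Displacement x xs d
  displacement (single _) _ _ d tan = record
    { δ = λ _ → d ; initial = refl ; tangent = λ { (here refl) → tan } ; parallel = λ () }
  displacement {r = r} {x} (step {y = y} {ys} l p) (x∉ ∷ u) (_ ∷ ¬corners) d tan =
    continue (tangent-with-val l (All.lookup ¬corners (here refl)) (val r d))
    where
    continue : ∃[ d′ ] Tangent y d′ × val r d′ ≡ val r d → Displacement x (y ∷ ys) d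
    continue (d′ , tan′ , eq) = record
      { δ = λ p → δ p (p ≟ᵖ x) ; initial = δ-x (x ≟ᵖ x) ; tangent = tangent ; parallel = parallel }
      where
      D : Displacement y ys d′
      D = displacement p u ¬corners d′ tan′
      module D = Displacement D
      δ : ∀ p → Dec (p ≡ x) → Pt
      δ p (yes _) = d
      δ p (no _) = D.δ p
      δ-x : ∀ dec → δ x dec ≡ d
      δ-x (yes _) = refl
      δ-x (no x≢x) = contradiction refl x≢x
      δ-rest : ∀ {p} → p ∈ y ∷ ys → ∀ dec → δ p dec ≡ D.δ p
      δ-rest p∈ (yes refl) = contradiction refl (All.lookup x∉ p∈)
      δ-rest p∈ (no _) = refl
      tangent : ∀ {p} → p ∈ x ∷ y ∷ ys → Tangent p (δ p (p ≟ᵖ x))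
      tangent (here refl) = subst (Tangent x) (sym (δ-x (x ≟ᵖ x))) tan
      tangent {p} (there p∈) = subst (Tangent p) (sym (δ-rest p∈ (p ≟ᵖ x))) (D.tangent p∈)
      parallel : ∀ {a b k} → (a , b) ∈ segs (x ∷ y ∷ ys) → Link k a b → val k (δ a (a ≟ᵖ x)) ≡ val k (δ b (b ≟ᵖ x))
      parallel {k = k} (here refl) l′ with same-or-other k r
      ... | inj₁ refl = trans (cong (val r) (δ-x (x ≟ᵖ x)))
              (trans (sym eq) (cong (val r) (sym (trans (δ-rest (here refl) (y ≟ᵖ x)) D.initial))))
      -- Distinct points cannot share a line along each of the two moves.
      ... | inj₂ refl = contradiction (vals-determine r (Link.aligned l) (Link.aligned l′)) (Link.distinct l)
      parallel {a} {b} {k} (there ab∈) l′ = let (a∈ , b∈) = segs⇒∈ (y ∷ ys) ab∈ in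
        trans (cong (val k) (δ-rest a∈ (a ≟ᵖ x))) (trans (D.parallel ab∈ l′) (cong (val k) (sym (δ-rest b∈ (b ≟ᵖ x)))))

  module _ {q} (z : Fin q → Pt) where

    -- Without corners l points carry l equations in l + 1 line coordinates; the nonzero solution slides
    -- every point along its side.
    stuck⇒¬rigid : ∀ {s r x xs} → Path s r x xs → Unique (x ∷ xs) → All (Image z) (x ∷ xs) →
                   All (λ p → ¬ IsCorner B p) (x ∷ xs) → Stuck z (other r) x → Stuck z s (last x xs) →
                   ¬ Rigid (_∈ x ∷ xs)
    stuck⇒¬rigid {s} {r} {x} {xs} path u L⊆z ¬corners stuck-head stuck-last rigid = conclude (boundary-side x bx)
      where
      bL : All (OnBoundary B) (x ∷ xs)
      bL = path-boundary path
      bx : OnBoundary B x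
      bx = All.lookup bL (here refl)
      conclude : ∃[ k ] sideVal B k x ≡ 0ℚ → ⊥
      -- The displacement at x is chosen to be the side vector; rigidity would make it zero.
      conclude (k₀ , xk₀) = edge≢0 k₀ (cong₂ _,_
          (trans (sym (ℚₚ.*-identityˡ (proj₁ (edge k₀)))) (still proj₁ (x+1*d≡x⇒d≡0 (proj₁ x) (proj₁ (δ x)) (cong proj₁ fx≡x))))
          (trans (sym (ℚₚ.*-identityˡ (proj₂ (edge k₀)))) (still proj₂ (x+1*d≡x⇒d≡0 (proj₂ x) (proj₂ (δ x)) (cong proj₂ fx≡x)))))
        where
        D : Displacement x xs (1ℚ ·ᵖ edge k₀)
        D = displacement path u ¬corners (1ℚ ·ᵖ edge k₀)
              (side-tangent 1ℚ x k₀ (proj₁ bx) (All.lookup ¬corners (here refl)) xk₀)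
        open Displacement D
        f : Pt → Pt
        f p = p +ᵖ (1ℚ ·ᵖ δ p)
        linked : ∀ {k p p′} → p ∈ x ∷ xs → p′ ∈ x ∷ xs → Link k p p′ → val k (δ p) ≡ val k (δ p′)
        linked {k} {p} {p′} p∈ p′∈ l = cases (neighbour path p∈ l)
          where
          cases : Adjacent (x ∷ xs) p p′ ⊎ (p ≡ x × k ≡ other r) ⊎ (p ≡ last x xs × k ≡ s) → val k (δ p) ≡ val k (δ p′)
          cases (inj₁ (inj₁ pp′∈)) = parallel pp′∈ l
          cases (inj₁ (inj₂ p′p∈)) = sym (parallel p′p∈ (Link-sym l))
          cases (inj₂ (inj₁ (refl , refl))) = contradiction l (stuck-head p′ (All.lookup L⊆z p′∈))
          cases (inj₂ (inj₂ (refl , refl))) = contradiction l (stuck-last p′ (All.lookup L⊆z p′∈))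
        flat : ∀ {k} j p → p ∈ x ∷ xs → slope j (m k) ≡ 0ℚ → sideVal B j p ≡ 0ℚ → val k (δ p) ≡ 0ℚ
        flat {k} j p p∈ par pj = trans (val≡cross k (δ p)) (cross-anti-zero (m k) (δ p)
          (parallel-trans (edge j) (m k) (δ p) (edge≢0 j) par (tangent p∈ j pj)))
        aligned : ∀ k p p′ → p ∈ x ∷ xs → p′ ∈ x ∷ xs → val k p ≡ val k p′ → val k (δ p) ≡ val k (δ p′)
        aligned k p p′ p∈ p′∈ eq = cases (p ≟ᵖ p′)
          where
          cases : Dec (p ≡ p′) → val k (δ p) ≡ val k (δ p′)
          cases (yes refl) = refl
          cases (no p≢p′) = split (link-or-common-side k p p′ (All.lookup bL p∈) (All.lookup bL p′∈) p≢p′ eq)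
            where
            split : Link k p p′ ⊎ CommonSide p p′ → val k (δ p) ≡ val k (δ p′)
            split (inj₁ l) = linked p∈ p′∈ l
            -- The common side is parallel to the move, so sliding along it changes neither line
            -- coordinate.
            split (inj₂ (j , pj , p′j)) = trans (flat j p p∈ par pj) (sym (flat j p′ p′∈ par p′j))
              where
              par : slope j (m k) ≡ 0ℚ
              par = common-side-parallel k j p p′ p≢p′ eq pj p′j
        respects : Respects (_∈ x ∷ xs) f
        respects = (λ k p p′ p∈ p′∈ eq → trans (val-line k p (δ p) 1ℚ) (trans
                      (cong₂ (λ a b → a + 1ℚ * b) eq (aligned k p p′ p∈ p′∈ eq)) (sym (val-line k p′ (δ p′) 1ℚ))))
                 , (λ k p p∈ pk → trans (side-line k p (δ p) 1ℚ) (cong₂ (λ a b → a + 1ℚ * b) pk (tangent p∈ k pk)))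
        fx≡x : f x ≡ x
        fx≡x = rigid f respects x (here refl)
        still : (π : Pt → ℚ) → π (δ x) ≡ 0ℚ → π (1ℚ ·ᵖ edge k₀) ≡ 0ℚ
        still π eq = trans (cong π (sym initial)) eq

cross-dot : ∀ e p c → cross e (p -ᵖ c) ≡ dot (- proj₂ e , proj₁ e) p - dot (- proj₂ e , proj₁ e) c
cross-dot (e , e′) (p , p′) (c , c′) = solve 6 (λ e e′ p p′ c c′ →
  e :* (p′ :- c′) :- e′ :* (p :- c) := (:- e′ :* p :+ e :* p′) :- (:- e′ :* c :+ e :* c′)) refl e e′ p p′ c c′

dot-comm : ∀ u v → dot u v ≡ dot v u
dot-comm (a , b) (c , d) = cong₂ _+_ (ℚₚ.*-comm a c) (ℚₚ.*-comm b d)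

dot-negˡ : ∀ u v → dot (negᵖ u) v ≡ - dot u v
dot-negˡ (a , b) (c , d) = solve 4 (λ a b c d → :- a :* c :+ :- b :* d := :- (a :* c :+ b :* d)) refl a b c d

-- Vertices

pad : ∀ {q} → Pt → List Pt → Fin q → Pt
pad y []       i       = y
pad y (x ∷ xs) zero    = x
pad y (x ∷ xs) (suc i) = pad y xs i

pad∈ : ∀ {q} y xs (i : Fin q) → pad y xs i ∈ y ∷ xs
pad∈ y []       i       = here refl
pad∈ y (x ∷ xs) zero    = there (here refl)
pad∈ y (x ∷ xs) (suc i) with pad∈ y xs i
... | here eq = here eq
... | there e∈ = there (there e∈)

∈-pad : ∀ {q} y xs {p} → length xs ℕ.≤ q → p ∈ xs → Image (pad {q} y xs) p
∈-pad y (x ∷ xs) (s≤s le) (here refl) = zero , refl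
∈-pad y (x ∷ xs) (s≤s le) (there p∈) = let (i , eq) = ∈-pad y xs le p∈ in suc i , eq

image-lookup⇒∈ : ∀ {L p} → Image (lookup L) p → p ∈ L
image-lookup⇒∈ {L} (i , refl) = ∈-lookup i

∈⇒image-lookup : ∀ {L p} → p ∈ L → Image (lookup L) p
∈⇒image-lookup p∈ = Any.index p∈ , sym (Anyₚ.lookup-index p∈)

module Configurations (B : Board) (P : Piece) where
  open Board B
  open Rigidity B P (move P) (moves-independent P) public

  normal≡rotate : ∀ r → normal P r ≡ rotate (move P r)
  normal≡rotate mv₁ = refl
  normal≡rotate mv₂ = refl

  attack-lhs : ∀ r p q → dot (p -ᵖ q) (normal P r) ≡ val r p - val r q
  attack-lhs r p q = trans (cong (dot (p -ᵖ q)) (normal≡rotate r)) (val-diff r p q)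

  attack⇒val : ∀ r p q → dot (p -ᵖ q) (normal P r) ≡ 0ℚ → val r p ≡ val r q
  attack⇒val r p q eq = a-b≡0⇒a≡b {val r p} {val r q} (trans (sym (attack-lhs r p q)) eq)

  val⇒attack : ∀ r p q → val r p ≡ val r q → dot (p -ᵖ q) (normal P r) ≡ 0ℚ
  val⇒attack r p q eq = trans (attack-lhs r p q) (a≡b⇒a-b≡0 {val r p} {val r q} eq)

  fixation⇒side : ∀ k p → dot (sideα B k) p ≡ sideβ B k → sideVal B k p ≡ 0ℚ
  fixation⇒side k p eq = trans (cross-dot (edge k) p (corner k))
    (a≡b⇒a-b≡0 {dot (sideα B k) p} {sideβ B k} eq)

  side⇒fixation : ∀ k p → sideVal B k p ≡ 0ℚ → dot (sideα B k) p ≡ sideβ B k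
  side⇒fixation k p eq = a-b≡0⇒a≡b {dot (sideα B k) p} {sideβ B k}
    (trans (sym (cross-dot (edge k) p (corner k))) eq)

  Hyperplane : ℕ → Set
  Hyperplane q = Hyp B P q

  Sats : ∀ {q} → Hyperplane q → (Fin q → Pt) → Set
  Sats = Sat B P

  fullRank⇒rigid : ∀ {q} (z : Fin q → Pt) → FullRank B P z → Rigid (Image z)
  fullRank⇒rigid z full f (att , fix) p (i , refl) = full (λ i → f (z i)) preserved i
    where
    preserved : ∀ h → Sats h z → Sats h (λ i → f (z i))
    preserved (attack r i j _) sat = val⇒attack r (f (z i)) (f (z j))
      (att r (z i) (z j) (i , refl) (j , refl) (attack⇒val r (z i) (z j) sat))
    preserved (fixation k i) sat = side⇒fixation k (f (z i)) (fix k (z i) (i , refl) (fixation⇒side k (z i) sat))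

  rigid⇒fullRank : ∀ {q} (z : Fin q → Pt) → Rigid (Image z) → FullRank B P z
  rigid⇒fullRank z rigid w preserved i = trans (sym (f-on i)) (rigid f (att , fix) (z i) (i , refl))
    where
    val-w : ∀ r i j → val r (z i) ≡ val r (z j) → val r (w i) ≡ val r (w j)
    val-w r i j eq = cases (i Fin.≟ j)
      where
      cases : Dec (i ≡ j) → val r (w i) ≡ val r (w j)
      cases (yes refl) = refl
      cases (no i≢j) = attack⇒val r (w i) (w j) (preserved (attack r i j i≢j) (val⇒attack r (z i) (z j) eq))
    same : ∀ i j → z i ≡ z j → w i ≡ w j
    same i j eq = vals-determine mv₁ {w i} {w j} (val-w mv₁ i j (cong (val mv₁) eq)) (val-w mv₂ i j (cong (val mv₂) eq))
    choose : ∀ p → Dec (Image z p) → Pt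
    choose p (yes (i , _)) = w i
    -- A default off the configuration, where nothing is required of f.
    choose p (no _) = p
    f : Pt → Pt
    f p = choose p (Finₚ.any? λ i → z i ≟ᵖ p)
    choose-on : ∀ i dec → choose (z i) dec ≡ w i
    choose-on i (yes (j , eq)) = same j i eq
    choose-on i (no none) = contradiction (i , refl) none
    f-on : ∀ i → f (z i) ≡ w i
    f-on i = choose-on i (Finₚ.any? λ j → z j ≟ᵖ z i)
    att : AttackPreserving (Image z) f
    att r p p′ (i , refl) (j , refl) eq =
      trans (cong (val r) (f-on i)) (trans (val-w r i j eq) (cong (val r) (sym (f-on j))))
    fix : FixationPreserving (Image z) f
    fix k p (i , refl) eq = trans (cong (sideVal B k) (f-on i))
      (fixation⇒side k (w i) (preserved (fixation k i) (side⇒fixation k (z i) eq)))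

  Sats? : ∀ {q} (z : Fin q → Pt) (h : Hyperplane q) → Dec (Sats h z)
  Sats? z (attack r i j _) = dot (z i -ᵖ z j) (normal P r) ℚₚ.≟ 0ℚ
  Sats? z (fixation k i) = dot (sideα B k) (z i) ℚₚ.≟ sideβ B k

  attackList : ∀ {q} → Move → Fin q → Fin q → List (Hyperplane q)
  attackList r i j with i Fin.≟ j
  ... | yes _ = []
  ... | no i≢j = attack r i j i≢j ∷ []

  attacksOf : ∀ {q} → Move → List (Hyperplane q)
  attacksOf {q} r = concatMap (λ i → concatMap (attackList r i) (allFin q)) (allFin q)

  fixationsOf : ∀ {q} → Fin n → List (Hyperplane q)
  fixationsOf {q} k = map (fixation k) (allFin q)

  hyperplanes : ∀ q → List (Hyperplane q)
  hyperplanes q = concatMap attacksOf (mv₁ ∷ mv₂ ∷ []) ++ concatMap fixationsOf (allFin n)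

  -- Equal solution sets. An attack carries a proof of i ≢ j, and the listed copy may carry a
  -- different one, so completeness of the list is stated up to this relation.
  _≈ₕ_ : ∀ {q} → Hyperplane q → Hyperplane q → Set
  h ≈ₕ h′ = ∀ w → (Sats h w → Sats h′ w) × (Sats h′ w → Sats h w)

  move∈ : ∀ r → r ∈ mv₁ ∷ mv₂ ∷ []
  move∈ mv₁ = here refl
  move∈ mv₂ = there (here refl)

  hyperplanes-complete : ∀ {q} (h : Hyperplane q) → ∃[ h′ ] h′ ∈ hyperplanes q × h ≈ₕ h′
  hyperplanes-complete {q} (attack r i j i≢j) = let (i≢j′ , h∈) = listed in
      attack r i j i≢j′ ,
      ∈-++⁺ˡ (∈-concatMap⁺ attacksOf (lose (move∈ r)
        (∈-concatMap⁺ (λ i → concatMap (attackList r i) (allFin q)) (lose (∈-allFin i)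
          (∈-concatMap⁺ (attackList r i) (lose (∈-allFin j) h∈)))))) ,
      λ w → (λ s → s) , (λ s → s)
    where
    listed : ∃[ i≢j′ ] attack r i j i≢j′ ∈ attackList r i j
    listed with i Fin.≟ j
    ... | yes i≡j = contradiction i≡j i≢j
    ... | no i≢j′ = i≢j′ , here refl
  hyperplanes-complete {q} (fixation k i) = fixation k i ,
    ∈-++⁺ʳ (concatMap attacksOf (mv₁ ∷ mv₂ ∷ [])) (∈-concatMap⁺ fixationsOf (lose (∈-allFin k) (∈-map⁺ (fixation k) (∈-allFin i)))) ,
    λ w → (λ s → s) , (λ s → s)

  through : ∀ {q} → (Fin q → Pt) → List (Hyperplane q)
  through {q} z = filter (Sats? z) (hyperplanes q)

  through-determines : ∀ {q} (z w : Fin q → Pt) → All (λ h → Sats h w) (through z) → ∀ h → Sats h z → Sats h w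
  through-determines {q} z w sat h hz = conclude (hyperplanes-complete h)
    where
    conclude : ∃[ h′ ] h′ ∈ hyperplanes q × h ≈ₕ h′ → Sats h w
    conclude (h′ , h′∈ , h≈h′) = proj₂ (h≈h′ w) (All.lookup sat (∈-filter⁺ (Sats? z) h′∈ (proj₁ (h≈h′ z) hz)))

  vertex⇒fullRank : ∀ {q} (z : Fin q → Pt) → Vertex B P z → FullRank B P z
  vertex⇒fullRank z (_ , C , sat , uniq) w preserved = uniq w (All.map (λ {h} → preserved h) sat)

  fullRank⇒vertex : ∀ {q} (z : Fin q → Pt) → (∀ i → InB B (z i)) → FullRank B P z → Vertex B P z
  fullRank⇒vertex {q} z z∈B full = z∈B , through z , Allₚ.all-filter (Sats? z) (hyperplanes q) ,
    λ w sat → full w (through-determines z w sat)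

-- Enumeration of the vertices

powerlist : {A : Set} → List A → List (List A)
powerlist []       = [] ∷ []
powerlist (x ∷ xs) = map (x ∷_) (powerlist xs) ++ powerlist xs

filter∈powerlist : {A : Set} {Q : A → Set} (Q? : ∀ x → Dec (Q x)) (xs : List A) → filter Q? xs ∈ powerlist xs
filter∈powerlist Q? [] = here refl
filter∈powerlist Q? (x ∷ xs) with Q? x
... | yes _ = ∈-++⁺ˡ (∈-map⁺ (x ∷_) (filter∈powerlist Q? xs))
... | no _  = ∈-++⁺ʳ (map (x ∷_) (powerlist xs)) (filter∈powerlist Q? xs)

-- This is 2q, defined by recursion so that each piece is definitionally two entries of the vector.
dimension : ℕ → ℕ
dimension zero = zero
dimension (suc q) = suc (suc (dimension q))

flatten : ∀ {q} → (Fin q → Pt) → Vec ℚ (dimension q)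
flatten {zero}  z = []
flatten {suc q} z = proj₁ (z zero) ∷ proj₂ (z zero) ∷ flatten (z ∘ suc)

unflatten : ∀ {q} → Vec ℚ (dimension q) → Fin q → Pt
unflatten (x ∷ y ∷ v) zero    = x , y
unflatten (x ∷ y ∷ v) (suc i) = unflatten v i

unflatten-flatten : ∀ {q} (z : Fin q → Pt) i → unflatten (flatten z) i ≡ z i
unflatten-flatten z zero    = refl
unflatten-flatten z (suc i) = unflatten-flatten (z ∘ suc) i

flatten-unflatten : ∀ {q} (v : Vec ℚ (dimension q)) → flatten {q} (unflatten v) ≡ v
flatten-unflatten {zero}  []          = refl
flatten-unflatten {suc q} (x ∷ y ∷ v) = cong (λ v → x ∷ y ∷ v) (flatten-unflatten v)

zeros : ∀ N → Vec ℚ N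
zeros N = Vec.replicate N 0ℚ

zeros-∙ : ∀ {N} (v : Vec ℚ N) → zeros N ∙ v ≡ 0ℚ
zeros-∙ [] = refl
zeros-∙ (x ∷ v) = trans (cong (0ℚ * x +_) (zeros-∙ v)) (solve 1 (λ x → con 0ℚ :* x :+ con 0ℚ := con 0ℚ) refl x)

single-coefficients : ∀ {q} → Fin q → Pt → Vec ℚ (dimension q)
single-coefficients {suc q} zero    (a , b) = a ∷ b ∷ zeros (dimension q)
single-coefficients         (suc i) u       = 0ℚ ∷ 0ℚ ∷ single-coefficients i u

single-coefficients-∙ : ∀ {q} (i : Fin q) u z → single-coefficients i u ∙ flatten z ≡ dot u (z i)
single-coefficients-∙ zero (a , b) z = trans (cong (λ s → a * proj₁ (z zero) + (b * proj₂ (z zero) + s)) (zeros-∙ (flatten (z ∘ suc))))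
  (cong (a * proj₁ (z zero) +_) (ℚₚ.+-identityʳ (b * proj₂ (z zero))))
single-coefficients-∙ (suc i) u z = trans
  (solve 3 (λ x y s → con 0ℚ :* x :+ (con 0ℚ :* y :+ s) := s) refl
    (proj₁ (z zero)) (proj₂ (z zero)) (single-coefficients i u ∙ flatten (z ∘ suc)))
  (single-coefficients-∙ i u (z ∘ suc))

module Enumeration (B : Board) (P : Piece) where
  open Configurations B P

  equation : ∀ {q} → Hyperplane q → Equation (dimension q)
  equation (attack r i j _) = single-coefficients i (normal P r) ⊕ single-coefficients j (negᵖ (normal P r)) , 0ℚ
  equation (fixation k i)   = single-coefficients i (sideα B k) , sideβ B k

  attack-equation : ∀ {q} (z : Fin q → Pt) i j u →
    (single-coefficients i u ⊕ single-coefficients j (negᵖ u)) ∙ flatten z ≡ dot (z i -ᵖ z j) u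
  attack-equation z i j u = trans (∙-⊕ (single-coefficients i u) (single-coefficients j (negᵖ u)) (flatten z)) (trans
    (cong₂ _+_ (trans (single-coefficients-∙ i u z) (dot-comm u (z i)))
               (trans (single-coefficients-∙ j (negᵖ u) z) (trans (dot-negˡ u (z j)) (cong -_ (dot-comm u (z j))))))
    (sym (dot-diff (z i) (z j) u)))

  sat⇒solves : ∀ {q} (h : Hyperplane q) z → Sats h z → Solves (flatten z) (equation h)
  sat⇒solves (attack r i j _) z sat = trans (attack-equation z i j (normal P r)) sat
  sat⇒solves (fixation k i)   z sat = trans (single-coefficients-∙ i (sideα B k) z) sat

  solves⇒sat : ∀ {q} (h : Hyperplane q) z → Solves (flatten z) (equation h) → Sats h z
  solves⇒sat (attack r i j _) z sol = trans (sym (attack-equation z i j (normal P r))) sol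
  solves⇒sat (fixation k i)   z sol = trans (sym (single-coefficients-∙ i (sideα B k) z)) sol

  allInB? : ∀ {q} (z : Fin q → Pt) → Dec (∀ i → InB B (z i))
  allInB? z = Finₚ.all? λ i → InB? (z i)

  -- The decision is an argument so that the proofs can distinguish its cases.
  solutionVertex : ∀ {q} (S : List (Hyperplane q)) → Dec (∃[ x ] UniqueSolution (map equation S) x) → List (Fin q → Pt)
  solutionVertex S (no _) = []
  solutionVertex S (yes (x , _)) with allInB? (unflatten x)
  ... | yes _ = unflatten x ∷ []
  ... | no _ = []

  verticesOn : ∀ {q} → List (Hyperplane q) → List (Fin q → Pt)
  verticesOn S = solutionVertex S (uniqueSolution? (map equation S))

  vertices : ∀ q → List (Fin q → Pt)
  vertices q = concatMap verticesOn (powerlist (hyperplanes q))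

  solutionVertex-sound : ∀ {q} (S : List (Hyperplane q)) dec {z} → z ∈ solutionVertex S dec → Vertex B P z
  solutionVertex-sound {q} S (yes (x , sat , uniq)) z∈ with allInB? (unflatten {q} x)
  solutionVertex-sound {q} S (yes (x , sat , uniq)) (here refl) | yes z∈B = z∈B , S ,
      All.map (λ {h} sol → solves⇒sat h (unflatten x) (subst (λ v → Solves v (equation h)) (sym (flatten-unflatten x)) sol)) (Allₚ.map⁻ sat) ,
      λ w satw i → trans (sym (unflatten-flatten w i))
        (cong (λ v → unflatten v i) (uniq (flatten w) (Allₚ.map⁺ (All.map (λ {h} → sat⇒solves h w) satw))))

  vertices-sound : ∀ {q} {z : Fin q → Pt} → z ∈ vertices q → Vertex B P z
  vertices-sound {q} z∈ with find (∈-concatMap⁻ verticesOn {xs = powerlist (hyperplanes q)} z∈)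
  ... | S , _ , z∈S = solutionVertex-sound S (uniqueSolution? (map equation S)) z∈S

  -- The hyperplanes through z are a filtered part of the full list, hence an entry of its
  -- `powerlist`, and by full rank z is their only solution. Configurations are functions, so
  -- agreement is pointwise.
  vertices-complete : ∀ {q} (z : Fin q → Pt) → Vertex B P z → ∃[ z′ ] z′ ∈ vertices q × (∀ i → z′ i ≡ z i)
  vertices-complete {q} z V = found (uniqueSolution? (map equation S)) refl
    where
    S : List (Hyperplane q)
    S = through z
    unique : UniqueSolution (map equation S) (flatten z)
    unique = Allₚ.map⁺ (All.map (λ {h} → sat⇒solves h z) (Allₚ.all-filter (Sats? z) (hyperplanes q))) ,
      λ y sol → trans (sym (flatten-unflatten y)) (cong-flatten (vertex⇒fullRank z V (unflatten y)
        (through-determines z (unflatten y) (All.map (λ {h} s → solves⇒sat h (unflatten y)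
          (subst (λ v → Solves v (equation h)) (sym (flatten-unflatten y)) s)) (Allₚ.map⁻ sol)))))
      where
      cong-flatten : ∀ {q} {w z : Fin q → Pt} → (∀ i → w i ≡ z i) → flatten w ≡ flatten z
      cong-flatten {zero} eq = refl
      cong-flatten {suc q} eq = cong₂ (λ p v → proj₁ p ∷ proj₂ p ∷ v) (eq zero) (cong-flatten (eq ∘ suc))
    found : (dec : Dec (∃[ x ] UniqueSolution (map equation S) x)) → uniqueSolution? (map equation S) ≡ dec →
            ∃[ z′ ] z′ ∈ vertices q × (∀ i → z′ i ≡ z i)
    found (no none) _ = contradiction (flatten z , unique) none
    found (yes (x , sat , uniq)) eq = unflatten x , ∈-concatMap⁺ verticesOn (lose (filter∈powerlist (Sats? z) (hyperplanes q))
        (subst (λ dec → unflatten x ∈ solutionVertex S dec) (sym eq) listed)) , agrees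
      where
      agrees : ∀ i → unflatten x i ≡ z i
      agrees i = trans (cong (λ v → unflatten v i) (sym (uniq (flatten z) (proj₁ unique)))) (unflatten-flatten z i)
      listed : unflatten x ∈ solutionVertex S (yes (x , sat , uniq))
      listed with allInB? (unflatten {q} x)
      ... | yes _ = here refl
      ... | no ¬inB = contradiction (λ i → subst (InB B) (sym (agrees i)) (proj₁ V i)) ¬inB

-- Denominators and least common multiples

denPt∣denConf : ∀ {q} (z : Fin q → Pt) i → denPt (z i) ∣ denConf z
denPt∣denConf {suc q} z zero = m∣lcm[m,n] (denPt (z zero)) (denConf (z ∘ suc))
denPt∣denConf {suc q} z (suc i) = ∣-trans (denPt∣denConf (z ∘ suc) i) (n∣lcm[m,n] (denPt (z zero)) (denConf (z ∘ suc)))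

denConf-least : ∀ {q} (z : Fin q → Pt) {M} → (∀ i → denPt (z i) ∣ M) → denConf z ∣ M
denConf-least {zero} z all∣ = 1∣ _
denConf-least {suc q} z all∣ = lcm-least (all∣ zero) (denConf-least (z ∘ suc) (all∣ ∘ suc))

lcmList : List ℕ → ℕ
lcmList = foldr lcm 1

∈⇒∣lcmList : ∀ {m ms} → m ∈ ms → m ∣ lcmList ms
∈⇒∣lcmList {ms = m ∷ ms} (here refl) = m∣lcm[m,n] m (lcmList ms)
∈⇒∣lcmList {ms = m′ ∷ ms} (there m∈) = ∣-trans (∈⇒∣lcmList m∈) (n∣lcm[m,n] m′ (lcmList ms))

lcmList-least : ∀ {ms M} → All (_∣ M) ms → lcmList ms ∣ M
lcmList-least [] = 1∣ _
lcmList-least (m∣ ∷ ms∣) = lcm-least m∣ (lcmList-least ms∣)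

vertex-lcm : ∀ B P q → ∃[ D ] IsLcmOf (VertexDen B P q) D
vertex-lcm B P q = lcmList (map denConf (vertices q)) , upper , least
  where
  open Enumeration B P
  upper : ∀ m → VertexDen B P q m → m ∣ lcmList (map denConf (vertices q))
  upper m (z , V , refl) with vertices-complete z V
  ... | z′ , z′∈ , z′≗z = denConf-least z λ i → subst (λ p → denPt p ∣ lcmList (map denConf (vertices q))) (z′≗z i)
          (∣-trans (denPt∣denConf z′ i) (∈⇒∣lcmList (∈-map⁺ denConf z′∈)))
  least : ∀ M → (∀ m → VertexDen B P q m → m ∣ M) → lcmList (map denConf (vertices q)) ∣ M
  least M all∣ = lcmList-least (Allₚ.map⁺ (All.tabulate λ {z} z∈ → all∣ (denConf z) (z , vertices-sound z∈ , refl)))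

-- Special points and vertices

module Correspondence (B : Board) (P : Piece) where
  open Board B
  open Configurations B P

  step⇒link : ∀ {r b b′} → OnBoundary B b → Step B P r b b′ → Link r b b′
  step⇒link {r} {b} bb (bb′ , b′≢b , (l , eq) , (μ , o°)) =
    link bb bb′ (λ e → b′≢b (sym e)) (sym (trans (cong (val r) eq) (val-move r b l)))
      (b +ᵖ (μ ·ᵖ move P r)) o° (val-move r b μ)

  link⇒step : ∀ {r b b′} → Link r b b′ → Step B P r b b′
  link⇒step {r} {b} {b′} (link bb bb′ b≢b′ eq o o° oa) = bb′ , (λ e → b≢b′ (sym e)) , on-line r b b′ eq ,
    (let (μ , o≡) = on-line r b o (sym oa) in μ , subst (Interior B) o≡ o°)

  step-val : ∀ {r b b′} → Step B P r b b′ → val r b′ ≡ val r b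
  step-val {r} {b} (_ , _ , (l , eq) , _) = trans (cong (val r) eq) (val-move r b l)

  path⇒chain : ∀ {s r x xs} → Path s r x xs → AltChain B P r (x ∷ xs)
  path⇒chain (single _) = tt
  path⇒chain (step {r} {x} {y} l p) = link⇒step {r} {x} {y} l , path⇒chain p

  path⇒outMove : ∀ {s r x xs} → Path s r x xs → outMove B P r (x ∷ xs) ≡ s
  path⇒outMove (single _) = refl
  path⇒outMove (step l p) = path⇒outMove p

  chain⇒path : ∀ r x xs → All (OnBoundary B) (x ∷ xs) → AltChain B P r (x ∷ xs) → Path (outMove B P r (x ∷ xs)) r x xs
  chain⇒path r x [] (bx ∷ []) _ = single bx
  chain⇒path r x (y ∷ ys) (bx ∷ bs) (st , chain) = step (step⇒link bx st) (chain⇒path (other r) y ys bs chain)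

  path⇒trajectory : ∀ {s r x xs} → Path s r x xs → Unique (x ∷ xs) → TrajectoryFrom B P r x xs
  path⇒trajectory p u = u , path-boundary p , path⇒chain p

  trajectory⇒path : ∀ {r x xs} → TrajectoryFrom B P r x xs → Path (outMove B P r (x ∷ xs)) r x xs
  trajectory⇒path {r} {x} {xs} (_ , bs , chain) = chain⇒path r x xs bs chain

  IsCorner? : ∀ p → Dec (IsCorner B p)
  IsCorner? p = Finₚ.any? λ k → corner k ≟ᵖ p

  -- From special points to vertices

  Contained : List Pt → Set
  Contained L = ∀ {p} → p ∈ L → InB B p

  boundary⇒contained : ∀ {L} → All (OnBoundary B) L → Contained L
  boundary⇒contained bs p∈ = proj₁ (All.lookup bs p∈)

  Rigid-⊆ : ∀ {X Y} → (∀ {p} → X p → Y p) → (∀ {p} → Y p → X p) → Rigid X → Rigid Y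
  Rigid-⊆ {X} {Y} X⊆Y Y⊆X rigid f resp p yp = rigid f (Respects-⊆ Y X f X⊆Y resp) p (Y⊆X yp)

  rigidCycle⇒rigid : ∀ {L} → RigidCycle B P L → Rigid (_∈ L) × Contained L
  rigidCycle⇒rigid {x ∷ xs} ((_ , r , (_ , bs , _) , _) , full) =
    Rigid-⊆ image-lookup⇒∈ ∈⇒image-lookup (fullRank⇒rigid (lookup (x ∷ xs)) full) , boundary⇒contained bs

  cornerTrajectory⇒rigid : ∀ {L} → CornerTrajectory B P L → Rigid (_∈ L) × Contained L
  cornerTrajectory⇒rigid {x ∷ xs} ((r , tr) , corner∈) =
    corner-path-rigid (trajectory⇒path {r} tr) corner∈ , boundary⇒contained (proj₁ (proj₂ tr))

  cornerOrRigid⇒rigid : ∀ {L} → CornerOrRigid B P L → Rigid (_∈ L) × Contained L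
  cornerOrRigid⇒rigid (inj₁ corner) = cornerTrajectory⇒rigid corner
  cornerOrRigid⇒rigid (inj₂ cycle) = rigidCycle⇒rigid cycle

  -- What a crossing point needs of a segment. The end points added by an augmentation may lie
  -- outside X, but their segments lie on lines through places of X.
  AlignedWith : (Pt → Set) → Pt × Pt → Set
  AlignedWith X (a , b) = ∃[ r ] ∃[ x ] X x × val r a ≡ val r x × val r b ≡ val r x

  AlignedWith-⊆ : ∀ X Y s → (∀ {p} → X p → Y p) → AlignedWith X s → AlignedWith Y s
  AlignedWith-⊆ X Y s X⊆Y (r , x , xx , eqs) = r , x , X⊆Y xx , eqs

  aligned-post : ∀ r x xs post → AltChain B P r (x ∷ xs) → Neighbour B P (outMove B P r (x ∷ xs)) (last x xs) post →
                 ∀ {s} → s ∈ segs (x ∷ xs ++ post) → AlignedWith (_∈ x ∷ xs) s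
  aligned-post r x [] _ _ (inj₁ (b′ , st , refl)) (here refl) = r , x , here refl , refl , step-val {r} {x} {b′} st
  aligned-post r x [] _ _ (inj₂ (_ , refl)) ()
  aligned-post r x (y ∷ ys) post (st , chain) nb (here refl) = r , x , here refl , refl , step-val {r} {x} {y} st
  aligned-post r x (y ∷ ys) post (st , chain) nb {s} (there s∈) =
    AlignedWith-⊆ (_∈ y ∷ ys) (_∈ x ∷ y ∷ ys) s there (aligned-post (other r) y ys post chain nb s∈)

  augmentation-aligned : ∀ {L A} → Augmentation B P L A → ∀ {s} → s ∈ segs A → AlignedWith (_∈ L) s
  augmentation-aligned {x ∷ xs} (r , (_ , _ , chain) , pre , post , inj₁ (b′ , st , refl) , nb , refl) (here refl) =
    other r , x , here refl , step-val {other r} {x} {b′} st , refl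
  augmentation-aligned {x ∷ xs} (r , (_ , _ , chain) , pre , post , inj₁ (b′ , st , refl) , nb , refl) (there s∈) =
    aligned-post r x xs post chain nb s∈
  augmentation-aligned {x ∷ xs} (r , (_ , _ , chain) , pre , post , inj₂ (_ , refl) , nb , refl) s∈ =
    aligned-post r x xs post chain nb s∈

  segment-val : ∀ r p a b v → val r a ≡ v → val r b ≡ v → OnSegment B P p (a , b) → val r p ≡ v
  segment-val r p a b v av bv (t , _ , _ , eq) = trans (cong (val r) eq) (trans (val-line r a (b -ᵖ a) t)
    (trans (cong (λ d → val r a + t * d) (val-diff r b a)) (collapse (val r a) (val r b) t av bv)))
    where
    collapse : ∀ x y t → x ≡ v → y ≡ v → x + t * (y - x) ≡ v
    collapse x y t refl refl = solve 2 (λ x t → x :+ t :* (x :- x) := x) refl x t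

  -- Each segment lies on a line through a fixed place along a move. The segments are not parallel,
  -- so the moves differ and both line coordinates of p are fixed.
  crossing-fixed : ∀ {X f A₁ A₂ p} → (∀ {s} → s ∈ segs A₁ → AlignedWith X s) → (∀ {s} → s ∈ segs A₂ → AlignedWith X s) →
                   CrossingPoint B P A₁ A₂ p → AttackPreserving (λ x → x ≡ p ⊎ X x) f → (∀ x → X x → f x ≡ x) → f p ≡ p
  crossing-fixed {X} {f} {p = p} al₁ al₂ (_ , (a , b) , (c , d) , s₁∈ , s₂∈ , on₁ , on₂ , ∦) att fixed =
    conclude (al₁ s₁∈) (al₂ s₂∈)
    where
    val-f : ∀ r x → X x → val r p ≡ val r x → val r (f p) ≡ val r p
    val-f r x xx eq = trans (att r p x (inj₁ refl) (inj₂ xx) eq) (trans (cong (val r) (fixed x xx)) (sym eq))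
    conclude : AlignedWith X (a , b) → AlignedWith X (c , d) → f p ≡ p
    conclude (r , x , xx , ax , bx) (r′ , y , yy , cy , dy) with same-or-other r′ r
    ... | inj₁ refl = contradiction (parallel-trans (move P r) (b -ᵖ a) (d -ᵖ c) (m≢0 r)
            (cross-val r b a (trans bx (sym ax))) (cross-val r d c (trans dy (sym cy)))) ∦
    ... | inj₂ refl = vals-determine r {f p} {p} (val-f r x xx (segment-val r p a b (val r x) ax bx on₁))
            (val-f (other r) y yy (segment-val (other r) p c d (val (other r) y) cy dy on₂))

  rigid-crossing : ∀ L {A₁ A₂ p} → Rigid (_∈ L) → (∀ {s} → s ∈ segs A₁ → AlignedWith (_∈ L) s) →
                   (∀ {s} → s ∈ segs A₂ → AlignedWith (_∈ L) s) → CrossingPoint B P A₁ A₂ p → Rigid (_∈ p ∷ L)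
  rigid-crossing L {A₁} {A₂} {p} rigid al₁ al₂ cr f resp = fixed
    where
    fixed-L : ∀ x → x ∈ L → f x ≡ x
    fixed-L = rigid f (Respects-⊆ (_∈ p ∷ L) (_∈ L) f there resp)
    attach : ∀ {x} → x ≡ p ⊎ x ∈ L → x ∈ p ∷ L
    attach (inj₁ eq) = here eq
    attach (inj₂ x∈) = there x∈
    fixed : ∀ x → x ∈ p ∷ L → f x ≡ x
    fixed x (here refl) = crossing-fixed {_∈ L} {f} {A₁} {A₂} {p} al₁ al₂ cr
      (λ r a b a∈ b∈ → proj₁ resp r a b (attach a∈) (attach b∈)) fixed-L
    fixed x (there x∈) = fixed-L x x∈

  rigid-++ : ∀ L₁ L₂ → Rigid (_∈ L₁) → Rigid (_∈ L₂) → Rigid (_∈ L₁ ++ L₂)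
  rigid-++ L₁ L₂ rigid₁ rigid₂ f resp x x∈ with ∈-++⁻ L₁ x∈
  ... | inj₁ x∈₁ = rigid₁ f (Respects-⊆ (_∈ L₁ ++ L₂) (_∈ L₁) f ∈-++⁺ˡ resp) x x∈₁
  ... | inj₂ x∈₂ = rigid₂ f (Respects-⊆ (_∈ L₁ ++ L₂) (_∈ L₂) f (∈-++⁺ʳ L₁) resp) x x∈₂

  RealizedAt : ℕ → Pt → Set
  RealizedAt q p = ∃[ z ] Vertex B P {q} z × Image z p

  rigid⇒realized : ∀ {q} L {p} → Rigid (_∈ L) → Contained L → length L ℕ.≤ q → p ∈ L → RealizedAt q p
  rigid⇒realized {q} (y ∷ ys) rigid inB le p∈ =
      z , fullRank⇒vertex z (λ i → inB (z∈L i)) (rigid⇒fullRank z (Rigid-⊆ (λ x∈ → ∈-pad y (y ∷ ys) le x∈)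
        (λ { (i , refl) → z∈L i }) rigid)) , ∈-pad y (y ∷ ys) le p∈
    where
    z : Fin q → Pt
    z = pad y (y ∷ ys)
    z∈L : ∀ i → z i ∈ y ∷ ys
    z∈L i with pad∈ y (y ∷ ys) i
    ... | here eq = here eq
    ... | there x∈ = x∈

  contained-∷ : ∀ {p L} → Interior B p → Contained L → Contained (p ∷ L)
  contained-∷ {p} p° inB (here refl) = interior⇒InB p p°
  contained-∷ p° inB (there x∈) = inB x∈

  contained-++ : ∀ L₁ {L₂} → Contained L₁ → Contained L₂ → Contained (L₁ ++ L₂)
  contained-++ L₁ inB₁ inB₂ x∈ with ∈-++⁻ L₁ x∈
  ... | inj₁ x∈₁ = inB₁ x∈₁
  ... | inj₂ x∈₂ = inB₂ x∈₂

  special⇒realized : ∀ {q p} → SpecialPoint B P q p → RealizedAt q p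
  special⇒realized (inj₁ (L , cycle , le , p∈)) =
    let (rigid , inB) = rigidCycle⇒rigid cycle in rigid⇒realized L rigid inB le p∈
  special⇒realized (inj₂ (inj₁ (x ∷ xs , (tr , isC) , le , p∈))) =
    let (rigid , inB) = cornerTrajectory⇒rigid {x ∷ xs} (tr , here isC) in rigid⇒realized (x ∷ xs) rigid inB le p∈
  special⇒realized {p = p} (inj₂ (inj₂ (inj₁ (L , A , cr , le , aug , cross)))) =
    let (rigid , inB) = cornerOrRigid⇒rigid cr
    in rigid⇒realized (p ∷ L) (rigid-crossing L {A} {A} rigid (augmentation-aligned aug) (augmentation-aligned aug) cross)
         (contained-∷ (proj₁ cross) inB) le (here refl)
  special⇒realized {q} {p} (inj₂ (inj₂ (inj₂ (L₁ , L₂ , A₁ , A₂ , _ , cr₁ , cr₂ , le , aug₁ , aug₂ , cross)))) =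
    let (rigid₁ , inB₁) = cornerOrRigid⇒rigid cr₁ ; (rigid₂ , inB₂) = cornerOrRigid⇒rigid cr₂
    in rigid⇒realized (p ∷ L₁ ++ L₂)
         (rigid-crossing (L₁ ++ L₂) {A₁} {A₂} (rigid-++ L₁ L₂ rigid₁ rigid₂)
           (λ {s} s∈ → AlignedWith-⊆ (_∈ L₁) (_∈ L₁ ++ L₂) s ∈-++⁺ˡ (augmentation-aligned aug₁ s∈))
           (λ {s} s∈ → AlignedWith-⊆ (_∈ L₂) (_∈ L₁ ++ L₂) s (∈-++⁺ʳ L₁) (augmentation-aligned aug₂ s∈)) cross)
         (contained-∷ (proj₁ cross) (contained-++ L₁ inB₁ inB₂))
         (subst (λ k → suc k ℕ.≤ q) (sym (Listₚ.length-++ L₁)) le) (here refl)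

  -- From vertices to special points

  record PathFrom (L : List Pt) (c : Pt) : Set where
    field
      {s r}  : Move
      rest   : List Pt
      path   : Path s r c rest
      unique : Unique (c ∷ rest)
      ⊆L     : ∀ {p} → p ∈ c ∷ rest → p ∈ L

  whole : ∀ {s r x xs} → Path s r x xs → Unique (x ∷ xs) → PathFrom (x ∷ xs) x
  whole {s} {r} {x} {xs} p u = record { s = s ; r = r ; rest = xs ; path = p ; unique = u ; ⊆L = λ p∈ → p∈ }

  enlarge : ∀ {L L′ c} → (∀ {p} → p ∈ L → p ∈ L′) → PathFrom L c → PathFrom L′ c
  enlarge L⊆L′ S = record { s = S.s ; r = S.r ; rest = S.rest ; path = S.path ; unique = S.unique ; ⊆L = λ p∈ → L⊆L′ (S.⊆L p∈) }
    where module S = PathFrom S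

  suffix : ∀ {s r x xs c} → Path s r x xs → Unique (x ∷ xs) → c ∈ x ∷ xs →
           Σ (PathFrom (x ∷ xs) c) λ S → last c (PathFrom.rest S) ≡ last x xs
  suffix p u (here refl) = whole p u , refl
  suffix (step l p) (_ ∷ u) (there c∈) = let (S , eq) = suffix p u c∈ in enlarge there S , eq

  -- Special points of kind (2) need a trajectory that starts at the corner c, while the chain may
  -- contain c anywhere. It is cut at c and the half towards b kept, reversed if b comes first.
  path-between : ∀ {s r x xs b c} → Path s r x xs → Unique (x ∷ xs) → b ∈ x ∷ xs → c ∈ x ∷ xs →
                 Σ (PathFrom (x ∷ xs) c) λ S → b ∈ c ∷ PathFrom.rest S
  path-between p u b∈ (here refl) = whole p u , b∈
  path-between {x = x} {xs} {c = c} p u (here refl) c∈@(there _) =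
    let (ys , p′ , end , perm) = reverse-path p
        (S , eq) = suffix p′ (Unique-resp-↭ (↭-sym perm) u) (↭ₚ.∈-resp-↭ (↭-sym perm) c∈)
    in enlarge (↭ₚ.∈-resp-↭ perm) S , subst (_∈ c ∷ PathFrom.rest S) (trans eq end) (last∈ c (PathFrom.rest S))
  path-between (step l p) (_ ∷ u) (there b∈) (there c∈) =
    let (S , b∈S) = path-between p u b∈ c∈ in enlarge there S , b∈S

  augment-neighbour : ∀ k a → OnBoundary B a → ∃[ N ] Neighbour B P k a N × (∀ b → Link k a b → N ≡ b ∷ [])
  augment-neighbour k a ba = build (successor k a ba)
    where
    build : (∃[ b ] Link k a b) ⊎ (∀ b → ¬ Link k a b) →
            ∃[ N ] Neighbour B P k a N × (∀ b → Link k a b → N ≡ b ∷ [])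
    build (inj₁ (b , l)) = b ∷ [] , inj₁ (b , link⇒step {k} {a} {b} l , refl) ,
      λ b′ l′ → cong (_∷ []) (Link-functional l l′)
    build (inj₂ none) = [] , inj₂ ((λ b st → none b (step⇒link {k} {a} {b} ba st)) , refl) , λ b l → contradiction l (none b)

  segs-++ˡ : ∀ x xs {ys s} → s ∈ segs (x ∷ xs) → s ∈ segs (x ∷ xs ++ ys)
  segs-++ˡ x (y ∷ ys) (here eq) = here eq
  segs-++ˡ x (y ∷ ys) (there s∈) = there (segs-++ˡ y ys s∈)

  last-seg : ∀ x xs b → (last x xs , b) ∈ segs (x ∷ xs ++ b ∷ [])
  last-seg x [] b = here refl
  last-seg x (y ∷ ys) b = there (last-seg y ys b)

  segs-++ʳ : ∀ {k a N} → Neighbour B P k a N → ∀ x xs {s} → s ∈ segs (x ∷ xs) → s ∈ segs (N ++ x ∷ xs)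
  segs-++ʳ (inj₁ (_ , _ , refl)) x xs s∈ = there s∈
  segs-++ʳ (inj₂ (_ , refl)) x xs s∈ = s∈

  -- By `neighbour`, a link that is not on the path starts at an end in its spare direction, and
  -- there it is the added segment. On a cycle the added points repeat the opposite ends.
  augment : ∀ {s r x xs} → Path s r x xs → Unique (x ∷ xs) →
            ∃[ A ] Augmentation B P (x ∷ xs) A × (∀ {b k c} → b ∈ x ∷ xs → Link k b c → Adjacent A b c)
  augment {s} {r} {x} {xs} p u =
    extended (augment-neighbour (other r) x (All.lookup (path-boundary p) (here refl)))
             (augment-neighbour s (last x xs) (All.lookup (path-boundary p) (last∈ x xs)))
    where
    extended : ∃[ N ] Neighbour B P (other r) x N × (∀ b → Link (other r) x b → N ≡ b ∷ []) →
               ∃[ N ] Neighbour B P s (last x xs) N × (∀ b → Link s (last x xs) b → N ≡ b ∷ []) →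
               ∃[ A ] Augmentation B P (x ∷ xs) A × (∀ {b k c} → b ∈ x ∷ xs → Link k b c → Adjacent A b c)
    extended (pre , nb , pre≡) (post , nb′ , post≡) = pre ++ (x ∷ xs) ++ post ,
        (r , path⇒trajectory p u , pre , post , nb ,
          subst (λ k → Neighbour B P k (last x xs) post) (sym (path⇒outMove p)) nb′ , refl) ,
        λ b∈ l → covered l (neighbour p b∈ l)
      where
      inside : ∀ {s} → s ∈ segs (x ∷ xs ++ post) → s ∈ segs (pre ++ (x ∷ xs) ++ post)
      inside = segs-++ʳ {other r} {x} {pre} nb x (xs ++ post)
      covered : ∀ {b k c} → Link k b c → Adjacent (x ∷ xs) b c ⊎ (b ≡ x × k ≡ other r) ⊎ (b ≡ last x xs × k ≡ s) →
                Adjacent (pre ++ (x ∷ xs) ++ post) b c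
      covered l (inj₁ (inj₁ bc∈)) = inj₁ (inside (segs-++ˡ x xs bc∈))
      covered l (inj₁ (inj₂ cb∈)) = inj₂ (inside (segs-++ˡ x xs cb∈))
      covered {c = c} l (inj₂ (inj₁ (refl , refl))) =
        inj₂ (subst (λ N → (c , x) ∈ segs (N ++ (x ∷ xs) ++ post)) (sym (pre≡ c l)) (here refl))
      covered {c = c} l (inj₂ (inj₂ (refl , refl))) =
        inj₁ (inside (subst (λ N → (last x xs , c) ∈ segs (x ∷ xs ++ N)) (sym (post≡ c l)) (last-seg x xs c)))

  record SegmentAlong (A : List Pt) (p : Pt) (r : Move) : Set where
    field
      start end : Pt
      listed    : (start , end) ∈ segs A
      through-p : OnSegment B P p (start , end)
      proper    : start ≢ end
      direction : val r start ≡ val r end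

  -- The line through b and the interior point p meets the boundary again at some c, possibly
  -- outside the configuration. The link from b to c is a segment of the augmentation, and p lies on
  -- it.
  segment-along : ∀ {L A} → All (OnBoundary B) L → (∀ {b k c} → b ∈ L → Link k b c → Adjacent A b c) →
                  ∀ r p b → Interior B p → b ∈ L → val r b ≡ val r p → SegmentAlong A p r
  segment-along {L} {A} bL adj r p b p° b∈ eq = conclude (opposite r p b p° (All.lookup bL b∈) (sym eq))
    where
    conclude : ∃[ c ] Link r b c → SegmentAlong A p r
    conclude (c , l) = orient (adj b∈ l)
      where
      seg : OnSeg p b c
      seg = between r {b} {c} p p° (Link.source l) (Link.target l) (Link.distinct l) (sym eq) (trans (sym eq) (Link.aligned l))
      orient : Adjacent A b c → SegmentAlong A p r
      orient (inj₁ bc∈) = record { start = b ; end = c ; listed = bc∈ ; through-p = seg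
        ; proper = Link.distinct l ; direction = Link.aligned l }
      orient (inj₂ cb∈) = record { start = c ; end = b ; listed = cb∈ ; through-p = OnSeg-sym {p} {b} {c} seg
        ; proper = λ e → Link.distinct l (sym e) ; direction = sym (Link.aligned l) }

  segments-cross : ∀ {A₁ A₂ p} → Interior B p → SegmentAlong A₁ p mv₁ → SegmentAlong A₂ p mv₂ → CrossingPoint B P A₁ A₂ p
  segments-cross p° S₁ S₂ = p° , (S₁.start , S₁.end) , (S₂.start , S₂.end) , S₁.listed , S₂.listed ,
      S₁.through-p , S₂.through-p , λ par → moves-independent P
        (parallel-trans v₂ (move P mv₁) (move P mv₂) (proper⇒≢0 S₂.proper)
          (cross-anti-zero (move P mv₁) v₂ (parallel-trans v₁ (move P mv₁) v₂ (proper⇒≢0 S₁.proper)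
            (cross-anti-zero (move P mv₁) v₁ (cross-val mv₁ S₁.end S₁.start (sym S₁.direction))) par))
          (cross-anti-zero (move P mv₂) v₂ (cross-val mv₂ S₂.end S₂.start (sym S₂.direction))))
    where
    module S₁ = SegmentAlong S₁
    module S₂ = SegmentAlong S₂
    v₁ v₂ : Pt
    v₁ = S₁.end -ᵖ S₁.start
    v₂ = S₂.end -ᵖ S₂.start
    proper⇒≢0 : ∀ {a b} → a ≢ b → b -ᵖ a ≢ (0ℚ , 0ℚ)
    proper⇒≢0 {a} {b} a≢b eq = a≢b (sym (p-q≡0⇒p≡q b a eq))

  module _ {q} (z : Fin q → Pt) (z∈B : ∀ i → InB B (z i)) (rigid : Rigid (Image z)) where

    classify : ∀ {b} (C : Component z b) → let open Component C in
               RigidCycle B P points ⊎ Any (IsCorner B) points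
    classify C = cases ending (Any.any? IsCorner? points)
      where
      open Component C
      rigid-points : Rigid (_∈ points)
      rigid-points = closed⇒rigid z z∈B points (path-boundary path) ⊆image (component-closed z C) rigid
      cyclic : ∀ {x xs} → Path s r x xs → s ≡ other r → Link s (last x xs) x → Unique (x ∷ xs) →
               CyclicalTrajectory B P (x ∷ xs)
      -- A link joins distinct points, so a single point does not close up; this gives the minimal
      -- length 2.
      cyclic {xs = []} p s≡ l u = contradiction refl (Link.distinct l)
      cyclic {x} {y ∷ ys} p s≡ l u = s≤s (s≤s z≤n) , r , path⇒trajectory p u , trans (path⇒outMove p) s≡ ,
        link⇒step {other r} {last x (y ∷ ys)} {x} (subst (λ k → Link k (last x (y ∷ ys)) x) s≡ l)
      cases : (s ≡ other r × Link s (last head rest) head ⊎ Stuck z (other r) head × Stuck z s (last head rest)) →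
              Dec (Any (IsCorner B) points) → RigidCycle B P points ⊎ Any (IsCorner B) points
      cases (inj₁ (s≡ , l)) _ = inj₁ (cyclic path s≡ l unique ,
        rigid⇒fullRank (lookup points) (Rigid-⊆ ∈⇒image-lookup image-lookup⇒∈ rigid-points))
      cases (inj₂ _) (yes corner∈) = inj₂ corner∈
      cases (inj₂ (stuck , stuck′)) (no none) = contradiction rigid-points
        (stuck⇒¬rigid z path unique ⊆image (Allₚ.¬Any⇒All¬ points none) stuck stuck′)

    cornerOrRigid : ∀ {b} (C : Component z b) → CornerOrRigid B P (Component.points C)
    cornerOrRigid C with classify C
    ... | inj₁ cycle = inj₂ cycle
    ... | inj₂ corner∈ = inj₁ ((Component.r C , path⇒trajectory (Component.path C) (Component.unique C)) , corner∈)

    boundary-special : ∀ b → Image z b → OnBoundary B b → SpecialPoint B P q b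
    boundary-special b b∈z bb = cases (classify C)
      where
      C : Component z b
      C = component z b bb b∈z
      open Component C
      cases : RigidCycle B P points ⊎ Any (IsCorner B) points → SpecialPoint B P q b
      cases (inj₁ cycle) = inj₁ (points , cycle , unique⊆image⇒length≤ z unique (All.lookup ⊆image) , contains)
      cases (inj₂ corner∈) with find corner∈
      ... | c , c∈ , isC with path-between path unique contains c∈
      ...   | S , b∈S = inj₂ (inj₁ (c ∷ S.rest , ((S.r , path⇒trajectory S.path S.unique) , isC) ,
                unique⊆image⇒length≤ z S.unique (λ p∈ → All.lookup ⊆image (S.⊆L p∈)) , b∈S))
        where module S = PathFrom S

    module _ (p : Pt) (p∈z : Image z p) (p° : Interior B p) where

      -- An interior p is one more distinct place besides the chains, which leaves at most q - 1 for
      -- their lengths.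
      interior∉ : ∀ {L} → All (OnBoundary B) L → All (p ≢_) L
      interior∉ bL = All.map (λ { (_ , ¬p°) refl → ¬p° p° }) bL

      one-trajectory : ∀ {b} (C : Component z b) b₁ b₂ → b₁ ∈ Component.points C → b₂ ∈ Component.points C →
                       val mv₁ b₁ ≡ val mv₁ p → val mv₂ b₂ ≡ val mv₂ p → SpecialPoint B P q p
      one-trajectory C b₁ b₂ b₁∈ b₂∈ eq₁ eq₂ = build (augment path unique)
        where
        open Component C
        bL : All (OnBoundary B) points
        bL = path-boundary path
        length≤ : suc (length points) ℕ.≤ q
        length≤ = unique⊆image⇒length≤ z {p ∷ points} (interior∉ bL ∷ unique) (All.lookup (p∈z ∷ ⊆image))
        build : ∃[ A ] Augmentation B P points A × (∀ {b k c} → b ∈ points → Link k b c → Adjacent A b c) →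
                SpecialPoint B P q p
        build (A , aug , adj) = inj₂ (inj₂ (inj₁ (points , A , cornerOrRigid C , length≤ , aug ,
          segments-cross {A} {A} {p} p° (segment-along {points} {A} bL adj mv₁ p b₁ p° b₁∈ eq₁)
            (segment-along {points} {A} bL adj mv₂ p b₂ p° b₂∈ eq₂))))

      two-trajectories : ∀ {b₁ b₂} (C₁ : Component z b₁) (C₂ : Component z b₂) → b₂ ∉ Component.points C₁ →
                         b₁ ∉ Component.points C₂ → val mv₁ b₁ ≡ val mv₁ p → val mv₂ b₂ ≡ val mv₂ p → SpecialPoint B P q p
      two-trajectories {b₁} {b₂} C₁ C₂ b₂∉ b₁∉ eq₁ eq₂ = build (augment C₁.path C₁.unique) (augment C₂.path C₂.unique)
        where
        module C₁ = Component C₁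
        module C₂ = Component C₂
        bL₁ : All (OnBoundary B) C₁.points
        bL₁ = path-boundary C₁.path
        bL₂ : All (OnBoundary B) C₂.points
        bL₂ = path-boundary C₂.path
        -- From a shared place, membership in the second chain would spread along the links of the
        -- first one as far as b₁.
        disjoint : ∀ {x} → x ∈ C₁.points × x ∈ C₂.points → ⊥
        disjoint (x∈₁ , x∈₂) = b₁∉ (spread (_∈ C₂.points) C₁.path
          (λ a∈ b∈ l a∈₂ → component-closed z C₂ a∈₂ (All.lookup C₁.⊆image b∈) l) x∈₁ x∈₂ C₁.contains)
        length≤ : suc (length C₁.points ℕ.+ length C₂.points) ℕ.≤ q
        length≤ = subst (λ k → suc k ℕ.≤ q) (Listₚ.length-++ C₁.points)
          (unique⊆image⇒length≤ z {p ∷ C₁.points ++ C₂.points}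
            (interior∉ (Allₚ.++⁺ bL₁ bL₂) ∷ Uniqueₚ.++⁺ C₁.unique C₂.unique disjoint)
            (All.lookup (p∈z ∷ Allₚ.++⁺ C₁.⊆image C₂.⊆image)))
        build : ∃[ A ] Augmentation B P C₁.points A × (∀ {b k c} → b ∈ C₁.points → Link k b c → Adjacent A b c) →
                ∃[ A ] Augmentation B P C₂.points A × (∀ {b k c} → b ∈ C₂.points → Link k b c → Adjacent A b c) →
                SpecialPoint B P q p
        build (A₁ , aug₁ , adj₁) (A₂ , aug₂ , adj₂) = inj₂ (inj₂ (inj₂ (C₁.points , C₂.points , A₁ , A₂ ,
          (λ eq → b₂∉ (subst (b₂ ∈_) (sym eq) C₂.contains)) , cornerOrRigid C₁ , cornerOrRigid C₂ , length≤ , aug₁ , aug₂ ,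
          segments-cross {A₁} {A₂} {p} p° (segment-along {C₁.points} {A₁} bL₁ adj₁ mv₁ p b₁ p° C₁.contains eq₁)
            (segment-along {C₂.points} {A₂} bL₂ adj₂ mv₂ p b₂ p° C₂.contains eq₂))))

      interior-special : SpecialPoint B P q p
      interior-special = conclude (interior-aligned z z∈B rigid p p∈z mv₁) (interior-aligned z z∈B rigid p p∈z mv₂)
        where
        conclude : ∃[ b ] Image z b × OnBoundary B b × val mv₁ b ≡ val mv₁ p →
                   ∃[ b ] Image z b × OnBoundary B b × val mv₂ b ≡ val mv₂ p → SpecialPoint B P q p
        conclude (b₁ , b₁∈z , bb₁ , eq₁) (b₂ , b₂∈z , bb₂ , eq₂) =
          cases (b₂ ∈? Component.points C₁) (b₁ ∈? Component.points C₂)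
          where
          C₁ : Component z b₁
          C₁ = component z b₁ bb₁ b₁∈z
          C₂ : Component z b₂
          C₂ = component z b₂ bb₂ b₂∈z
          cases : Dec (b₂ ∈ Component.points C₁) → Dec (b₁ ∈ Component.points C₂) → SpecialPoint B P q p
          cases (yes b₂∈) _ = one-trajectory C₁ b₁ b₂ (Component.contains C₁) b₂∈ eq₁ eq₂
          cases (no _) (yes b₁∈) = one-trajectory C₂ b₁ b₂ b₁∈ (Component.contains C₂) eq₁ eq₂
          cases (no b₂∉) (no b₁∉) = two-trajectories C₁ C₂ b₂∉ b₁∉ eq₁ eq₂

    vertex-special : ∀ i → SpecialPoint B P q (z i)
    vertex-special i with interior-or-boundary (z i) (z∈B i)
    ... | inj₁ p° = interior-special (z i) (i , refl) p°
    ... | inj₂ bp = boundary-special (z i) (i , refl) bp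

theorem5p11 : (B : Board) (P : Piece) (q : ℕ) → 1 ≤ q →
    Σ ℕ (λ D → IsLcmOf (VertexDen B P q) D × IsLcmOf (SpecialDen B P q) D)
theorem5p11 B P q _ = D , isLcm , upper , least
  where
  open Configurations B P
  open Correspondence B P
  D : ℕ
  D = proj₁ (vertex-lcm B P q)
  isLcm : IsLcmOf (VertexDen B P q) D
  isLcm = proj₂ (vertex-lcm B P q)
  upper : ∀ m → SpecialDen B P q m → m ∣ D
  upper m (p , special , refl) with special⇒realized special
  ... | z , V , i , refl = ∣-trans (denPt∣denConf z i) (proj₁ isLcm (denConf z) (z , V , refl))
  least : ∀ M → (∀ m → SpecialDen B P q m → m ∣ M) → D ∣ M
  least M all∣ = proj₂ isLcm M vertex∣
    where
    vertex∣ : ∀ m → VertexDen B P q m → m ∣ M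
    vertex∣ m (z , V , refl) = denConf-least z λ i → all∣ (denPt (z i))
      (z i , vertex-special z (proj₁ V) (fullRank⇒rigid z (vertex⇒fullRank z V)) i , refl)
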